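{- Let $P$ be a simplicial poset of rank $d$ with face ring $A_P$ over $\mathbb Q$, atoms $x_1,\dots,x_n$, and a fixed linear system of parameters $\theta_1,\dots,\theta_d\in(A_P)_1$ spanning $\Theta$ and generating the polynomial subring $\mathbb Q[\Theta]\subset A_P$. Assume: (1) every element of rank $d-1$ of $P$ lies below exactly two elements of rank $d$; (2) there are signs $\operatorname{sgn}(y)\in\{\pm1\}$ for the elements $y$ of rank $d$ such that $\sum_{\operatorname{rank}y=d}\operatorname{sgn}(y)\langle y\rangle$ is a cycle in the cellular chain complex $C_*(\Gamma(P);\mathbb Z)$. Then for every $\alpha\in A_P$ the element $$\operatorname{ind}_T(\alpha):=\sum_{\operatorname{rank}y=d}\frac{\operatorname{sgn}(y)\,\iota_y(\alpha)}{m(y)\prod_{i\in\mathcal A(y)}\theta_i(y)}$$ of the fraction field of $\mathbb Q[\Theta]$ actually lies in $\mathbb Q[\Theta]$.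
   Context: A simplicial poset is a finite poset $P$ with smallest element $\hat 0$ such that every interval $[\hat 0,y]$ is a boolean algebra; $y$ has rank $i$ if $[\hat 0,y]$ is the boolean algebra of subsets of an $i$-element set, and $\operatorname{rank}P$ is the maximal rank; rank-one elements are atoms. Face ring: if $P$ has elements $\hat 0,y_1,\dots,y_p$, $A_P=\mathbb Q[y_1,\dots,y_p]/\mathcal I_P$ where $\mathcal I_P$ is generated by $y_iy_j-(y_i\wedge y_j)\sum_z z$ ($z$ over all minimal upper bounds of $y_i,y_j$, sum $0$ if none; $\hat 0$ identified with $1$), graded by $\deg y_i=\operatorname{rank}y_i$. A linear system of parameters is a sequence of $d$ degree-one elements over whose generated subring $A_P$ is a finitely generated module. For $y$ of rank $d$, the epimorphism $A_P\to A_{[\hat 0,y]}$ (sending elements of $P$ not $\le y$ to $0$, others to themselves) restricts to an isomorphism $\mathbb Q[\Theta]\to A_{[\hat 0,y]}$, and $\iota_y\colon A_P\to\mathbb Q[\Theta]$ is the composite of this epimorphism with the inverse of that isomorphism. $\mathcal A(y)=\{i:x_i\le y\}$ (a $d$-element set) and $\theta_i(y)=\iota_y(x_i)$ for $i\in\mathcal A(y)$; these form a basis of $\Theta$. Orient $\Theta$ by the ordered basis $(\theta_1,\dots,\theta_d)$ and order $\mathcal A(y)=\{i_1,\dots,i_d\}$ so that $(\theta_{i_1}(y),\dots,\theta_{i_d}(y))$ is positively oriented; $m(y)>0$ is the determinant of the linear map sending this ordered basis to $(\theta_1,\dots,\theta_d)$. $\Gamma(P)$ is the CW complex obtained by taking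 for each $y\in P\setminus\{\hat 0\}$ a geometric simplex with face poset $[\hat 0,y]$ and gluing according to the order of $P$; its $(d-1)$-cells are the rank-$d$ elements and its $(d-2)$-cells the rank-$(d-1)$ elements. $\langle y\rangle$ denotes the $(d-1)$-cell $y$ oriented as the simplex with ordered vertices $(x_{i_1},\dots,x_{i_d})$, whose boundary is $\sum_k(-1)^{k-1}$ times its face omitting $x_{i_k}$ (each such face being the unique rank-$(d-1)$ element $z\le y$ with $\mathcal A(z)=\mathcal A(y)\setminus\{i_k\}$, with the induced vertex order). -}

module Defs where

open import Data.Bool using (Bool; true; false; T; _∧_; _∨_; not; if_then_else_)
open import Data.Nat as ℕ using (ℕ; zero; suc; _∸_; _<ᵇ_; _≡ᵇ_)
open import Data.Fin as Fin using (Fin; punchIn; toℕ)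
open import Data.Fin.Properties using (all?)
open import Data.Fin.Subset using (Subset; _⊆_)
open import Data.Integer as ℤ using (ℤ)
open import Data.Rational as ℚ using (ℚ; 0ℚ; 1ℚ)
open import Data.Bool.ListAction using (any; all)
open import Data.List as List using (List; []; _∷_; _++_; map; concatMap; allFin; filterᵇ; length)
open import Data.Product using (Σ; ∃; ∃-syntax; _×_; _,_)
open import Data.Sum using (_⊎_)
open import Relation.Nullary using (yes; no; does; ¬_)
open import Relation.Binary.PropositionalEquality using (_≡_)

-- Polynomials over ℚ in the variables indexed by Fin k.
-- A polynomial is a formal list of terms (coefficient , exponent vector);
-- two polynomials are equal (_≈P_) iff all their coefficients agree.

Mon : ℕ → Set
Mon k = Fin k → ℕ

Poly : ℕ → Set
Poly k = List (ℚ × Mon k)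

coeff : ∀ {k} → Poly k → Mon k → ℚ
coeff [] e = 0ℚ
coeff ((c , m) ∷ p) e with all? (λ i → m i ℕ.≟ e i)
... | yes _ = c ℚ.+ coeff p e
... | no _  = coeff p e

infix 4 _≈P_
_≈P_ : ∀ {k} → Poly k → Poly k → Set
p ≈P q = ∀ e → coeff p e ≡ coeff q e

0P : ∀ {k} → Poly k
0P = []

constP : ∀ {k} → ℚ → Poly k
constP c = (c , λ _ → 0) ∷ []

1P : ∀ {k} → Poly k
1P = constP 1ℚ

var : ∀ {k} → Fin k → Poly k
var i = (1ℚ , λ j → if does (i Fin.≟ j) then 1 else 0) ∷ []

infixl 6 _+P_ _-P_
infixl 7 _*P_

_+P_ : ∀ {k} → Poly k → Poly k → Poly k
_+P_ = _++_

scaleP : ∀ {k} → ℚ → Poly k → Poly k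
scaleP c = map (λ { (a , m) → (c ℚ.* a , m) })

_-P_ : ∀ {k} → Poly k → Poly k → Poly k
p -P q = p +P scaleP (ℚ.- 1ℚ) q

_*P_ : ∀ {k} → Poly k → Poly k → Poly k
p *P q = concatMap (λ { (a , m) → map (λ { (b , m') → (a ℚ.* b , λ i → m i ℕ.+ m' i) }) q }) p

sumP : ∀ {k} → List (Poly k) → Poly k
sumP = List.foldr _+P_ 0P

prodP : ∀ {k} → List (Poly k) → Poly k
prodP = List.foldr _*P_ 1P

powP : ∀ {k} → Poly k → ℕ → Poly k
powP p zero = 1P
powP p (suc n) = p *P powP p n

ΣF : ∀ {k} n → (Fin n → Poly k) → Poly k
ΣF n f = sumP (map f (allFin n))

ΠF : ∀ {k} n → (Fin n → Poly k) → Poly k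
ΠF n f = prodP (map f (allFin n))

evalP : ∀ {k l} → Poly k → (Fin k → Poly l) → Poly l
evalP {k} p s = sumP (map (λ { (c , m) → scaleP c (ΠF k (λ i → powP (s i) (m i))) }) p)

unitMon : ∀ {k} → Fin k → Mon k
unitMon j i = if does (j Fin.≟ i) then 1 else 0

InIdeal : ∀ {k} → (Poly k → Set) → Poly k → Set
InIdeal {k} G f =
  Σ ℕ λ r → Σ (Fin r → Poly k) λ h → Σ (Fin r → Poly k) λ g →
    (∀ i → G (g i)) × (f ≈P ΣF r (λ i → h i *P g i))

anyF : ∀ {N} → (Fin N → Bool) → Bool
anyF {N} f = any f (allFin N)

allF : ∀ {N} → (Fin N → Bool) → Bool
allF {N} f = all f (allFin N)

record BooleanInterval (N : ℕ) (le : Fin N → Fin N → Bool) (y : Fin N) (r : ℕ) : Set where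
  field
    to      : (z : Fin N) → T (le z y) → Subset r
    from    : Subset r → Fin N
    from≤   : ∀ s → T (le (from s) y)
    from-to : ∀ z (p : T (le z y)) → from (to z p) ≡ z
    to-from : ∀ s → to (from s) (from≤ s) ≡ s
    to-mono : ∀ z z' (p : T (le z y)) (p' : T (le z' y)) → T (le z z') → to z p ⊆ to z' p'
    to-reflect : ∀ z z' (p : T (le z y)) (p' : T (le z' y)) → to z p ⊆ to z' p' → T (le z z')

record SimplicialPoset : Set where
  field
    N      : ℕ
    le     : Fin N → Fin N → Bool
    refl   : ∀ x → T (le x x)
    antisym : ∀ x y → T (le x y) → T (le y x) → x ≡ y
    trans  : ∀ x y z → T (le x y) → T (le y z) → T (le x z)
    bot    : Fin N
    bot-min : ∀ y → T (le bot y)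
    rk     : Fin N → ℕ
    boolean : ∀ y → BooleanInterval N le y (rk y)

module _ (P : SimplicialPoset) where
  open SimplicialPoset P

  _≤P_ : Fin N → Fin N → Set
  x ≤P y = T (le x y)

  eqF : Fin N → Fin N → Bool
  eqF x y = does (x Fin.≟ y)

  HasRank : ℕ → Set
  HasRank d = (∀ y → rk y ℕ.≤ d) × (∃[ y ] rk y ≡ d)

  rankList : ℕ → List (Fin N)
  rankList d = filterᵇ (λ y → rk y ≡ᵇ d) (allF′)
    where allF′ = allFin N

  IsAtom : Fin N → Set
  IsAtom x = rk x ≡ 1

  IsGLB : Fin N → Fin N → Fin N → Set
  IsGLB w i j = w ≤P i × w ≤P j × (∀ u → u ≤P i → u ≤P j → u ≤P w)

  -- S : a downward closed set of elements (as a Bool predicate);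
  -- upper bounds / minimal upper bounds computed inside S.
  isUB : (Fin N → Bool) → Fin N → Fin N → Fin N → Bool
  isUB S i j z = S z ∧ le i z ∧ le j z

  isMUB : (Fin N → Bool) → Fin N → Fin N → Fin N → Bool
  isMUB S i j z = isUB S i j z ∧ allF (λ w → not (isUB S i j w ∧ le w z) ∨ eqF w z)

  mubs : (Fin N → Bool) → Fin N → Fin N → List (Fin N)
  mubs S i j = filterᵇ (isMUB S i j) (allFin N)

  -- generators of the face ideal of the subposet S (with 0̂ identified with 1,
  -- elements outside S sent to 0)
  FaceGen : (Fin N → Bool) → Poly N → Set
  FaceGen S f =
      (f ≡ var bot -P 1P)
    ⊎ (∃[ z ] (S z ≡ false × f ≡ var z))
    ⊎ (∃[ i ] ∃[ j ] (S i ≡ true × S j ≡ true ×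
         ((anyF (isUB S i j) ≡ false × f ≡ var i *P var j)
         ⊎ (∃[ w ] (IsGLB w i j ×
              f ≡ var i *P var j -P var w *P sumP (map var (mubs S i j)))))))

  allS : Fin N → Bool
  allS _ = true

  below : Fin N → Fin N → Bool
  below y z = le z y

  infix 4 _≡[_]_
  _≡[_]_ : Poly N → (Fin N → Bool) → Poly N → Set
  f ≡[ S ] g = InIdeal (FaceGen S) (f -P g)

  -- the degree-one element Σ_z c z · z  (c supported on atoms)
  linP : (Fin N → ℚ) → Poly N
  linP c = ΣF N (λ z → scaleP (c z) (var z))

  DegreeOne : ∀ {d} → (Fin d → Fin N → ℚ) → Set
  DegreeOne Θ = ∀ i z → ¬ IsAtom z → Θ i z ≡ 0ℚ

  θP : ∀ {d} → (Fin d → Fin N → ℚ) → Fin d → Poly N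
  θP Θ i = linP (Θ i)

  IsLSOP : ∀ {d} → (Fin d → Fin N → ℚ) → Set
  IsLSOP {d} Θ =
    Σ ℕ λ r → Σ (Fin r → Poly N) λ g → ∀ (f : Poly N) →
      Σ (Fin r → Poly d) λ h →
        f ≡[ allS ] ΣF r (λ k → evalP (h k) (θP Θ) *P g k)

  EnumAtoms : ∀ {d} → Fin N → (Fin d → Fin N) → Set
  EnumAtoms {d} y o =
      (∀ k → IsAtom (o k) × o k ≤P y)
    × (∀ k k' → o k ≡ o k' → k ≡ k')
    × (∀ x → IsAtom x → x ≤P y → ∃[ k ] o k ≡ x)

negOnePowℚ : ℕ → ℚ
negOnePowℚ zero = 1ℚ
negOnePowℚ (suc n) = ℚ.- negOnePowℚ n

det : ∀ {n} → (Fin n → Fin n → ℚ) → ℚ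
det {zero} M = 1ℚ
det {suc n} M =
  List.foldr ℚ._+_ 0ℚ
    (map (λ k → negOnePowℚ (toℕ k) ℚ.* (M Fin.zero k ℚ.* det (λ i j → M (Fin.suc i) (punchIn k j))))
         (allFin (suc n)))

negOnePowℤ : ℕ → ℤ
negOnePowℤ zero = ℤ.+ 1
negOnePowℤ (suc n) = ℤ.- negOnePowℤ n

inversions : List ℕ → ℕ
inversions [] = 0
inversions (a ∷ s) = length (filterᵇ (λ b → b <ᵇ a) s) ℕ.+ inversions s

removeAt : ∀ {A : Set} → ℕ → List A → List A
removeAt _ [] = []
removeAt zero (x ∷ xs) = xs
removeAt (suc n) (x ∷ xs) = x ∷ removeAt n xs

sumℤ : List ℤ → ℤ
sumℤ = List.foldr ℤ._+_ (ℤ.+ 0)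

sumℚ : List ℚ → ℚ
sumℚ = List.foldr ℚ._+_ 0ℚ

module _ (P : SimplicialPoset) (d : ℕ) where
  open SimplicialPoset P

  tops : List (Fin N)
  tops = rankList P d

  PseudoCond : Set
  PseudoCond = ∀ z → rk z ≡ d ∸ 1 →
    length (filterᵇ (λ y → (rk y ≡ᵇ d) ∧ le z y) (allFin N)) ≡ 2

  -- (2) Σ_{rank y = d} sgn(y)⟨y⟩ is a cycle, where ⟨y⟩ is oriented by the vertex
  -- order (ord y 0, …, ord y (d-1)).  The coefficient of a (d-2)-cell z (oriented
  -- by increasing atom index) in ∂⟨y⟩ is (-1)^(k-1) times the sign of the
  -- permutation sorting the induced vertex order (x_{i_1},…,x̂_{i_k},…,x_{i_d}).
  CycleCond : (Fin N → ℤ) → (Fin N → Fin d → Fin N) → Set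
  CycleCond sgn ord = ∀ z → rk z ≡ d ∸ 1 →
    sumℤ (concatMap (λ y → map (λ k →
        if le z y ∧ not (le (ord y k) z)
        then sgn y ℤ.* (negOnePowℤ (toℕ k) ℤ.*
               negOnePowℤ (inversions (removeAt (toℕ k) (map (λ k' → toℕ (ord y k')) (allFin d)))))
        else ℤ.+ 0) (allFin d)) tops)
    ≡ ℤ.+ 0

  -- matrix whose k-th column is the coordinate vector of θ_{i_k}(y) w.r.t. (θ_1,…,θ_d)
  -- (identifying ℚ[Θ] with ℚ[t_1,…,t_d], θ_j ↦ t_j); lθ y x = ι_y(x) for atoms x ≤ y
  ThetaMat : (Fin N → Fin d → Fin N) → (Fin N → Fin N → Poly d) → Fin N → Fin d → Fin d → ℚ
  ThetaMat ord lθ y j k = coeff (lθ y (ord y k)) (unitMon j)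

  ThetaProd : (Fin N → Fin d → Fin N) → (Fin N → Fin N → Poly d) → Fin N → Poly d
  ThetaProd ord lθ y = ΠF d (λ k → lθ y (ord y k))

  -- "Σ_{y ∈ tops} sgn(y) ι_y(α) / (m(y) ∏ θ_i(y))  lies in ℚ[Θ]":
  -- there is g ∈ ℚ[t] with g · ∏_y c_y = Σ_y sgn(y) ι_y(α) ∏_{y' ≠ y} c_{y'},
  -- where c_y = m(y) ∏_{i ∈ 𝒜(y)} θ_i(y)  (equality in the fraction field).
  IndexPolynomial : (Fin N → ℤ) → (Fin N → ℚ) → (Fin N → Poly d) → (Fin N → Poly d) → Set
  IndexPolynomial sgn m ια c =
    Σ (Poly d) λ g →
      g *P prodP (map (λ y → scaleP (m y) (c y)) tops)
        ≈P sumP (map (λ y → scaleP (sgn y ℚ./ 1)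
                  (ια y *P prodP (map (λ y' → scaleP (m y') (c y'))
                                      (filterᵇ (λ y' → not (eqF P y y')) tops))))
                tops)

{-# OPTIONS --safe #-}

-- Write L(y,k) for the linear form θ_{i_k}(y).  A nonzero linear form is prime, so the denominator
-- of ind_T(α) can be cancelled one factor at a time once the sum is known to have no pole along any
-- single form ℓ.  The cell y has at most a simple pole along ℓ, namely when L(y,k) is proportional to ℓ
-- for a (unique) k; let z be the facet of y opposite to the vertex k.  Restriction to z factors through
-- ℚ[Θ]/ℓ, so modulo ℓ neither the forms at the vertices of z nor the restriction of α depend on the cell
-- containing z.  Comparing determinants then shows that the residue of the y-term is the coefficient of z
-- in ∂(sgn(y)⟨y⟩) times a quantity depending on z alone, and the cycle condition makes the residues
-- belonging to each z add up to zero.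

module Submission where

open import Defs
open import Algebra.Bundles using (CommutativeMonoid; CommutativeRing)
open import Data.Bool using (Bool; true; false; T; _∧_; _∨_; not; if_then_else_)
open import Data.Bool.Properties using (T-irrelevant; T-∧; T-≡)
open import Data.Empty using (⊥; ⊥-elim)
open import Data.Fin as Fin using (Fin; zero; suc; toℕ; punchIn; punchOut)
open import Data.Fin.Properties as Finₚ using (all?; any?)
open import Data.Fin.Subset using (⁅_⁆; ∁; _∪_; _∈_; _⊆_) renaming (⊥ to ∅)
import Data.Fin.Subset.Properties as Subsetₚ
open import Data.Integer as ℤ using (ℤ)
open import Data.List as List using (List; []; _∷_; _++_; map; allFin; concatMap; filterᵇ; length; tabulate)
open import Data.List.Membership.Propositional using (lose)
open import Data.List.Membership.Propositional.Properties using (∈-allFin; ∈-tabulate⁺; ∈-tabulate⁻)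
open import Data.List.Membership.Propositional.Properties.WithK using (unique∧set⇒bag)
import Data.List.Properties as Listₚ
open import Data.List.Relation.Binary.BagAndSetEquality using (∼bag⇒↭)
open import Data.List.Relation.Binary.Permutation.Propositional using (_↭_; prep; swap) renaming (refl to ↭-refl; trans to ↭-trans)
import Data.List.Relation.Binary.Permutation.Propositional.Properties as Perm
open import Data.List.Relation.Binary.Pointwise.Base using (Pointwise; []; _∷_)
open import Data.List.Relation.Unary.All as All using ([]; _∷_)
import Data.List.Relation.Unary.All.Properties as Allₚ
open import Data.List.Relation.Unary.AllPairs using ([]; _∷_)
import Data.List.Relation.Unary.Any.Properties as Anyₚ
open import Data.List.Relation.Unary.Unique.Propositional using (Unique)
open import Data.List.Relation.Unary.Unique.Propositional.Properties using (tabulate⁺)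
open import Data.Nat as ℕ using (ℕ; zero; suc)
import Data.Nat.Properties as ℕₚ
open import Data.Product using (Σ; ∃; _×_; _,_; proj₁; proj₂)
open import Data.Rational as ℚ using (ℚ; 0ℚ; 1ℚ; _<_; _*_; _+_; -_; _-_)
import Data.Rational.Properties as ℚₚ
open import Data.Rational.Solver using (module +-*-Solver)
open import Data.Sum using (_⊎_; inj₁; inj₂)
import Data.Vec.Functional as Vector
import Data.Vec.Functional.Properties as Vectorₚ
open import Function using (Equivalence; _∘_; case_of_; id; mk⇔)
open import Level using (0ℓ)
open import Relation.Binary.PropositionalEquality using (_≡_; _≢_; refl; sym; trans; cong; cong₂; subst; module ≡-Reasoning)
open import Relation.Nullary using (Dec; yes; no; does; ¬_)
open import Relation.Nullary.Decidable using (T?; ¬?; decidable-stable)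

-- The coordinates of the forms in two cells y, y' through z are linked by duality. The coordinate
-- vectors of the L(y,k) form the basis dual to the vectors of values of θ_1, ..., θ_d at the atoms
-- of y, and those values do not depend on the cell. When a form of y' is expanded in the basis of
-- y, its coefficient at a vertex of z is therefore 0 or 1. Only the coefficient at the vertex
-- opposite z is free, and the basis vector there is a multiple of ℓ. This one computation shows
-- that the forms at the vertices of z agree modulo ℓ, and also that the form of y' opposite z is
-- again proportional to ℓ. The number m(y) is the inverse of the determinant of these vectors. If
-- the vector opposite z is c times that of ℓ, the determinant is, up to sign, c times a determinant
-- that has ℓ itself as a column. Adding multiples of ℓ to the other columns does not change it, so
-- 1/(m(y)c) depends on z alone up to the orientation sign. No fraction field is built: every
-- fraction is cleared to a polynomial identity, and factors are cancelled because they are not zero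
-- divisors, either in the polynomial ring or after setting ℓ = 0.

T⇒true : ∀ {b} → T b → b ≡ true
T⇒true = Equivalence.to T-≡

¬T⇒false : ∀ {b} → ¬ T b → b ≡ false
¬T⇒false {true}  h = ⊥-elim (h _)
¬T⇒false {false} h = refl

-- Finite sums and partial fractions in a commutative ring

module FiniteSum {a ℓ} (M : CommutativeMonoid a ℓ) where
  open CommutativeMonoid M renaming (refl to ≈-refl; sym to ≈-sym; trans to ≈-trans)
  open import Algebra.Properties.CommutativeMonoid.Sum M public

  foldr-tabulate : ∀ {n} (f : Fin n → Carrier) → List.foldr _∙_ ε (tabulate f) ≡ sum f
  foldr-tabulate {zero}  f = refl
  foldr-tabulate {suc n} f = cong (f zero ∙_) (foldr-tabulate (f ∘ suc))

  foldr-allFin : ∀ n (f : Fin n → Carrier) → List.foldr _∙_ ε (map f (allFin n)) ≡ sum f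
  foldr-allFin n f = trans (cong (List.foldr _∙_ ε) (Listₚ.map-tabulate id f)) (foldr-tabulate f)

  foldr-filter : ∀ {A : Set} (p : A → Bool) (f : A → Carrier) xs →
    List.foldr _∙_ ε (map f (filterᵇ p xs)) ≈ List.foldr _∙_ ε (map (λ x → if p x then f x else ε) xs)
  foldr-filter p f [] = ≈-refl
  foldr-filter p f (x ∷ xs) with p x
  ... | true  = ∙-congˡ (foldr-filter p f xs)
  ... | false = ≈-trans (foldr-filter p f xs) (≈-sym (identityˡ _))

  sum-filter : ∀ n (p : Fin n → Bool) (f : Fin n → Carrier) →
    List.foldr _∙_ ε (map f (filterᵇ p (allFin n))) ≈ sum (λ x → if p x then f x else ε)
  sum-filter n p f = ≈-trans (foldr-filter p f (allFin n)) (reflexive (foldr-allFin n _))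

  sum-cong : ∀ {n} {f g : Fin n → Carrier} → (∀ i → f i ≈ g i) → sum f ≈ sum g
  sum-cong = sum-cong-≋

  sum-ε : ∀ {n} {f : Fin n → Carrier} → (∀ i → f i ≈ ε) → sum f ≈ ε
  sum-ε {n} h = ≈-trans (sum-cong h) (sum-replicate-zero n)

  sum-only : ∀ {n} {f : Fin n → Carrier} i → (∀ j → j ≢ i → f j ≈ ε) → sum f ≈ f i
  sum-only {suc n} {f} zero h =
    ≈-trans (∙-congˡ (sum-ε (λ j → h (suc j) (λ ())))) (identityʳ _)
  sum-only {suc n} {f} (suc i) h =
    ≈-trans (∙-congʳ (h zero (λ ())))
      (≈-trans (identityˡ _) (sum-only i (λ j ne → h (suc j) (λ { refl → ne refl }))))

module RingSums {c ℓ} (R : CommutativeRing c ℓ) where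
  open CommutativeRing R
  open FiniteSum +-commutativeMonoid public
    renaming (sum to ∑; sum-cong to ∑-cong; sum-ε to ∑-zero; sum-only to ∑-only; foldr-allFin to ∑-allFin; sum-filter to ∑-filter)
    using (∑-distrib-+; ∑-comm)
  open FiniteSum *-commutativeMonoid public
    renaming (sum to ∏; sum-cong to ∏-cong; sum-ε to ∏-one; sum-only to ∏-only; foldr-allFin to ∏-allFin; sum-filter to ∏-filter
             ; ∑-distrib-+ to ∏-distrib-*; sum-remove to ∏-remove; foldr-tabulate to ∏-tabulate; foldr-filter to ∏-foldr-filter)
    using ()
  open import Algebra.Properties.Semiring.Sum semiring public using (*-distribˡ-sum; *-distribʳ-sum)

module PartialFractions {c ℓ} (R : CommutativeRing c ℓ) {N : ℕ} where
  open CommutativeRing R renaming (refl to ≈-refl; sym to ≈-sym; trans to ≈-trans; reflexive to ≈-reflexive; setoid to setoidR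
    ; _+_ to _⊹_; _*_ to _·_; -_ to ⊖_; zeroˡ to ·-zeroˡ; *-identityʳ to ·-identityʳ)
    hiding (_-_; zeroʳ; +-identityʳ)
  open RingSums R using () renaming (∑ to ⨁; ∏ to ⨂; ∑-cong to ⨁-cong; ∑-zero to ⨁-zero; ∑-comm to ⨁-comm
    ; ∏-only to ⨂-only; ∏-cong to ⨂-cong; ∏-distrib-* to ⨂-distrib; *-distribʳ-sum to ⨁-distribʳ)
  open import Relation.Binary.Reasoning.Setoid setoidR
  open import Algebra.Solver.Ring.NaturalCoefficients.Default commutativeSemiring using (solve; _:+_; _:*_; _:=_)

  add-multiples : ∀ w p q p' q' → (p ⊹ w · q) ⊹ (p' ⊹ w · q') ≈ (p ⊹ p') ⊹ w · (q ⊹ q')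
  add-multiples = solve 5 (λ w p q p' q' → (p :+ w :* q) :+ (p' :+ w :* q') := (p :+ p') :+ w :* (q :+ q')) ≈-refl

  multiply-multiples : ∀ w x c p q → (x ⊹ w · c) · (p ⊹ w · q) ≈ x · p ⊹ w · (x · q ⊹ c · p ⊹ c · w · q)
  multiply-multiples =
    solve 5 (λ w x c p q → (x :+ w :* c) :* (p :+ w :* q) := x :* p :+ w :* (x :* q :+ c :* p :+ c :* w :* q)) ≈-refl

  -- The cofactor of `C y` in the common denominator. The omitted factor becomes `1#`, so the
  -- product still runs over all of `Fin N`.
  hat : (Fin N → Carrier) → Fin N → Carrier
  hat C y = ⨂ (λ y' → if does (y Fin.≟ y') then 1# else C y')

  hat-total : ∀ C y → C y · hat C y ≈ ⨂ C
  hat-total C y = begin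
    C y · hat C y         ≈⟨ *-congʳ (≈-sym (≈-trans (⨂-only y other) self)) ⟩
    ⨂ single · hat C y    ≈⟨ ≈-sym (⨂-distrib single (λ y' → if does (y Fin.≟ y') then 1# else C y')) ⟩
    ⨂ (λ y' → single y' · (if does (y Fin.≟ y') then 1# else C y')) ≈⟨ ⨂-cong recombine ⟩
    ⨂ C ∎
    where
    single : Fin N → Carrier
    single y' = if does (y Fin.≟ y') then C y' else 1#
    other : ∀ y' → y' ≢ y → single y' ≈ 1#
    other y' ne with y Fin.≟ y'
    ... | yes refl = ⊥-elim (ne refl)
    ... | no _     = ≈-refl
    self : single y ≈ C y
    self with y Fin.≟ y
    ... | yes _ = ≈-refl
    ... | no ne = ⊥-elim (ne refl)
    recombine : ∀ y' → single y' · (if does (y Fin.≟ y') then 1# else C y') ≈ C y'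
    recombine y' with y Fin.≟ y'
    ... | yes _ = ·-identityʳ (C y')
    ... | no _  = *-identityˡ (C y')

  -- In fractions, `1 / C y` is `Λ* y / (l · D y)`, so `l` times the sum of the `a y / C y` is the
  -- sum of the `a y · Λ* y / D y`. This is that identity with both common denominators multiplied
  -- out.
  clear-denominators : ∀ (a C D Λ Λ* : Fin N → Carrier) l → (∀ y → C y ≈ D y · Λ y) → (∀ y → Λ* y · Λ y ≈ l) →
    l · (⨁ (λ y → a y · hat C y) · ⨂ D) ≈ ⨁ (λ y → a y · Λ* y · hat D y) · ⨂ C
  clear-denominators a C D Λ Λ* l split compl = begin
    l · (⨁ (λ y → a y · hat C y) · ⨂ D)     ≈⟨ solve 3 (λ l s d → l :* (s :* d) := s :* (l :* d)) ≈-refl l _ _ ⟩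
    ⨁ (λ y → a y · hat C y) · (l · ⨂ D)     ≈⟨ ⨁-distribʳ (l · ⨂ D) (λ y → a y · hat C y) ⟩
    ⨁ (λ y → a y · hat C y · (l · ⨂ D))     ≈⟨ ⨁-cong term ⟩
    ⨁ (λ y → a y · Λ* y · hat D y · ⨂ C)    ≈⟨ ≈-sym (⨁-distribʳ (⨂ C) (λ y → a y · Λ* y · hat D y)) ⟩
    ⨁ (λ y → a y · Λ* y · hat D y) · ⨂ C ∎
    where
    term : ∀ y → a y · hat C y · (l · ⨂ D) ≈ a y · Λ* y · hat D y · ⨂ C
    term y = begin
      a y · hat C y · (l · ⨂ D) ≈⟨ *-congˡ (*-cong (≈-sym (compl y)) (≈-sym (hat-total D y))) ⟩
      a y · hat C y · ((Λ* y · Λ y) · (D y · hat D y))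
        ≈⟨ solve 6 (λ a h s t d k → a :* h :* ((s :* t) :* (d :* k)) := a :* s :* k :* ((d :* t) :* h)) ≈-refl
             (a y) (hat C y) (Λ* y) (Λ y) (D y) (hat D y) ⟩
      a y · Λ* y · hat D y · ((D y · Λ y) · hat C y) ≈⟨ *-congˡ (≈-trans (*-congʳ (≈-sym (split y))) (hat-total C y)) ⟩
      a y · Λ* y · hat D y · ⨂ C ∎

  -- With `h = W / X` and `h' = W / X'`, the hypothesis on `g`, `g'` says `g / X = g' / X'`. The
  -- factor `X · X'` stays, to be cancelled where it is known not to be a zero divisor.
  cross-multiply : ∀ {X X' h h' W g g' i i'} → X · h ≈ W → X' · h' ≈ W → g · X' ≈ g' · X → i ≈ i' →
    (X · X') · (g · (i · h)) ≈ (X · X') · (g' · (i' · h'))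
  cross-multiply {X} {X'} {h} {h'} {W} {g} {g'} {i} {i'} Xh X'h' gX' ii' = begin
    (X · X') · (g · (i · h))    ≈⟨ solve 5 (λ X X' g i h → (X :* X') :* (g :* (i :* h)) := (g :* X') :* (i :* (X :* h))) ≈-refl X X' g i h ⟩
    (g · X') · (i · (X · h))    ≈⟨ *-cong gX' (*-cong ii' (≈-trans Xh (≈-sym X'h'))) ⟩
    (g' · X) · (i' · (X' · h')) ≈⟨ solve 5 (λ X X' g i h → (g :* X) :* (i :* (X' :* h)) := (X :* X') :* (g :* (i :* h))) ≈-refl X X' g' i' h' ⟩
    (X · X') · (g' · (i' · h')) ∎

  -- Each B y k is counted once among the z incident to (y , k); the terms incident to a common z
  -- are e y k times a common value, and the e y k add up to zero.
  cancel-by-cells : ∀ {d} (B e : Fin N → Fin d → Carrier) (inc : Fin N → Fin N → Fin d → Bool) →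
    (∀ y k → B y k ≈ ⨁ (λ z → if inc z y k then B y k else 0#)) →
    (∀ z → ⨁ (λ y → ⨁ (λ k → if inc z y k then e y k else 0#)) ≈ 0#) →
    (∀ z y k y' k' → T (inc z y k) → T (inc z y' k') → e y k · B y k ≈ e y' k' · B y' k') →
    (∀ z y k → T (inc z y k) → e y k · e y k ≈ 1#) →
    ⨁ (λ y → ⨁ (λ k → B y k)) ≈ 0#
  cancel-by-cells {d} B e inc counted cycle agree square = begin
    ⨁ (λ y → ⨁ (λ k → B y k)) ≈⟨ ⨁-cong (λ y → ⨁-cong (counted y)) ⟩
    ⨁ (λ y → ⨁ (λ k → ⨁ (λ z → G z y k))) ≈⟨ ⨁-cong (λ y → ⨁-comm (λ k z → G z y k)) ⟩
    ⨁ (λ y → ⨁ (λ z → ⨁ (λ k → G z y k))) ≈⟨ ⨁-comm (λ y z → ⨁ (λ k → G z y k)) ⟩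
    ⨁ (λ z → ⨁ (λ y → ⨁ (λ k → G z y k))) ≈⟨ ⨁-zero (λ z → cell z (any? (λ y → any? (λ k → T? (inc z y k))))) ⟩
    0# ∎
    where
    G : Fin N → Fin N → Fin d → Carrier
    G z y k = if inc z y k then B y k else 0#
    cell : ∀ z → Dec (∃ λ y → ∃ λ k → T (inc z y k)) → ⨁ (λ y → ⨁ (λ k → G z y k)) ≈ 0#
    cell z (no none) = ⨁-zero (λ y → ⨁-zero (λ k → ≈-reflexive
      (cong (λ b → if b then B y k else 0#) (¬T⇒false (λ t → none (y , k , t))))))
    cell z (yes (y₀ , k₀ , t₀)) = begin
      ⨁ (λ y → ⨁ (λ k → G z y k)) ≈⟨ ⨁-cong (λ y → ≈-trans (⨁-cong (term y)) (≈-sym (⨁-distribʳ K (λ k → if inc z y k then e y k else 0#)))) ⟩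
      ⨁ (λ y → ⨁ (λ k → if inc z y k then e y k else 0#) · K) ≈⟨ ≈-sym (⨁-distribʳ K (λ y → ⨁ (λ k → if inc z y k then e y k else 0#))) ⟩
      ⨁ (λ y → ⨁ (λ k → if inc z y k then e y k else 0#)) · K ≈⟨ *-congʳ (cycle z) ⟩
      0# · K ≈⟨ ·-zeroˡ K ⟩
      0# ∎
      where
      K = e y₀ k₀ · B y₀ k₀
      incident : ∀ y k → T (inc z y k) → B y k ≈ e y k · K
      incident y k t = begin
        B y k                     ≈⟨ ≈-sym (*-identityˡ (B y k)) ⟩
        1# · B y k                ≈⟨ *-congʳ (≈-sym (square z y k t)) ⟩
        (e y k · e y k) · B y k   ≈⟨ *-assoc (e y k) (e y k) (B y k) ⟩
        e y k · (e y k · B y k)   ≈⟨ *-congˡ (agree z y k y₀ k₀ t t₀) ⟩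
        e y k · K ∎
      term : ∀ y k → G z y k ≈ (if inc z y k then e y k else 0#) · K
      term y k with inc z y k in eq
      ... | true  = incident y k (subst T (sym eq) _)
      ... | false = ≈-sym (·-zeroˡ K)

open +-*-Solver using (solve; _:+_; _:*_; _:-_; :-_; _:=_; con)

-- Polynomials over ℚ

Elem : SimplicialPoset → Set
Elem P = Fin (SimplicialPoset.N P)

infix 4 _≐_
_≐_ : ∀ {k} → Mon k → Mon k → Set
m ≐ m' = ∀ i → m i ≡ m' i

infixl 6 _⊕_
_⊕_ : ∀ {k} → Mon k → Mon k → Mon k
(m ⊕ m') i = m i ℕ.+ m' i

𝟎 : ∀ {k} → Mon k
𝟎 _ = 0

-- Exponent vectors are functions and may agree pointwise without being propositionally equal, so
-- this compatibility has to be demanded explicitly.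
Resp : ∀ {k} → (Mon k → ℚ) → Set
Resp φ = ∀ {m m'} → m ≐ m' → φ m ≡ φ m'

-- The linear functional on term lists with value `φ m` on the monomial `m`. Testing against all
-- such functionals turns a polynomial identity into identities in ℚ, which the ring solver can
-- handle.
lin : ∀ {k} → (Mon k → ℚ) → Poly k → ℚ
lin φ []            = 0ℚ
lin φ ((a , m) ∷ p) = a * φ m + lin φ p

indicator : {A : Set} → Dec A → ℚ
indicator (yes _) = 1ℚ
indicator (no _)  = 0ℚ

δ : ∀ {k} → Mon k → Mon k → ℚ
δ e m = indicator (all? (λ i → m i ℕ.≟ e i))

δ-hit : ∀ {k} {e m : Mon k} → m ≐ e → δ e m ≡ 1ℚ
δ-hit {e = e} {m} eq with all? (λ i → m i ℕ.≟ e i)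
... | yes _ = refl
... | no ¬p = ⊥-elim (¬p eq)

δ-miss : ∀ {k} {e m : Mon k} → ¬ (m ≐ e) → δ e m ≡ 0ℚ
δ-miss {e = e} {m} ne with all? (λ i → m i ℕ.≟ e i)
... | yes p = ⊥-elim (ne p)
... | no _  = refl

δ-dec : ∀ {k} (e m : Mon k) → (m ≐ e × δ e m ≡ 1ℚ) ⊎ (¬ (m ≐ e) × δ e m ≡ 0ℚ)
δ-dec e m with all? (λ i → m i ℕ.≟ e i)
... | yes p = inj₁ (p , refl)
... | no ¬p = inj₂ (¬p , refl)

δ-resp : ∀ {k} (e : Mon k) → Resp (δ e)
δ-resp e {m} {m'} eq with δ-dec e m
... | inj₁ (p , q) = trans q (sym (δ-hit (λ i → trans (sym (eq i)) (p i))))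
... | inj₂ (p , q) = trans q (sym (δ-miss (λ r → p (λ i → trans (eq i) (r i)))))

coeff-lin : ∀ {k} (p : Poly k) e → coeff p e ≡ lin (δ e) p
coeff-lin [] e = refl
coeff-lin ((a , m) ∷ p) e with all? (λ i → m i ℕ.≟ e i)
... | yes _ = cong₂ _+_ (sym (ℚₚ.*-identityʳ a)) (coeff-lin p e)
... | no _  = trans (coeff-lin p e)
  (trans (sym (ℚₚ.+-identityˡ _)) (cong (_+ lin (δ e) p) (sym (ℚₚ.*-zeroʳ a))))

module _ {k : ℕ} where

  lin-++ : ∀ (φ : Mon k → ℚ) p q → lin φ (p +P q) ≡ lin φ p + lin φ q
  lin-++ φ [] q = sym (ℚₚ.+-identityˡ _)
  lin-++ φ ((a , m) ∷ p) q =
    trans (cong ((a * φ m) +_) (lin-++ φ p q)) (sym (ℚₚ.+-assoc (a * φ m) _ _))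

  lin-scale : ∀ (φ : Mon k → ℚ) c p → lin φ (scaleP c p) ≡ c * lin φ p
  lin-scale φ c [] = sym (ℚₚ.*-zeroʳ c)
  lin-scale φ c ((a , m) ∷ p) = trans (cong ((c * a * φ m) +_) (lin-scale φ c p))
    (solve 4 (λ c a f l → c :* a :* f :+ c :* l := c :* (a :* f :+ l)) refl c a (φ m) (lin φ p))

  lin-cong : ∀ {φ ψ : Mon k → ℚ} → (∀ m → φ m ≡ ψ m) → ∀ p → lin φ p ≡ lin ψ p
  lin-cong eq [] = refl
  lin-cong eq ((a , m) ∷ p) = cong₂ _+_ (cong (a *_) (eq m)) (lin-cong eq p)

  lin-add : ∀ (φ ψ : Mon k → ℚ) p → lin (λ m → φ m + ψ m) p ≡ lin φ p + lin ψ p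
  lin-add φ ψ [] = refl
  lin-add φ ψ ((a , m) ∷ p) = trans (cong ((a * (φ m + ψ m)) +_) (lin-add φ ψ p))
    (solve 5 (λ a f g x y → a :* (f :+ g) :+ (x :+ y) := (a :* f :+ x) :+ (a :* g :+ y)) refl
      a (φ m) (ψ m) (lin φ p) (lin ψ p))

  lin-mulˡ : ∀ c (φ : Mon k → ℚ) p → lin (λ m → c * φ m) p ≡ c * lin φ p
  lin-mulˡ c φ [] = sym (ℚₚ.*-zeroʳ c)
  lin-mulˡ c φ ((a , m) ∷ p) = trans (cong ((a * (c * φ m)) +_) (lin-mulˡ c φ p))
    (solve 4 (λ c a f l → a :* (c :* f) :+ c :* l := c :* (a :* f :+ l)) refl c a (φ m) (lin φ p))

  lin-zero : ∀ p → lin {k} (λ _ → 0ℚ) p ≡ 0ℚ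
  lin-zero [] = refl
  lin-zero ((a , m) ∷ p) = cong₂ _+_ (ℚₚ.*-zeroʳ a) (lin-zero p)

  lin-map-term : ∀ (φ : Mon k → ℚ) a m (f : ℚ × Mon k → ℚ × Mon k) →
    (∀ b m' → f (b , m') ≡ (a * b , m ⊕ m')) →
    ∀ q → lin φ (map f q) ≡ a * lin (λ m' → φ (m ⊕ m')) q
  lin-map-term φ a m f eq [] = sym (ℚₚ.*-zeroʳ a)
  lin-map-term φ a m f eq ((b , m') ∷ q) rewrite eq b m' | lin-map-term φ a m f eq q =
    solve 4 (λ a b x l → a :* b :* x :+ a :* l := a :* (b :* x :+ l)) refl
      a b (φ (m ⊕ m')) (lin (λ m' → φ (m ⊕ m')) q)

  lin-* : ∀ (φ : Mon k → ℚ) p q → lin φ (p *P q) ≡ lin (λ m → lin (λ m' → φ (m ⊕ m')) q) p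
  lin-* φ [] q = refl
  lin-* φ ((a , m) ∷ p) q = trans (lin-++ φ (map _ q) (p *P q))
    (cong₂ _+_ (lin-map-term φ a m _ (λ _ _ → refl) q) (lin-* φ p q))

lin-swap : ∀ {k l} (h : Mon k → Mon l → ℚ) p q →
  lin (λ m → lin (h m) q) p ≡ lin (λ m' → lin (λ m → h m m') p) q
lin-swap h [] q = sym (lin-zero q)
lin-swap h ((a , m) ∷ p) q = begin
  a * lin (h m) q + lin (λ m → lin (h m) q) p
    ≡⟨ cong₂ _+_ (sym (lin-mulˡ a (h m) q)) (lin-swap h p q) ⟩
  lin (λ m' → a * h m m') q + lin (λ m' → lin (λ m → h m m') p) q
    ≡⟨ sym (lin-add _ _ q) ⟩
  lin (λ m' → a * h m m' + lin (λ m → h m m') p) q ∎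
  where open ≡-Reasoning

-- Functionals depend only on the coefficients

module _ {k : ℕ} where
  remove : Mon k → Poly k → Poly k
  remove e [] = []
  remove e ((a , m) ∷ p) with all? (λ i → m i ℕ.≟ e i)
  ... | yes _ = remove e p
  ... | no _  = (a , m) ∷ remove e p

  remove-length : ∀ e p → length (remove e p) ℕ.≤ length p
  remove-length e [] = ℕ.z≤n
  remove-length e ((a , m) ∷ p) with all? (λ i → m i ℕ.≟ e i)
  ... | yes _ = ℕₚ.m≤n⇒m≤1+n (remove-length e p)
  ... | no _  = ℕ.s≤s (remove-length e p)

  lin-remove : ∀ {φ : Mon k → ℚ} → Resp φ → ∀ e p → lin φ p ≡ coeff p e * φ e + lin φ (remove e p)
  lin-remove {φ} rφ e [] = solve 1 (λ x → con 0ℚ := con 0ℚ :* x :+ con 0ℚ) refl (φ e)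
  lin-remove {φ} rφ e ((a , m) ∷ p) with all? (λ i → m i ℕ.≟ e i)
  ... | yes eq = trans (cong₂ (λ x y → a * x + y) (rφ eq) (lin-remove rφ e p))
      (solve 4 (λ a f c l → a :* f :+ (c :* f :+ l) := (a :+ c) :* f :+ l) refl a (φ e) (coeff p e) (lin φ (remove e p)))
  ... | no _   = trans (cong ((a * φ m) +_) (lin-remove rφ e p))
      (solve 3 (λ x y z → x :+ (y :+ z) := y :+ (x :+ z)) refl (a * φ m) (coeff p e * φ e) (lin φ (remove e p)))

  remove-zero : ∀ e p → (∀ e' → coeff p e' ≡ 0ℚ) → ∀ e' → coeff (remove e p) e' ≡ 0ℚ
  remove-zero e p z e' = begin
    coeff (remove e p) e'            ≡⟨ coeff-lin (remove e p) e' ⟩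
    lin (δ e') (remove e p)          ≡⟨ solve 2 (λ x y → x := con 0ℚ :* y :+ x) refl _ (δ e' e) ⟩
    0ℚ * δ e' e + lin (δ e') (remove e p)  ≡⟨ cong (λ c → c * δ e' e + lin (δ e') (remove e p)) (sym (z e)) ⟩
    coeff p e * δ e' e + lin (δ e') (remove e p) ≡⟨ sym (lin-remove (δ-resp e') e p) ⟩
    lin (δ e') p                     ≡⟨ sym (coeff-lin p e') ⟩
    coeff p e'                       ≡⟨ z e' ⟩
    0ℚ ∎
    where open ≡-Reasoning

  remove-head-length : ∀ a (m : Mon k) p → length (remove m ((a , m) ∷ p)) ℕ.≤ length p
  remove-head-length a m p with all? (λ i → m i ℕ.≟ m i)
  ... | yes _ = remove-length m p
  ... | no ne = ⊥-elim (ne (λ _ → refl))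

  -- All terms carrying the head's monomial contribute their total coefficient, which is zero, times
  -- `φ m`. Removing them keeps all coefficients zero and shortens the list; `n` bounds the length
  -- because `remove` is not a structural subterm.
  lin-vanish : ∀ {φ : Mon k → ℚ} → Resp φ → ∀ n p → length p ℕ.≤ n → (∀ e → coeff p e ≡ 0ℚ) → lin φ p ≡ 0ℚ
  lin-vanish rφ n [] _ z = refl
  lin-vanish {φ} rφ (suc n) p@((a , m) ∷ p') (ℕ.s≤s le) z = begin
    lin φ p                                ≡⟨ lin-remove rφ m p ⟩
    coeff p m * φ m + lin φ (remove m p)   ≡⟨ cong₂ (λ c l → c * φ m + l) (z m)
        (lin-vanish rφ n (remove m p) (ℕₚ.≤-trans (remove-head-length a m p') le) (remove-zero m p z)) ⟩
    0ℚ * φ m + 0ℚ                          ≡⟨ solve 1 (λ x → con 0ℚ :* x :+ con 0ℚ := con 0ℚ) refl (φ m) ⟩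
    0ℚ ∎
    where open ≡-Reasoning

-- A record around _≈P_, so that the two sides can be inferred from a proof.
infix 4 _≋_
record _≋_ {k} (p q : Poly k) : Set where
  constructor mk≋
  field at : p ≈P q
open _≋_ public

-- Equality by functionals and the laws of the polynomial ring

module _ {k : ℕ} where
  lin-ext : ∀ {p q : Poly k} → (∀ (φ : Mon k → ℚ) → Resp φ → lin φ p ≡ lin φ q) → p ≋ q
  lin-ext {p} {q} h .at e = trans (coeff-lin p e) (trans (h (δ e) (δ-resp e)) (sym (coeff-lin q e)))

  -- The converse of `lin-ext`, by `lin-vanish` applied to `p -P q`. Together they let congruence
  -- laws be proved by rewriting under a functional.
  lin-≋ : ∀ {φ : Mon k → ℚ} → Resp φ → ∀ {p q} → p ≋ q → lin φ p ≡ lin φ q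
  lin-≋ {φ} rφ {p} {q} pq = begin
    lin φ p ≡⟨ solve 2 (λ x y → x := (x :+ con (- 1ℚ) :* y) :+ y) refl (lin φ p) (lin φ q) ⟩
    (lin φ p + (- 1ℚ) * lin φ q) + lin φ q ≡⟨ cong (_+ lin φ q) (trans (sym diff) vanish) ⟩
    0ℚ + lin φ q ≡⟨ ℚₚ.+-identityˡ _ ⟩
    lin φ q ∎
    where
    open ≡-Reasoning
    lin-diff : ∀ (ψ : Mon k → ℚ) → lin ψ (p -P q) ≡ lin ψ p + (- 1ℚ) * lin ψ q
    lin-diff ψ = trans (lin-++ ψ p _) (cong ((lin ψ p) +_) (lin-scale ψ (- 1ℚ) q))
    diff = lin-diff φ
    vanish : lin φ (p -P q) ≡ 0ℚ
    vanish = lin-vanish rφ _ (p -P q) ℕₚ.≤-refl (λ e → begin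
      coeff (p -P q) e ≡⟨ trans (coeff-lin (p -P q) e) (lin-diff (δ e)) ⟩
      lin (δ e) p + (- 1ℚ) * lin (δ e) q
        ≡⟨ cong₂ (λ x y → x + (- 1ℚ) * y) (trans (sym (coeff-lin p e)) (at pq e)) (sym (coeff-lin q e)) ⟩
      coeff q e + (- 1ℚ) * coeff q e ≡⟨ solve 1 (λ y → y :+ con (- 1ℚ) :* y := con 0ℚ) refl (coeff q e) ⟩
      0ℚ ∎)

  ≋-refl : ∀ {p : Poly k} → p ≋ p
  ≋-refl = mk≋ (λ _ → refl)

  ≋-sym : ∀ {p q : Poly k} → p ≋ q → q ≋ p
  ≋-sym pq = mk≋ (λ e → sym (at pq e))

  ≋-trans : ∀ {p q r : Poly k} → p ≋ q → q ≋ r → p ≋ r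
  ≋-trans pq qr = mk≋ (λ e → trans (at pq e) (at qr e))

  +P-cong : ∀ {p p' q q' : Poly k} → p ≋ p' → q ≋ q' → p +P q ≋ p' +P q'
  +P-cong {p} {p'} {q} {q'} pp qq = lin-ext λ φ rφ →
    trans (lin-++ φ p q) (trans (cong₂ _+_ (lin-≋ rφ pp) (lin-≋ rφ qq)) (sym (lin-++ φ p' q')))

  +P-comm : ∀ (p q : Poly k) → p +P q ≋ q +P p
  +P-comm p q = lin-ext λ φ _ →
    trans (lin-++ φ p q) (trans (ℚₚ.+-comm (lin φ p) (lin φ q)) (sym (lin-++ φ q p)))

  private
    lin-shift-resp : ∀ {φ : Mon k → ℚ} → Resp φ → ∀ q → Resp (λ m → lin (λ m' → φ (m ⊕ m')) q)
    lin-shift-resp rφ q eq = lin-cong (λ m' → rφ (λ i → cong (ℕ._+ m' i) (eq i))) q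

  *P-cong : ∀ {p p' q q' : Poly k} → p ≋ p' → q ≋ q' → p *P q ≋ p' *P q'
  *P-cong {p} {p'} {q} {q'} pp qq = lin-ext λ φ rφ → begin
    lin φ (p *P q) ≡⟨ lin-* φ p q ⟩
    lin (λ m → lin (λ m' → φ (m ⊕ m')) q) p
      ≡⟨ lin-cong (λ m → lin-≋ (λ eq → rφ (λ i → cong ((m i) ℕ.+_) (eq i))) qq) p ⟩
    lin (λ m → lin (λ m' → φ (m ⊕ m')) q') p ≡⟨ lin-≋ (lin-shift-resp rφ q') pp ⟩
    lin (λ m → lin (λ m' → φ (m ⊕ m')) q') p' ≡⟨ sym (lin-* φ p' q') ⟩
    lin φ (p' *P q') ∎
    where open ≡-Reasoning

  +P-congˡ : ∀ (r : Poly k) {p q} → p ≋ q → r +P p ≋ r +P q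
  +P-congˡ r = +P-cong (≋-refl {r})

  +P-congʳ : ∀ (r : Poly k) {p q} → p ≋ q → p +P r ≋ q +P r
  +P-congʳ r h = +P-cong h (≋-refl {r})

  *P-congˡ : ∀ (r : Poly k) {p q} → p ≋ q → r *P p ≋ r *P q
  *P-congˡ r = *P-cong (≋-refl {r})

  *P-congʳ : ∀ (r : Poly k) {p q} → p ≋ q → p *P r ≋ q *P r
  *P-congʳ r h = *P-cong h (≋-refl {r})

  *P-comm : ∀ (p q : Poly k) → p *P q ≋ q *P p
  *P-comm p q = lin-ext λ φ rφ → begin
    lin φ (p *P q) ≡⟨ lin-* φ p q ⟩
    lin (λ m → lin (λ m' → φ (m ⊕ m')) q) p ≡⟨ lin-swap (λ m m' → φ (m ⊕ m')) p q ⟩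
    lin (λ m' → lin (λ m → φ (m ⊕ m')) p) q
      ≡⟨ lin-cong (λ m' → lin-cong (λ m → rφ (λ i → ℕₚ.+-comm (m i) (m' i))) p) q ⟩
    lin (λ m' → lin (λ m → φ (m' ⊕ m)) p) q ≡⟨ sym (lin-* φ q p) ⟩
    lin φ (q *P p) ∎
    where open ≡-Reasoning

  *P-assoc : ∀ (p q r : Poly k) → (p *P q) *P r ≋ p *P (q *P r)
  *P-assoc p q r = lin-ext λ φ rφ → begin
    lin φ ((p *P q) *P r) ≡⟨ lin-* φ (p *P q) r ⟩
    lin (λ m → lin (λ n → φ (m ⊕ n)) r) (p *P q) ≡⟨ lin-* _ p q ⟩
    lin (λ l → lin (λ m → lin (λ n → φ (l ⊕ m ⊕ n)) r) q) p
      ≡⟨ lin-cong (λ l → lin-cong (λ m → lin-cong (λ n → rφ (λ i → ℕₚ.+-assoc (l i) (m i) (n i))) r) q) p ⟩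
    lin (λ l → lin (λ m → lin (λ n → φ (l ⊕ (m ⊕ n))) r) q) p
      ≡⟨ lin-cong (λ l → sym (lin-* (λ m → φ (l ⊕ m)) q r)) p ⟩
    lin (λ l → lin (λ m → φ (l ⊕ m)) (q *P r)) p ≡⟨ sym (lin-* φ p (q *P r)) ⟩
    lin φ (p *P (q *P r)) ∎
    where open ≡-Reasoning

  scaleP-≋ : ∀ c (p : Poly k) → scaleP c p ≋ constP c *P p
  scaleP-≋ c p = lin-ext λ φ _ → trans (lin-scale φ c p)
    (sym (trans (lin-* φ (constP c) p) (ℚₚ.+-identityʳ _)))

  scaleP-cong : ∀ c {p q : Poly k} → p ≋ q → scaleP c p ≋ scaleP c q
  scaleP-cong c {p} {q} pq = lin-ext λ φ rφ →
    trans (lin-scale φ c p) (trans (cong (c *_) (lin-≋ rφ pq)) (sym (lin-scale φ c q)))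

  *P-identityˡ : ∀ (p : Poly k) → 1P *P p ≋ p
  *P-identityˡ p = lin-ext λ φ _ → trans (lin-* φ 1P p)
    (trans (ℚₚ.+-identityʳ _) (ℚₚ.*-identityˡ _))

  *P-distribʳ : ∀ (r p q : Poly k) → (p +P q) *P r ≋ p *P r +P q *P r
  *P-distribʳ r p q = lin-ext λ φ _ → trans (lin-* φ (p +P q) r) (trans (lin-++ _ p q)
    (trans (sym (cong₂ _+_ (lin-* φ p r) (lin-* φ q r))) (sym (lin-++ φ (p *P r) (q *P r)))))

  *P-distribˡ : ∀ (r p q : Poly k) → r *P (p +P q) ≋ r *P p +P r *P q
  *P-distribˡ r p q = ≋-trans (*P-comm r (p +P q))
    (≋-trans (*P-distribʳ r p q) (+P-cong (*P-comm p r) (*P-comm q r)))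

  -P_ : Poly k → Poly k
  -P p = scaleP (- 1ℚ) p

  +P-inverseʳ : ∀ (p : Poly k) → p -P p ≋ 0P
  +P-inverseʳ p = lin-ext λ φ _ → trans (lin-++ φ p _) (trans (cong ((lin φ p) +_) (lin-scale φ (- 1ℚ) p))
    (solve 1 (λ y → y :+ con (- 1ℚ) :* y := con 0ℚ) refl (lin φ p)))

  -P-cong : ∀ {p q : Poly k} → p ≋ q → -P p ≋ -P q
  -P-cong {p} {q} pq = ≋-trans (scaleP-≋ (- 1ℚ) p)
    (≋-trans (*P-congˡ (constP (- 1ℚ)) pq) (≋-sym (scaleP-≋ (- 1ℚ) q)))

polyRing : ℕ → CommutativeRing 0ℓ 0ℓ
polyRing k = record
  { Carrier = Poly k ; _≈_ = _≋_ ; _+_ = _+P_ ; _*_ = _*P_ ; -_ = -P_ ; 0# = 0P ; 1# = 1P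
  ; isCommutativeRing = record
    { isRing = record
      { +-isAbelianGroup = record
        { isGroup = record
          { isMonoid = record
            { isSemigroup = record
              { isMagma = record
                { isEquivalence = record { refl = ≋-refl ; sym = ≋-sym ; trans = ≋-trans }
                ; ∙-cong = +P-cong }
              ; assoc = λ p q r → lin-ext λ φ _ → cong (lin φ) (Listₚ.++-assoc p q r) }
            ; identity = (λ p → ≋-refl) , (λ p → lin-ext λ φ _ → cong (lin φ) (Listₚ.++-identityʳ p)) }
          ; inverse = (λ p → ≋-trans (+P-comm (-P p) p) (+P-inverseʳ p)) , +P-inverseʳ
          ; ⁻¹-cong = -P-cong }
        ; comm = +P-comm }
      ; *-cong = *P-cong
      ; *-assoc = *P-assoc
      ; *-identity = *P-identityˡ , (λ p → ≋-trans (*P-comm p 1P) (*P-identityˡ p))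
      ; distrib = *P-distribˡ , *P-distribʳ }
    ; *-comm = *P-comm } }

module _ {k : ℕ} where
  open CommutativeRing (polyRing k) public
    using (+-identityʳ; *-identityʳ; zeroˡ; zeroʳ; setoid)
    renaming (reflexive to ≋-reflexive; +-assoc to +P-assoc)
  open RingSums (polyRing k) public

open RingSums ℚₚ.+-*-commutativeRing public using ()
  renaming (∑ to ∑ℚ; ∑-cong to ∑ℚ-cong; ∑-zero to ∑ℚ-zero; ∑-only to ∑ℚ-only; ∑-comm to ∑ℚ-comm
           ; ∑-distrib-+ to ∑ℚ-distrib-+; ∑-allFin to ∑ℚ-allFin; ∑-filter to ∑ℚ-filter
           ; *-distribˡ-sum to *-distribˡ-∑ℚ; *-distribʳ-sum to *-distribʳ-∑ℚ)
module ≋-Reasoning {k : ℕ} where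
  open import Relation.Binary.Reasoning.Setoid (setoid {k}) public

module NSum = FiniteSum ℕₚ.+-0-commutativeMonoid

lin-∑ : ∀ {k} (φ : Mon k → ℚ) {n} (f : Fin n → Poly k) → lin φ (∑ f) ≡ ∑ℚ (λ i → lin φ (f i))
lin-∑ φ {zero}  f = refl
lin-∑ φ {suc n} f = trans (lin-++ φ (f zero) _) (cong ((lin φ (f zero)) +_) (lin-∑ φ (f ∘ suc)))

constP-+ : ∀ {k} a b → constP {k} (a + b) ≋ constP a +P constP b
constP-+ a b = lin-ext λ φ _ → solve 3 (λ a b f → (a :+ b) :* f :+ con 0ℚ := a :* f :+ (b :* f :+ con 0ℚ)) refl a b (φ 𝟎)

constP-* : ∀ {k} a b → constP {k} (a * b) ≋ constP a *P constP b
constP-* a b = lin-ext λ φ rφ → refl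

constP-0 : ∀ {k} → constP {k} 0ℚ ≋ 0P
constP-0 = lin-ext λ φ _ → trans (ℚₚ.+-identityʳ _) (ℚₚ.*-zeroˡ (φ 𝟎))

kronecker : ∀ {n} → Fin n → Fin n → ℚ
kronecker i j = if does (i Fin.≟ j) then 1ℚ else 0ℚ

kronecker-self : ∀ {n} (i : Fin n) → kronecker i i ≡ 1ℚ
kronecker-self i with i Fin.≟ i
... | yes _ = refl
... | no ne = ⊥-elim (ne refl)

kronecker-other : ∀ {n} {i j : Fin n} → i ≢ j → kronecker i j ≡ 0ℚ
kronecker-other {i = i} {j} ne with i Fin.≟ j
... | yes eq = ⊥-elim (ne eq)
... | no _   = refl

-- Induction on polynomials, and substitution

degree : ∀ {k} → Mon k → ℕ
degree = NSum.sum

unitMon-self : ∀ {k} (i : Fin k) → unitMon i i ≡ 1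
unitMon-self i with i Fin.≟ i
... | yes _ = refl
... | no ne = ⊥-elim (ne refl)

unitMon-other : ∀ {k} {i j : Fin k} → j ≢ i → unitMon i j ≡ 0
unitMon-other {i = i} {j} ne with i Fin.≟ j
... | yes refl = ⊥-elim (ne refl)
... | no _     = refl

degree-unit : ∀ {k} (i : Fin k) (m : Mon k) → degree (unitMon i ⊕ m) ≡ suc (degree m)
degree-unit i m = trans (NSum.∑-distrib-+ (unitMon i) m)
  (cong (ℕ._+ degree m) (trans (NSum.sum-only i (λ _ → unitMon-other)) (unitMon-self i)))

monomial-split : ∀ {k} (m : Mon k) → (m ≐ 𝟎) ⊎ ∃ λ i → ∃ λ m' → m ≐ unitMon i ⊕ m'
monomial-split m with any? (λ i → 1 ℕ.≤? m i)
... | yes (i , le) = inj₂ (i , (λ j → m j ℕ.∸ unitMon i j) , λ j → sym (ℕₚ.m+[n∸m]≡n (bound j)))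
  where
  bound : ∀ j → unitMon i j ℕ.≤ m j
  bound j with i Fin.≟ j
  ... | yes refl = le
  ... | no _     = ℕ.z≤n
... | no none = inj₁ (λ i → ℕₚ.n≤0⇒n≡0 (ℕₚ.≤-pred (ℕₚ.≰⇒> (λ le → none (i , le)))))

-- A monomial is peeled one variable at a time. The recursion is on its degree, since an exponent
-- vector offers no structure to recurse on.
module PolyInduction {k : ℕ} (Q : Poly k → Set)
  (resp : ∀ {p q} → p ≋ q → Q p → Q q)
  (base : ∀ c → Q (constP c))
  (plus : ∀ {p q} → Q p → Q q → Q (p +P q))
  (times : ∀ i {p} → Q p → Q (var i *P p)) where

  monomial : ∀ n c m → degree m ≡ n → Q ((c , m) ∷ [])
  monomial n c m eq with monomial-split m
  ... | inj₁ z = resp (lin-ext λ φ rφ → cong (λ x → c * x + 0ℚ) (rφ (λ i → sym (z i)))) (base c)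
  monomial zero c m eq | inj₂ (i , m' , mm)
    with () ← trans (sym (degree-unit i m')) (trans (NSum.sum-cong (λ j → sym (mm j))) eq)
  monomial (suc n) c m eq | inj₂ (i , m' , mm) =
    resp (lin-ext λ φ rφ → cong₂ (λ x y → x * y + 0ℚ) (ℚₚ.*-identityˡ c) (rφ (λ j → sym (mm j))))
      (times i (monomial n c m' (ℕₚ.suc-injective
        (trans (sym (degree-unit i m')) (trans (NSum.sum-cong (λ j → sym (mm j))) eq)))))

  poly-ind : ∀ p → Q p
  poly-ind [] = resp constP-0 (base 0ℚ)
  poly-ind ((c , m) ∷ p) = plus (monomial (degree m) c m refl) (poly-ind p)

module _ {k l : ℕ} where
  mon : (Fin k → Poly l) → Mon k → Poly l
  mon s m = ΠF k (λ i → powP (s i) (m i))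

  mon-∏ : ∀ s m → mon s m ≡ ∏ (λ i → powP (s i) (m i))
  mon-∏ s m = ∏-allFin k _

powP-cong : ∀ {l} {p q : Poly l} → p ≋ q → ∀ n → powP p n ≋ powP q n
powP-cong eq zero    = ≋-refl
powP-cong eq (suc n) = *P-cong eq (powP-cong eq n)

powP-+ : ∀ {l} (p : Poly l) m n → powP p (m ℕ.+ n) ≋ powP p m *P powP p n
powP-+ p zero    n = ≋-sym (*P-identityˡ _)
powP-+ p (suc m) n = ≋-trans (*P-congˡ p (powP-+ p m n)) (≋-sym (*P-assoc p _ _))

module _ {k l : ℕ} where
  mon-cong : ∀ {s s' : Fin k → Poly l} {m m'} → (∀ i → s i ≋ s' i) → m ≐ m' → mon s m ≋ mon s' m'
  mon-cong {s} {s'} {m} {m'} ss mm = begin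
    mon s m                        ≡⟨ mon-∏ s m ⟩
    ∏ (λ i → powP (s i) (m i))     ≈⟨ ∏-cong (λ i → ≋-trans (powP-cong (ss i) (m i)) (≋-reflexive (cong (powP (s' i)) (mm i)))) ⟩
    ∏ (λ i → powP (s' i) (m' i))   ≡⟨ sym (mon-∏ s' m') ⟩
    mon s' m' ∎
    where open ≋-Reasoning

  mon-⊕ : ∀ (s : Fin k → Poly l) m m' → mon s (m ⊕ m') ≋ mon s m *P mon s m'
  mon-⊕ s m m' = begin
    mon s (m ⊕ m')                         ≡⟨ mon-∏ s (m ⊕ m') ⟩
    ∏ (λ i → powP (s i) (m i ℕ.+ m' i))    ≈⟨ ∏-cong (λ i → powP-+ (s i) (m i) (m' i)) ⟩
    ∏ (λ i → powP (s i) (m i) *P powP (s i) (m' i)) ≈⟨ ∏-distrib-* (λ i → powP (s i) (m i)) (λ i → powP (s i) (m' i)) ⟩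
    ∏ (λ i → powP (s i) (m i)) *P ∏ (λ i → powP (s i) (m' i)) ≡⟨ sym (cong₂ _*P_ (mon-∏ s m) (mon-∏ s m')) ⟩
    mon s m *P mon s m' ∎
    where open ≋-Reasoning

  mon-unit : ∀ (s : Fin k → Poly l) i → mon s (unitMon i) ≋ s i
  mon-unit s i = begin
    mon s (unitMon i)                     ≡⟨ mon-∏ s (unitMon i) ⟩
    ∏ (λ j → powP (s j) (unitMon i j))    ≈⟨ ∏-only i (λ j ne → ≋-reflexive (cong (powP (s j)) (unitMon-other ne))) ⟩
    powP (s i) (unitMon i i)              ≡⟨ cong (powP (s i)) (unitMon-self i) ⟩
    s i *P 1P                             ≈⟨ *-identityʳ (s i) ⟩
    s i ∎
    where open ≋-Reasoning

  mon-𝟎 : ∀ (s : Fin k → Poly l) → mon s 𝟎 ≋ 1P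
  mon-𝟎 s = ≋-trans (≋-reflexive (mon-∏ s 𝟎)) (∏-one {f = λ i → powP (s i) 0} (λ _ → ≋-refl))

  -- A functional after a substitution is again a functional, the one sending `m` to the value on
  -- `mon s m`. The laws of `evalP` below are reduced to this.
  lin-evalP : ∀ (φ : Mon l → ℚ) (p : Poly k) s → lin φ (evalP p s) ≡ lin (λ m → lin φ (mon s m)) p
  lin-evalP φ [] s = refl
  lin-evalP φ ((c , m) ∷ p) s = trans (lin-++ φ (scaleP c (mon s m)) (evalP p s))
    (cong₂ _+_ (lin-scale φ c (mon s m)) (lin-evalP φ p s))

  evalP-cong : ∀ {p q : Poly k} {s s' : Fin k → Poly l} → p ≋ q → (∀ i → s i ≋ s' i) → evalP p s ≋ evalP q s'
  evalP-cong {p} {q} {s} {s'} pq ss = lin-ext λ φ rφ → begin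
    lin φ (evalP p s)                  ≡⟨ lin-evalP φ p s ⟩
    lin (λ m → lin φ (mon s m)) p      ≡⟨ lin-≋ (λ eq → lin-≋ rφ (mon-cong {s = s} (λ _ → ≋-refl) eq)) pq ⟩
    lin (λ m → lin φ (mon s m)) q      ≡⟨ lin-cong (λ m → lin-≋ rφ (mon-cong {s = s} {m = m} ss (λ _ → refl))) q ⟩
    lin (λ m → lin φ (mon s' m)) q     ≡⟨ sym (lin-evalP φ q s') ⟩
    lin φ (evalP q s') ∎
    where open ≡-Reasoning

  evalP-+ : ∀ (p q : Poly k) (s : Fin k → Poly l) → evalP (p +P q) s ≋ evalP p s +P evalP q s
  evalP-+ p q s = lin-ext λ φ rφ → trans (lin-evalP φ (p +P q) s) (trans (lin-++ _ p q)
    (trans (sym (cong₂ _+_ (lin-evalP φ p s) (lin-evalP φ q s))) (sym (lin-++ φ (evalP p s) (evalP q s)))))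

  evalP-* : ∀ (p q : Poly k) (s : Fin k → Poly l) → evalP (p *P q) s ≋ evalP p s *P evalP q s
  evalP-* p q s = lin-ext λ φ rφ → begin
    lin φ (evalP (p *P q) s) ≡⟨ lin-evalP φ (p *P q) s ⟩
    lin (λ m → lin φ (mon s m)) (p *P q) ≡⟨ lin-* _ p q ⟩
    lin (λ m → lin (λ m' → lin φ (mon s (m ⊕ m'))) q) p
      ≡⟨ lin-cong (λ m → lin-cong (λ m' → trans (lin-≋ rφ (mon-⊕ s m m')) (lin-* φ (mon s m) (mon s m'))) q) p ⟩
    lin (λ m → lin (λ m' → lin (λ a → lin (λ b → φ (a ⊕ b)) (mon s m')) (mon s m)) q) p
      -- The sum over the terms of `mon s m` and the sum over the terms of `q` are interchanged, so
      -- that `q` meets `mon s m'` and `lin-evalP` applies to it.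
      ≡⟨ lin-cong (λ m → sym (lin-swap (λ a m' → lin (λ b → φ (a ⊕ b)) (mon s m')) (mon s m) q)) p ⟩
    lin (λ m → lin (λ a → lin (λ m' → lin (λ b → φ (a ⊕ b)) (mon s m')) q) (mon s m)) p
      ≡⟨ lin-cong (λ m → lin-cong (λ a → sym (lin-evalP (λ b → φ (a ⊕ b)) q s)) (mon s m)) p ⟩
    lin (λ m → lin (λ a → lin (λ b → φ (a ⊕ b)) (evalP q s)) (mon s m)) p ≡⟨ sym (lin-evalP _ p s) ⟩
    lin (λ a → lin (λ b → φ (a ⊕ b)) (evalP q s)) (evalP p s) ≡⟨ sym (lin-* φ (evalP p s) (evalP q s)) ⟩
    lin φ (evalP p s *P evalP q s) ∎
    where open ≡-Reasoning

  evalP-const : ∀ c (s : Fin k → Poly l) → evalP (constP c) s ≋ constP c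
  evalP-const c s = lin-ext λ φ rφ → begin
    lin φ (evalP (constP c) s)     ≡⟨ lin-evalP φ (constP c) s ⟩
    c * lin φ (mon s 𝟎) + 0ℚ       ≡⟨ cong (λ x → c * x + 0ℚ) (lin-≋ rφ (mon-𝟎 s)) ⟩
    c * (1ℚ * φ 𝟎 + 0ℚ) + 0ℚ       ≡⟨ cong (λ x → c * x + 0ℚ) (trans (ℚₚ.+-identityʳ _) (ℚₚ.*-identityˡ _)) ⟩
    c * φ 𝟎 + 0ℚ ∎
    where open ≡-Reasoning

  evalP-var : ∀ i (s : Fin k → Poly l) → evalP (var i) s ≋ s i
  evalP-var i s = lin-ext λ φ rφ → begin
    lin φ (evalP (var i) s)              ≡⟨ lin-evalP φ (var i) s ⟩
    1ℚ * lin φ (mon s (unitMon i)) + 0ℚ  ≡⟨ trans (ℚₚ.+-identityʳ _) (ℚₚ.*-identityˡ _) ⟩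
    lin φ (mon s (unitMon i))            ≡⟨ lin-≋ rφ (mon-unit s i) ⟩
    lin φ (s i) ∎
    where open ≡-Reasoning

  evalP-scale : ∀ c (p : Poly k) (s : Fin k → Poly l) → evalP (scaleP c p) s ≋ scaleP c (evalP p s)
  evalP-scale c p s = lin-ext λ φ rφ → trans (lin-evalP φ (scaleP c p) s) (trans (lin-scale _ c p)
    (trans (cong (c *_) (sym (lin-evalP φ p s))) (sym (lin-scale φ c (evalP p s)))))

  evalP-∑ : ∀ {n} (f : Fin n → Poly k) (s : Fin k → Poly l) → evalP (∑ f) s ≋ ∑ (λ i → evalP (f i) s)
  evalP-∑ {zero}  f s = ≋-refl
  evalP-∑ {suc n} f s = ≋-trans (evalP-+ (f zero) _ s) (+P-congˡ (evalP (f zero) s) (evalP-∑ (f ∘ suc) s))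

  evalP-∏ : ∀ {n} (f : Fin n → Poly k) (s : Fin k → Poly l) → evalP (∏ f) s ≋ ∏ (λ i → evalP (f i) s)
  evalP-∏ {zero}  f s = evalP-const 1ℚ s
  evalP-∏ {suc n} f s = ≋-trans (evalP-* (f zero) _ s) (*P-congˡ (evalP (f zero) s) (evalP-∏ (f ∘ suc) s))

evalP-id : ∀ {k} (p : Poly k) → evalP p var ≋ p
evalP-id = PolyInduction.poly-ind (λ p → evalP p var ≋ p)
  (λ pq h → ≋-trans (evalP-cong (≋-sym pq) (λ _ → ≋-refl)) (≋-trans h pq))
  (λ c → evalP-const c var)
  (λ {p} {q} hp hq → ≋-trans (evalP-+ p q var) (+P-cong hp hq))
  (λ i {p} hp → ≋-trans (evalP-* (var i) p var) (*P-cong (evalP-var i var) hp))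

evalP-∘ : ∀ {k l n} (s : Fin k → Poly l) (s' : Fin l → Poly n) (p : Poly k) →
  evalP (evalP p s) s' ≋ evalP p (λ i → evalP (s i) s')
evalP-∘ s s' = PolyInduction.poly-ind (λ p → evalP (evalP p s) s' ≋ evalP p (λ i → evalP (s i) s'))
  (λ pq h → ≋-trans (evalP-cong (evalP-cong (≋-sym pq) (λ _ → ≋-refl)) (λ _ → ≋-refl))
              (≋-trans h (evalP-cong pq (λ _ → ≋-refl))))
  (λ c → ≋-trans (evalP-cong (evalP-const c s) (λ _ → ≋-refl)) (≋-trans (evalP-const c s') (≋-sym (evalP-const c (λ i → evalP (s i) s')))))
  (λ {p} {q} hp hq → ≋-trans (evalP-cong (evalP-+ p q s) (λ _ → ≋-refl))
      (≋-trans (evalP-+ (evalP p s) (evalP q s) s') (≋-trans (+P-cong hp hq) (≋-sym (evalP-+ p q _)))))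
  (λ i {p} hp → ≋-trans (evalP-cong (evalP-* (var i) p s) (λ _ → ≋-refl))
      (≋-trans (evalP-* (evalP (var i) s) (evalP p s) s')
        (≋-trans (*P-cong (evalP-cong (evalP-var i s) (λ _ → ≋-refl)) hp)
          (≋-sym (≋-trans (evalP-* (var i) p _) (*P-cong (evalP-var i _) ≋-refl))))))

-- Coefficients and linear forms

module _ {k : ℕ} where
  coeff-+ : ∀ (p q : Poly k) e → coeff (p +P q) e ≡ coeff p e + coeff q e
  coeff-+ p q e = trans (coeff-lin (p +P q) e) (trans (lin-++ (δ e) p q)
    (sym (cong₂ _+_ (coeff-lin p e) (coeff-lin q e))))

  coeff-scale : ∀ c (p : Poly k) e → coeff (scaleP c p) e ≡ c * coeff p e
  coeff-scale c p e = trans (coeff-lin (scaleP c p) e) (trans (lin-scale (δ e) c p)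
    (cong (c *_) (sym (coeff-lin p e))))

  coeff-∑ : ∀ {n} (f : Fin n → Poly k) e → coeff (∑ f) e ≡ ∑ℚ (λ i → coeff (f i) e)
  coeff-∑ f e = trans (coeff-lin (∑ f) e) (trans (lin-∑ (δ e) f)
    (∑ℚ-cong (λ i → sym (coeff-lin (f i) e))))

  coeff-const-𝟎 : ∀ c → coeff (constP {k} c) 𝟎 ≡ c
  coeff-const-𝟎 c = trans (coeff-lin (constP {k} c) 𝟎) (trans (cong (λ x → c * x + 0ℚ) (δ-hit {k} {𝟎} {𝟎} (λ _ → refl)))
    (trans (ℚₚ.+-identityʳ _) (ℚₚ.*-identityʳ c)))

  coeff-const-unit : ∀ c i → coeff (constP {k} c) (unitMon i) ≡ 0ℚ
  coeff-const-unit c i = trans (coeff-lin (constP c) (unitMon i))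
    (trans (cong (λ x → c * x + 0ℚ) (δ-miss {e = unitMon i} miss)) (trans (ℚₚ.+-identityʳ _) (ℚₚ.*-zeroʳ c)))
    where
    miss : ¬ (𝟎 ≐ unitMon i)
    miss h with () ← trans (h i) (unitMon-self i)

  private
    lin-var* : ∀ (φ : Mon k → ℚ) i p → lin φ (var i *P p) ≡ lin (λ m → φ (unitMon i ⊕ m)) p
    lin-var* φ i p = trans (lin-* φ (var i) p) (trans (ℚₚ.+-identityʳ _) (ℚₚ.*-identityˡ _))

    coeff-var*-miss : ∀ i (p : Poly k) e → e i ≡ 0 → coeff (var i *P p) e ≡ 0ℚ
    coeff-var*-miss i p e z = trans (coeff-lin (var i *P p) e) (trans (lin-var* (δ e) i p)
      (trans (lin-cong (λ m → δ-miss (λ h → ℕₚ.1+n≢0 (trans (cong (ℕ._+ m i) (sym (unitMon-self i))) (trans (h i) z)))) p) (lin-zero p)))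

  coeff-var*-shift : ∀ i (p : Poly k) e → coeff (var i *P p) (unitMon i ⊕ e) ≡ coeff p e
  coeff-var*-shift i p e = trans (coeff-lin (var i *P p) (unitMon i ⊕ e)) (trans (lin-var* (δ (unitMon i ⊕ e)) i p)
    (trans (lin-cong shift p) (sym (coeff-lin p e))))
    where
    shift : ∀ m → δ (unitMon i ⊕ e) (unitMon i ⊕ m) ≡ δ e m
    shift m with δ-dec e m
    ... | inj₁ (h , eq) = trans (δ-hit (λ j → cong ((unitMon i j) ℕ.+_) (h j))) (sym eq)
    ... | inj₂ (h , eq) = trans (δ-miss (λ h' → h (λ j → ℕₚ.+-cancelˡ-≡ (unitMon i j) _ _ (h' j)))) (sym eq)

  coeff-resp : ∀ (p : Poly k) {e e'} → e ≐ e' → coeff p e ≡ coeff p e'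
  coeff-resp p {e} {e'} ee = trans (coeff-lin p e) (trans (lin-cong same p) (sym (coeff-lin p e')))
    where
    same : ∀ m → δ e m ≡ δ e' m
    same m with δ-dec e m
    ... | inj₁ (h , eq) = trans eq (sym (δ-hit (λ j → trans (h j) (ee j))))
    ... | inj₂ (h , eq) = trans eq (sym (δ-miss (λ h' → h (λ j → trans (h' j) (sym (ee j))))))

  coeff-var*-𝟎 : ∀ i (p : Poly k) → coeff (var i *P p) 𝟎 ≡ 0ℚ
  coeff-var*-𝟎 i p = coeff-var*-miss i p 𝟎 refl

  coeff-var*-unit : ∀ i (p : Poly k) → coeff (var i *P p) (unitMon i) ≡ coeff p 𝟎
  coeff-var*-unit i p = trans (coeff-resp (var i *P p) {unitMon i} {unitMon i ⊕ 𝟎} (λ j → sym (ℕₚ.+-identityʳ _)))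
    (coeff-var*-shift i p 𝟎)

  coeff-var*-other : ∀ {i j} → i ≢ j → ∀ (p : Poly k) → coeff (var i *P p) (unitMon j) ≡ 0ℚ
  coeff-var*-other {i} {j} ne p = coeff-var*-miss i p (unitMon j) (unitMon-other ne)

  linV : (Fin k → ℚ) → Poly k
  linV v = ΣF k (λ j → scaleP (v j) (var j))

  linV-∑ : ∀ v → linV v ≡ ∑ (λ j → scaleP (v j) (var j))
  linV-∑ v = ∑-allFin k _

  lin-linV : ∀ (φ : Mon k → ℚ) v → lin φ (linV v) ≡ ∑ℚ (λ j → v j * lin φ (var j))
  lin-linV φ v = trans (cong (lin φ) (linV-∑ v)) (trans (lin-∑ φ (λ j → scaleP (v j) (var j)))
    (∑ℚ-cong (λ j → lin-scale φ (v j) (var j))))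

  linV-cong : ∀ {v v'} → (∀ j → v j ≡ v' j) → linV v ≋ linV v'
  linV-cong {v} {v'} eq = lin-ext λ φ _ → trans (lin-linV φ v)
    (trans (∑ℚ-cong (λ j → cong (_* lin φ (var j)) (eq j))) (sym (lin-linV φ v')))

  linV-combine : ∀ v c a → linV v +P scaleP c (linV a) ≋ linV (λ j → v j + c * a j)
  linV-combine v c a = lin-ext λ φ _ → begin
    lin φ (linV v +P scaleP c (linV a))
      ≡⟨ trans (lin-++ φ (linV v) _) (cong₂ _+_ (lin-linV φ v) (trans (lin-scale φ c (linV a)) (cong (c *_) (lin-linV φ a)))) ⟩
    ∑ℚ (λ j → v j * lin φ (var j)) + c * ∑ℚ (λ j → a j * lin φ (var j))
      ≡⟨ cong ((∑ℚ (λ j → v j * lin φ (var j))) +_) (*-distribˡ-∑ℚ c (λ j → a j * lin φ (var j))) ⟩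
    ∑ℚ (λ j → v j * lin φ (var j)) + ∑ℚ (λ j → c * (a j * lin φ (var j)))
      ≡⟨ sym (∑ℚ-distrib-+ (λ j → v j * lin φ (var j)) (λ j → c * (a j * lin φ (var j)))) ⟩
    ∑ℚ (λ j → v j * lin φ (var j) + c * (a j * lin φ (var j)))
      ≡⟨ ∑ℚ-cong (λ j → solve 4 (λ v c a x → v :* x :+ c :* (a :* x) := (v :+ c :* a) :* x) refl (v j) c (a j) (lin φ (var j))) ⟩
    ∑ℚ (λ j → (v j + c * a j) * lin φ (var j)) ≡⟨ sym (lin-linV φ (λ j → v j + c * a j)) ⟩
    lin φ (linV (λ j → v j + c * a j)) ∎
    where open ≡-Reasoning

  linV-unit : ∀ i → linV (kronecker i) ≋ var i
  linV-unit i = lin-ext λ φ _ → trans (lin-linV φ (kronecker i))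
    (trans (∑ℚ-only i (λ j ne → trans (cong (_* lin φ (var j)) (kronecker-other (λ eq → ne (sym eq)))) (ℚₚ.*-zeroˡ (lin φ (var j)))))
      (trans (cong (_* lin φ (var i)) (kronecker-self i)) (ℚₚ.*-identityˡ (lin φ (var i)))))

  linV-*P : ∀ v (q : Poly k) → linV v *P q ≋ ∑ (λ j → scaleP (v j) (var j *P q))
  linV-*P v q = begin
    linV v *P q                                ≡⟨ cong (_*P q) (linV-∑ v) ⟩
    ∑ (λ j → scaleP (v j) (var j)) *P q        ≈⟨ *-distribʳ-sum q (λ j → scaleP (v j) (var j)) ⟩
    ∑ (λ j → scaleP (v j) (var j) *P q)        ≈⟨ ∑-cong (λ j → ≋-trans (*P-congʳ q (scaleP-≋ (v j) (var j)))
                                                    (≋-trans (*P-assoc (constP (v j)) (var j) q) (≋-sym (scaleP-≋ (v j) _)))) ⟩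
    ∑ (λ j → scaleP (v j) (var j *P q)) ∎
    where open ≋-Reasoning

  coeff-linV*-unit : ∀ v (q : Poly k) i → coeff (linV v *P q) (unitMon i) ≡ v i * coeff q 𝟎
  coeff-linV*-unit v q i = begin
    coeff (linV v *P q) (unitMon i)                          ≡⟨ at (linV-*P v q) (unitMon i) ⟩
    coeff (∑ (λ j → scaleP (v j) (var j *P q))) (unitMon i)  ≡⟨ coeff-∑ (λ j → scaleP (v j) (var j *P q)) (unitMon i) ⟩
    ∑ℚ (λ j → coeff (scaleP (v j) (var j *P q)) (unitMon i))
      ≡⟨ ∑ℚ-cong (λ j → coeff-scale (v j) (var j *P q) (unitMon i)) ⟩
    ∑ℚ (λ j → v j * coeff (var j *P q) (unitMon i))
      ≡⟨ ∑ℚ-only i (λ j ne → trans (cong ((v j) *_) (coeff-var*-other ne q)) (ℚₚ.*-zeroʳ (v j))) ⟩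
    v i * coeff (var i *P q) (unitMon i)                     ≡⟨ cong ((v i) *_) (coeff-var*-unit i q) ⟩
    v i * coeff q 𝟎 ∎
    where open ≡-Reasoning

  coeff-linV*-𝟎 : ∀ v (q : Poly k) → coeff (linV v *P q) 𝟎 ≡ 0ℚ
  coeff-linV*-𝟎 v q = begin
    coeff (linV v *P q) 𝟎                          ≡⟨ at (linV-*P v q) 𝟎 ⟩
    coeff (∑ (λ j → scaleP (v j) (var j *P q))) 𝟎  ≡⟨ coeff-∑ (λ j → scaleP (v j) (var j *P q)) 𝟎 ⟩
    ∑ℚ (λ j → coeff (scaleP (v j) (var j *P q)) 𝟎)
      ≡⟨ ∑ℚ-zero (λ j → trans (coeff-scale (v j) (var j *P q) 𝟎) (trans (cong ((v j) *_) (coeff-var*-𝟎 j q)) (ℚₚ.*-zeroʳ (v j)))) ⟩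
    0ℚ ∎
    where open ≡-Reasoning

evalP-linV : ∀ {k l} v (s : Fin k → Poly l) → evalP (linV v) s ≋ ∑ (λ j → scaleP (v j) (s j))
evalP-linV {k} {l} v s = begin
  evalP (linV v) s                            ≡⟨ cong (λ p → evalP p s) (linV-∑ v) ⟩
  evalP (∑ (λ j → scaleP (v j) (var j))) s    ≈⟨ evalP-∑ (λ j → scaleP (v j) (var j)) s ⟩
  ∑ (λ j → evalP (scaleP (v j) (var j)) s)    ≈⟨ ∑-cong (λ j → ≋-trans (evalP-scale (v j) (var j) s) (scaleP-cong (v j) (evalP-var j s))) ⟩
  ∑ (λ j → scaleP (v j) (s j)) ∎
  where open ≋-Reasoning

-- The chain rule at the origin: substituting linear forms multiplies linear parts.
module LinearPart {k l : ℕ} (A : Fin k → Fin l → ℚ) where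
  private
    s : Fin k → Poly l
    s j = linV (A j)

    -- The constant term has to be carried along: the linear part of `var i *P p` is the constant
    -- term of `p` times the variable.
    Q : Poly k → Set
    Q p = coeff (evalP p s) 𝟎 ≡ coeff p 𝟎 ×
          (∀ i → coeff (evalP p s) (unitMon i) ≡ ∑ℚ (λ j → coeff p (unitMon j) * A j i))

    open ≡-Reasoning

    Q-resp : ∀ {p q} → p ≋ q → Q p → Q q
    Q-resp pq (h₀ , h₁) =
      trans (sym (at e 𝟎)) (trans h₀ (at pq 𝟎)) ,
      λ i → trans (sym (at e (unitMon i))) (trans (h₁ i) (∑ℚ-cong (λ j → cong (_* A j i) (at pq (unitMon j)))))
      where e = evalP-cong {s = s} pq (λ _ → ≋-refl)

    Q-const : ∀ c → Q (constP c)
    Q-const c =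
      trans (at e 𝟎) (trans (coeff-const-𝟎 {l} c) (sym (coeff-const-𝟎 {k} c))) ,
      λ i → trans (at e (unitMon i)) (trans (coeff-const-unit c i)
        (sym (∑ℚ-zero (λ j → trans (cong (_* A j i) (coeff-const-unit c j)) (ℚₚ.*-zeroˡ (A j i))))))
      where e = evalP-const c s

    Q-+ : ∀ {p q} → Q p → Q q → Q (p +P q)
    Q-+ {p} {q} (p₀ , p₁) (q₀ , q₁) =
      trans (at e 𝟎) (trans (coeff-+ (evalP p s) (evalP q s) 𝟎) (trans (cong₂ _+_ p₀ q₀) (sym (coeff-+ p q 𝟎)))) ,
      λ i → begin
        coeff (evalP (p +P q) s) (unitMon i) ≡⟨ trans (at e (unitMon i)) (coeff-+ (evalP p s) (evalP q s) (unitMon i)) ⟩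
        coeff (evalP p s) (unitMon i) + coeff (evalP q s) (unitMon i) ≡⟨ cong₂ _+_ (p₁ i) (q₁ i) ⟩
        ∑ℚ (λ j → coeff p (unitMon j) * A j i) + ∑ℚ (λ j → coeff q (unitMon j) * A j i)
          ≡⟨ sym (∑ℚ-distrib-+ (λ j → coeff p (unitMon j) * A j i) (λ j → coeff q (unitMon j) * A j i)) ⟩
        ∑ℚ (λ j → coeff p (unitMon j) * A j i + coeff q (unitMon j) * A j i)
          ≡⟨ ∑ℚ-cong (λ j → trans (sym (ℚₚ.*-distribʳ-+ (A j i) (coeff p (unitMon j)) (coeff q (unitMon j))))
               (cong (_* A j i) (sym (coeff-+ p q (unitMon j))))) ⟩
        ∑ℚ (λ j → coeff (p +P q) (unitMon j) * A j i) ∎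
      where e = evalP-+ p q s

    Q-* : ∀ i {p} → Q p → Q (var i *P p)
    Q-* i {p} (p₀ , _) =
      trans (at e 𝟎) (trans (coeff-linV*-𝟎 (A i) (evalP p s)) (sym (coeff-var*-𝟎 i p))) ,
      λ l → begin
        coeff (evalP (var i *P p) s) (unitMon l) ≡⟨ trans (at e (unitMon l)) (coeff-linV*-unit (A i) (evalP p s) l) ⟩
        A i l * coeff (evalP p s) 𝟎 ≡⟨ trans (cong ((A i l) *_) p₀) (ℚₚ.*-comm (A i l) (coeff p 𝟎)) ⟩
        coeff p 𝟎 * A i l ≡⟨ cong (_* A i l) (sym (coeff-var*-unit i p)) ⟩
        coeff (var i *P p) (unitMon i) * A i l
          ≡⟨ sym (∑ℚ-only i (λ j ne → trans (cong (_* A j l) (coeff-var*-other (λ eq → ne (sym eq)) p)) (ℚₚ.*-zeroˡ (A j l)))) ⟩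
        ∑ℚ (λ j → coeff (var i *P p) (unitMon j) * A j l) ∎
      where e = ≋-trans (evalP-* (var i) p s) (*P-congʳ (evalP p s) (evalP-var i s))

  linear-part : ∀ p i → coeff (evalP p s) (unitMon i) ≡ ∑ℚ (λ j → coeff p (unitMon j) * A j i)
  linear-part p = proj₂ (PolyInduction.poly-ind Q Q-resp Q-const (λ {p} {q} → Q-+ {p} {q}) Q-* p)

-- Shears, and linear forms as non zero divisors

module Shear {k : ℕ} (i : Fin k) (w : Poly k) where
  step : Fin k → Poly k
  step j = if does (i Fin.≟ j) then w else 0P

  -- This has two uses. One choice of `w` makes it an invertible change of variables carrying a
  -- linear form to `var i`; another makes it the projection that sets a linear form to zero.
  shear : Poly k → Poly k
  shear p = evalP p (λ j → var j +P step j)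

  step-self : step i ≡ w
  step-self with i Fin.≟ i
  ... | yes _ = refl
  ... | no ne = ⊥-elim (ne refl)

  step-other : ∀ {j} → j ≢ i → step j ≡ 0P
  step-other {j} ne with i Fin.≟ j
  ... | yes refl = ⊥-elim (ne refl)
  ... | no _     = refl

  shear-linV : ∀ v → shear (linV v) ≋ linV v +P scaleP (v i) w
  shear-linV v = lin-ext λ φ rφ → begin
    lin φ (shear (linV v)) ≡⟨ lin-≋ rφ (evalP-linV v (λ j → var j +P step j)) ⟩
    lin φ (∑ (λ j → scaleP (v j) (var j +P step j))) ≡⟨ lin-∑ φ (λ j → scaleP (v j) (var j +P step j)) ⟩
    ∑ℚ (λ j → lin φ (scaleP (v j) (var j +P step j)))
      ≡⟨ ∑ℚ-cong (λ j → trans (lin-scale φ (v j) (var j +P step j))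
            (trans (cong ((v j) *_) (lin-++ φ (var j) (step j))) (ℚₚ.*-distribˡ-+ (v j) (lin φ (var j)) (lin φ (step j))))) ⟩
    ∑ℚ (λ j → v j * lin φ (var j) + v j * lin φ (step j)) ≡⟨ ∑ℚ-distrib-+ (λ j → v j * lin φ (var j)) (λ j → v j * lin φ (step j)) ⟩
    ∑ℚ (λ j → v j * lin φ (var j)) + ∑ℚ (λ j → v j * lin φ (step j))
      ≡⟨ cong₂ _+_ (sym (lin-linV φ v)) (∑ℚ-only i (λ j ne → trans (cong (λ x → v j * lin φ x) (step-other ne)) (ℚₚ.*-zeroʳ (v j)))) ⟩
    lin φ (linV v) + v i * lin φ (step i) ≡⟨ cong (λ x → lin φ (linV v) + v i * lin φ x) step-self ⟩
    lin φ (linV v) + v i * lin φ w ≡⟨ cong ((lin φ (linV v)) +_) (sym (lin-scale φ (v i) w)) ⟩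
    lin φ (linV v) + lin φ (scaleP (v i) w) ≡⟨ sym (lin-++ φ (linV v) (scaleP (v i) w)) ⟩
    lin φ (linV v +P scaleP (v i) w) ∎
    where open ≡-Reasoning

  shear-other : ∀ {j} → j ≢ i → shear (var j) ≋ var j
  shear-other {j} ne = ≋-trans (evalP-var j (λ j → var j +P step j))
    (≋-trans (≋-reflexive (cong ((var j) +P_) (step-other ne))) (+-identityʳ (var j)))

  private
    step-multiple : ∀ j → ∃ λ c → step j ≋ w *P c
    step-multiple j with i Fin.≟ j
    ... | yes _ = 1P , ≋-sym (*-identityʳ w)
    ... | no _  = 0P , ≋-sym (zeroʳ w)

  -- The substitution is the identity modulo `w` on every variable, and congruence modulo `w`
  -- survives sums and products.
  shear-mod : ∀ p → ∃ λ q → shear p ≋ p +P w *P q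
  shear-mod = PolyInduction.poly-ind (λ p → ∃ λ q → shear p ≋ p +P w *P q)
    (λ { pq (q , h) → q , ≋-trans (evalP-cong (≋-sym pq) (λ _ → ≋-refl)) (≋-trans h (+P-congʳ (w *P q) pq)) })
    (λ c → 0P , ≋-trans (evalP-const c (λ j → var j +P step j)) (≋-sym (≋-trans (+P-congˡ (constP c) (zeroʳ w)) (+-identityʳ (constP c)))))
    (λ { {p} {p'} (q , h) (q' , h') → q +P q' , ≋-trans (evalP-+ p p' _) (≋-trans (+P-cong h h')
      (add-multiples w p q p' q')) })
    (λ { j {p} (q , h) → let (c , e) = step-multiple j in
      var j *P q +P c *P p +P c *P w *P q ,
      ≋-trans (evalP-* (var j) p _) (≋-trans (*P-cong (≋-trans (evalP-var j _) (+P-congˡ (var j) e)) h)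
        (multiply-multiples w (var j) c p q)) })
    where open PartialFractions (polyRing k) {k} using (add-multiples; multiply-multiples)

ℚ-inverse : ∀ q → q ≢ 0ℚ → ∃ λ r → r * q ≡ 1ℚ
ℚ-inverse q ne = (ℚ.1/ q) , ℚₚ.*-inverseˡ q
  where instance _ = ℚ.≢-nonZero ne

NonZeroDivisor : ∀ {k} → Poly k → Set
NonZeroDivisor p = ∀ q → p *P q ≋ 0P → q ≋ 0P

var-nzd : ∀ {k} (i : Fin k) → NonZeroDivisor (var i)
var-nzd i q h = mk≋ (λ e → trans (sym (coeff-var*-shift i q e)) (at h (unitMon i ⊕ e)))

-- A shear carries the linear form to a variable, and another shear undoes it.
linV-nzd : ∀ {k} (v : Fin k → ℚ) i → v i ≢ 0ℚ → NonZeroDivisor (linV v)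
linV-nzd {k} v i ne p h = ≋-trans (≋-sym undo) (evalP-cong τp≋0 (λ _ → ≋-refl))
  where
  r = proj₁ (ℚ-inverse (v i) ne)
  rv = proj₂ (ℚ-inverse (v i) ne)
  x : Fin k → ℚ
  x = kronecker i
  a b : Fin k → ℚ
  -- `a` solves `v + v i * a = x`, so `τ` carries `linV v` to `var i`. `b` is chosen so that `ρ`
  -- carries `var i` to `linV v`, and this makes `ρ` undo `τ`.
  a j = r * (x j - v j)
  b j = v j - x j
  module τ = Shear i (linV a)
  module ρ = Shear i (linV b)
  open ≡-Reasoning

  τℓ : τ.shear (linV v) ≋ var i
  τℓ = ≋-trans (τ.shear-linV v) (≋-trans (linV-combine v (v i) a) (≋-trans (linV-cong {v = λ j → v j + v i * a j} {v' = x} λ j → begin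
    v j + v i * (r * (x j - v j))    ≡⟨ solve 4 (λ v c r x → v :+ c :* (r :* (x :- v)) := v :+ (r :* c) :* (x :- v)) refl (v j) (v i) r (x j) ⟩
    v j + (r * v i) * (x j - v j)    ≡⟨ cong (λ t → v j + t * (x j - v j)) rv ⟩
    v j + 1ℚ * (x j - v j)           ≡⟨ solve 2 (λ v x → v :+ con 1ℚ :* (x :- v) := x) refl (v j) (x j) ⟩
    x j ∎) (linV-unit i)))

  τp≋0 : τ.shear p ≋ 0P
  τp≋0 = var-nzd i _ (≋-trans (*P-congʳ (τ.shear p) (≋-sym τℓ))
    (≋-trans (≋-sym (evalP-* (linV v) p _)) (evalP-cong h (λ _ → ≋-refl))))

  xa : Fin k → ℚ
  xa j = x j + 1ℚ * a j

  var+w : var i +P linV a ≋ linV xa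
  var+w = ≋-trans (+P-cong (≋-sym (linV-unit i)) (≋-trans (≋-sym (*P-identityˡ (linV a))) (≋-sym (scaleP-≋ 1ℚ (linV a)))))
    (linV-combine x 1ℚ a)

  ρ-xa : ∀ j → xa j + xa i * b j ≡ x j
  ρ-xa j = begin
    xa j + xa i * b j ≡⟨ cong (λ t → xa j + (t + 1ℚ * (r * (t - v i))) * b j) (kronecker-self i) ⟩
    xa j + (1ℚ + 1ℚ * (r * (1ℚ - v i))) * b j
      ≡⟨ solve 4 (λ x r v c → (x :+ con 1ℚ :* (r :* (x :- v))) :+ (con 1ℚ :+ con 1ℚ :* (r :* (con 1ℚ :- c))) :* (v :- x)
           := x :+ (con 1ℚ :- r :* c) :* (v :- x)) refl (x j) r (v j) (v i) ⟩
    x j + (1ℚ - r * v i) * (v j - x j) ≡⟨ cong (λ t → x j + (1ℚ - t) * (v j - x j)) rv ⟩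
    x j + (1ℚ - 1ℚ) * (v j - x j) ≡⟨ solve 2 (λ x v → x :+ (con 1ℚ :- con 1ℚ) :* (v :- x) := x) refl (x j) (v j) ⟩
    x j ∎

  undo-var : ∀ j → ρ.shear (var j +P τ.step j) ≋ var j
  undo-var j with i Fin.≟ j
  ... | no i≢j = ≋-trans (evalP-cong (+-identityʳ (var j)) (λ _ → ≋-refl)) (ρ.shear-other (λ eq → i≢j (sym eq)))
  ... | yes refl = ≋-trans (evalP-cong var+w (λ _ → ≋-refl))
      (≋-trans (ρ.shear-linV xa) (≋-trans (linV-combine xa (xa i) b) (≋-trans (linV-cong {v = λ j → xa j + xa i * b j} {v' = x} ρ-xa) (linV-unit i))))

  undo : ρ.shear (τ.shear p) ≋ p
  undo = ≋-trans (evalP-∘ _ _ p) (≋-trans (evalP-cong (≋-refl {p = p}) undo-var) (evalP-id p))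

-- Determinants and orientations

-- Adjacent exchanges generate all permutations, and on lists an entry can be removed or moved
-- without reindexing.
record Alternating {A : Set} (F : List A → ℚ) : Set where
  constructor mkAlternating
  field exchange : ∀ ps x y qs → F (ps ++ x ∷ y ∷ qs) ≡ - F (ps ++ y ∷ x ∷ qs)
open Alternating

alternating-∷ : ∀ {A : Set} {F : List A → ℚ} → Alternating F → ∀ x → Alternating (λ r → F (x ∷ r))
alternating-∷ h x .exchange ps = h .exchange (x ∷ ps)

-- alt F (c₀ ∷ … ∷ cₙ ∷ []) = Σₖ (-1)ᵏ F cₖ (c₀ … ĉₖ … cₙ)
alt : {A : Set} → (A → List A → ℚ) → List A → ℚ
alt F []       = 0ℚ
alt F (c ∷ cs) = F c cs - alt (λ c' r → F c' (c ∷ r)) cs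

module _ {A : Set} where

  alt-cong : ∀ {F G : A → List A → ℚ} → (∀ c r → F c r ≡ G c r) → ∀ cs → alt F cs ≡ alt G cs
  alt-cong h []       = refl
  alt-cong h (c ∷ cs) = cong₂ _-_ (h c cs) (alt-cong (λ c' r → h c' (c ∷ r)) cs)

  alt-linear : ∀ (F G : A → List A → ℚ) a cs → alt (λ c r → F c r + a * G c r) cs ≡ alt F cs + a * alt G cs
  alt-linear F G a [] = solve 1 (λ a → con 0ℚ := con 0ℚ :+ a :* con 0ℚ) refl a
  alt-linear F G a (c ∷ cs) = trans (cong (λ t → (F c cs + a * G c cs) - t) (alt-linear _ _ a cs))
    (solve 5 (λ f g a x y → (f :+ a :* g) :- (x :+ a :* y) := (f :- x) :+ a :* (g :- y)) refl
      (F c cs) (G c cs) a _ _)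

  alt-neg : ∀ (F : A → List A → ℚ) cs → alt (λ c r → - F c r) cs ≡ - alt F cs
  alt-neg F [] = refl
  alt-neg F (c ∷ cs) = trans (cong (λ t → - F c cs - t) (alt-neg _ cs))
    (solve 2 (λ f x → (:- f) :- (:- x) := :- (f :- x)) refl (F c cs) _)

  -- The two terms that single out an exchanged entry trade places with opposite signs; every other
  -- term takes its sign from `F c`.
  alt-alternating : ∀ {F : A → List A → ℚ} → (∀ c → Alternating (F c)) → Alternating (alt F)
  alt-alternating {F} h .exchange [] x y qs = begin
    F x (y ∷ qs) - (F y (x ∷ qs) - alt (λ c r → F c (x ∷ y ∷ r)) qs)
      ≡⟨ cong (λ t → F x (y ∷ qs) - (F y (x ∷ qs) - t)) (trans (alt-cong (λ c → h c .exchange [] x y) qs) (alt-neg _ qs)) ⟩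
    F x (y ∷ qs) - (F y (x ∷ qs) - - alt (λ c r → F c (y ∷ x ∷ r)) qs)
      ≡⟨ solve 3 (λ f g t → f :- (g :- (:- t)) := :- (g :- (f :- t))) refl (F x (y ∷ qs)) (F y (x ∷ qs)) _ ⟩
    - (F y (x ∷ qs) - (F x (y ∷ qs) - alt (λ c r → F c (y ∷ x ∷ r)) qs)) ∎
    where open ≡-Reasoning
  alt-alternating {F} h .exchange (p ∷ ps) x y qs =
    trans (cong₂ _-_ (h p .exchange ps x y qs) (alt-alternating (λ c → alternating-∷ (h c) p) .exchange ps x y qs))
      (solve 2 (λ f t → (:- f) :- (:- t) := :- (f :- t)) refl (F p (ps ++ y ∷ x ∷ qs)) _)

  alt-tabulate : ∀ n (F : A → List A → ℚ) (c : Fin (suc n) → A) →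
    alt F (tabulate c) ≡
    ∑ℚ (λ k → negOnePowℚ (toℕ k) * F (c k) (tabulate (c ∘ punchIn k)))
  alt-tabulate zero F c =
    solve 1 (λ f → f :- con 0ℚ := con 1ℚ :* f :+ con 0ℚ) refl (F (c zero) [])
  alt-tabulate (suc n) F c = begin
    F₀ - alt (λ c' r → F c' (c zero ∷ r)) (tabulate (c ∘ suc))
      ≡⟨ cong (λ t → F₀ - t) (alt-tabulate n (λ c' r → F c' (c zero ∷ r)) (c ∘ suc)) ⟩
    F₀ - ∑ℚ s
      ≡⟨ solve 2 (λ f x → f :- x := con 1ℚ :* f :+ con (- 1ℚ) :* x) refl F₀ (∑ℚ s) ⟩
    1ℚ * F₀ + (- 1ℚ) * ∑ℚ s
      ≡⟨ cong ((1ℚ * F₀) +_) (trans (*-distribˡ-∑ℚ (- 1ℚ) s)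
           (∑ℚ-cong (λ k → solve 2 (λ x y → con (- 1ℚ) :* (x :* y) := (:- x) :* y) refl
              (negOnePowℚ (toℕ k)) (F (c (suc k)) (tabulate (c ∘ punchIn (suc k))))))) ⟩
    ∑ℚ (λ k → negOnePowℚ (toℕ k) * F (c k) (tabulate (c ∘ punchIn k))) ∎
    where
    open ≡-Reasoning
    F₀ = F (c zero) (tabulate (c ∘ suc))
    s : Fin (suc n) → ℚ
    s k = negOnePowℚ (toℕ k) * F (c (suc k)) (tabulate (c ∘ punchIn (suc k)))

  pull-front : ∀ {F : List A → ℚ} → Alternating F → ∀ {n} (c : Fin (suc n) → A) k →
    F (tabulate c) ≡ negOnePowℚ (toℕ k) * F (c k ∷ tabulate (c ∘ punchIn k))
  pull-front h c zero = sym (ℚₚ.*-identityˡ _)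
  pull-front {F} h {suc n} c (suc k) = trans (pull-front (alternating-∷ h (c zero)) (c ∘ suc) k)
    (trans (cong ((negOnePowℚ (toℕ k)) *_) (h .exchange [] (c zero) (c (suc k)) _))
      (solve 2 (λ x y → x :* (:- y) := (:- x) :* y) refl (negOnePowℚ (toℕ k)) _))

  pull-front-++ : ∀ {F : List A → ℚ} → Alternating F → ∀ ps x qs →
    F (ps ++ x ∷ qs) ≡ negOnePowℚ (length ps) * F (x ∷ ps ++ qs)
  pull-front-++ h [] x qs = sym (ℚₚ.*-identityˡ _)
  pull-front-++ {F} h (p ∷ ps) x qs = trans (pull-front-++ (alternating-∷ h p) ps x qs)
    (trans (cong ((negOnePowℚ (length ps)) *_) (h .exchange [] p x _))
      (solve 2 (λ x y → x :* (:- y) := (:- x) :* y) refl (negOnePowℚ (length ps)) _))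

-- det as a function of the list of columns; the value is 0 when their number is not n.
D : ∀ n → List (Fin n → ℚ) → ℚ
D zero    []      = 1ℚ
D zero    (_ ∷ _) = 0ℚ
D (suc n) cs      = alt (λ c r → c zero * D n (map (_∘ suc) r)) cs

det-D : ∀ n (M : Fin n → Fin n → ℚ) → det M ≡ D n (tabulate (λ k i → M i k))
det-D zero    M = refl
det-D (suc n) M = begin
  det M ≡⟨ ∑ℚ-allFin (suc n) (λ k → negOnePowℚ (toℕ k) * (M zero k * det (λ i j → M (suc i) (punchIn k j)))) ⟩
  ∑ℚ (λ k → negOnePowℚ (toℕ k) * (M zero k * det (λ i j → M (suc i) (punchIn k j))))
    ≡⟨ ∑ℚ-cong (λ k → cong (λ t → negOnePowℚ (toℕ k) * (M zero k * t))
         (trans (det-D n (λ i j → M (suc i) (punchIn k j)))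
                (cong (D n) (sym (Listₚ.map-tabulate (λ j i → M i (punchIn k j)) (_∘ suc)))))) ⟩
  ∑ℚ (λ k → negOnePowℚ (toℕ k) * (M zero k * D n (map (_∘ suc) (tabulate (λ j i → M i (punchIn k j))))))
    ≡⟨ sym (alt-tabulate n (λ c r → c zero * D n (map (_∘ suc) r)) (λ k i → M i k)) ⟩
  D (suc n) (tabulate (λ k i → M i k)) ∎
  where open ≡-Reasoning

D-alternating : ∀ n → Alternating (D n)
D-alternating zero .exchange []      x y qs = refl
D-alternating zero .exchange (_ ∷ _) x y qs = refl
D-alternating (suc n) = alt-alternating λ c → mkAlternating λ ps x y qs → begin
  c zero * D n (map (_∘ suc) (ps ++ x ∷ y ∷ qs))
    ≡⟨ cong (λ l → c zero * D n l) (Listₚ.map-++ (_∘ suc) ps (x ∷ y ∷ qs)) ⟩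
  c zero * D n (map (_∘ suc) ps ++ x ∘ suc ∷ y ∘ suc ∷ map (_∘ suc) qs)
    ≡⟨ cong ((c zero) *_) (D-alternating n .exchange (map (_∘ suc) ps) (x ∘ suc) (y ∘ suc) (map (_∘ suc) qs)) ⟩
  c zero * - D n (map (_∘ suc) ps ++ y ∘ suc ∷ x ∘ suc ∷ map (_∘ suc) qs)
    ≡⟨ cong (λ l → c zero * - D n l) (sym (Listₚ.map-++ (_∘ suc) ps (y ∷ x ∷ qs))) ⟩
  c zero * - D n (map (_∘ suc) (ps ++ y ∷ x ∷ qs))
    ≡⟨ sym (ℚₚ.neg-distribʳ-* (c zero) _) ⟩
  - (c zero * D n (map (_∘ suc) (ps ++ y ∷ x ∷ qs))) ∎
  where open ≡-Reasoning

-- Linearity in the first column is enough, because `D-alternating` lets any column be moved to the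
-- front.
D-linear : ∀ n {z x y : Fin n → ℚ} a → (∀ i → z i ≡ x i + a * y i) →
  ∀ cs → D n (z ∷ cs) ≡ D n (x ∷ cs) + a * D n (y ∷ cs)
D-linear zero a h cs = solve 1 (λ a → con 0ℚ := con 0ℚ :+ a :* con 0ℚ) refl a
D-linear (suc n) {z} {x} {y} a h cs = begin
  z zero * d - alt (λ c r → c zero * D n (z ∘ suc ∷ map (_∘ suc) r)) cs
    ≡⟨ cong₂ (λ s t → s * d - t) (h zero) (trans (alt-cong step cs) (alt-linear Fx Fy a cs)) ⟩
  (x zero + a * y zero) * d - (alt Fx cs + a * alt Fy cs)
    ≡⟨ solve 6 (λ x a y d s t → (x :+ a :* y) :* d :- (s :+ a :* t) := (x :* d :- s) :+ a :* (y :* d :- t)) refl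
         (x zero) a (y zero) d (alt Fx cs) (alt Fy cs) ⟩
  (x zero * d - alt Fx cs) + a * (y zero * d - alt Fy cs) ∎
  where
  open ≡-Reasoning
  d = D n (map (_∘ suc) cs)
  Fx Fy : (Fin (suc n) → ℚ) → List (Fin (suc n) → ℚ) → ℚ
  Fx c r = c zero * D n (x ∘ suc ∷ map (_∘ suc) r)
  Fy c r = c zero * D n (y ∘ suc ∷ map (_∘ suc) r)
  step : ∀ c r → c zero * D n (z ∘ suc ∷ map (_∘ suc) r) ≡ Fx c r + a * Fy c r
  step c r = trans (cong ((c zero) *_) (D-linear n a (h ∘ suc) (map (_∘ suc) r)))
    (solve 4 (λ c u a v → c :* (u :+ a :* v) := c :* u :+ a :* (c :* v)) refl (c zero) _ a _)

-- A case of `D-linear`: `a * u` is `u` plus `a - 1` times `u`.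
D-scale : ∀ n {z u : Fin n → ℚ} a → (∀ i → z i ≡ a * u i) → ∀ cs → D n (z ∷ cs) ≡ a * D n (u ∷ cs)
D-scale n {z} {u} a h cs = trans
  (D-linear n (a - 1ℚ) (λ i → trans (h i) (solve 2 (λ a u → a :* u := u :+ (a :- con 1ℚ) :* u) refl a (u i))) cs)
  (solve 2 (λ a d → d :+ (a :- con 1ℚ) :* d := a :* d) refl a (D n (u ∷ cs)))

x≡-x⇒x≡0 : ∀ x → x ≡ - x → x ≡ 0ℚ
x≡-x⇒x≡0 x h = begin
  x                         ≡⟨ solve 1 (λ x → x := con ℚ.½ :* (x :+ x)) refl x ⟩
  ℚ.½ * (x + x)             ≡⟨ cong (λ t → ℚ.½ * (x + t)) h ⟩
  ℚ.½ * (x + - x)           ≡⟨ solve 1 (λ x → con ℚ.½ :* (x :+ :- x) := con 0ℚ) refl x ⟩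
  0ℚ ∎
  where open ≡-Reasoning

D-repeat : ∀ n x cs → D n (x ∷ x ∷ cs) ≡ 0ℚ
D-repeat n x cs = x≡-x⇒x≡0 _ (D-alternating n .exchange [] x x cs)

-- Each column is pulled to the front and split by linearity; the surplus term contains `u` twice.
-- Hence a determinant with column `u` sees the other columns only modulo `u`. In `go`, `ps` holds
-- the columns already replaced.
D-column-operations : ∀ n (u : Fin n → ℚ) {cs cs'} →
  Pointwise (λ c c' → ∃ λ a → ∀ i → c i ≡ c' i + a * u i) cs cs' → D n (u ∷ cs) ≡ D n (u ∷ cs')
D-column-operations n u {cs} {cs'} = go []
  where
  open ≡-Reasoning
  go : ∀ ps {cs cs'} → Pointwise (λ c c' → ∃ λ a → ∀ i → c i ≡ c' i + a * u i) cs cs' →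
    D n (u ∷ ps ++ cs) ≡ D n (u ∷ ps ++ cs')
  go ps [] = refl
  go ps {c ∷ cs} {c' ∷ cs'} ((a , h) ∷ hs) = begin
    D n (u ∷ ps ++ c ∷ cs)  ≡⟨ pull-front-++ (D-alternating n) (u ∷ ps) c cs ⟩
    s * D n (c ∷ u ∷ ps ++ cs)  ≡⟨ cong (s *_) (D-linear n a h (u ∷ ps ++ cs)) ⟩
    s * (D n (c' ∷ u ∷ ps ++ cs) + a * D n (u ∷ u ∷ ps ++ cs))
      ≡⟨ cong (λ t → s * (D n (c' ∷ u ∷ ps ++ cs) + a * t)) (D-repeat n u (ps ++ cs)) ⟩
    s * (D n (c' ∷ u ∷ ps ++ cs) + a * 0ℚ)
      ≡⟨ solve 3 (λ s d a → s :* (d :+ a :* con 0ℚ) := s :* d) refl s _ a ⟩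
    s * D n (c' ∷ u ∷ ps ++ cs) ≡⟨ sym (pull-front-++ (D-alternating n) (u ∷ ps) c' cs) ⟩
    D n (u ∷ ps ++ c' ∷ cs)   ≡⟨ cong (λ l → D n (u ∷ l)) (sym (Listₚ.++-assoc ps (c' ∷ []) cs)) ⟩
    D n (u ∷ (ps ++ c' ∷ []) ++ cs)   ≡⟨ go (ps ++ c' ∷ []) hs ⟩
    D n (u ∷ (ps ++ c' ∷ []) ++ cs')  ≡⟨ cong (λ l → D n (u ∷ l)) (Listₚ.++-assoc ps (c' ∷ []) cs') ⟩
    D n (u ∷ ps ++ c' ∷ cs') ∎
    where s = negOnePowℚ (length (u ∷ ps))

unique-↭ : ∀ {A : Set} {xs ys : List A} → xs ↭ ys → Unique xs → Unique ys
unique-↭ ↭-refl        u                      = u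
unique-↭ (prep x p)    (a ∷ u)                = Perm.All-resp-↭ p a ∷ unique-↭ p u
unique-↭ (swap x y p)  ((x≢y ∷ ax) ∷ ay ∷ u)  =
  ((λ eq → x≢y (sym eq)) ∷ Perm.All-resp-↭ p ay) ∷ Perm.All-resp-↭ p ax ∷ unique-↭ p u
unique-↭ (↭-trans p q) u                      = unique-↭ q (unique-↭ p u)

negOnePowℚ-+ : ∀ m n → negOnePowℚ (m ℕ.+ n) ≡ negOnePowℚ m * negOnePowℚ n
negOnePowℚ-+ zero    n = sym (ℚₚ.*-identityˡ _)
negOnePowℚ-+ (suc m) n = trans (cong -_ (negOnePowℚ-+ m n)) (ℚₚ.neg-distribˡ-* (negOnePowℚ m) (negOnePowℚ n))

negOnePowℚ-square : ∀ n → negOnePowℚ n * negOnePowℚ n ≡ 1ℚ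
negOnePowℚ-square zero = refl
negOnePowℚ-square (suc n) = trans (solve 1 (λ x → (:- x) :* (:- x) := x :* x) refl (negOnePowℚ n)) (negOnePowℚ-square n)

inversionSign : ∀ {N} → List (Fin N) → ℚ
inversionSign xs = negOnePowℚ (inversions (map toℕ xs))

module _ {N : ℕ} where
  private
    smaller : Fin N → List (Fin N) → ℕ
    smaller x xs = length (filterᵇ (λ b → b ℕ.<ᵇ toℕ x) (map toℕ xs))

    ε : List (Fin N) → ℚ
    ε = inversionSign

    ε-∷ : ∀ x xs → ε (x ∷ xs) ≡ negOnePowℚ (smaller x xs) * ε xs
    ε-∷ x xs = negOnePowℚ-+ (smaller x xs) _

    less : Fin N → Fin N → ℕ
    less x y = if toℕ x ℕ.<ᵇ toℕ y then 1 else 0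

    smaller-∷ : ∀ x y ys → smaller x (y ∷ ys) ≡ less y x ℕ.+ smaller x ys
    smaller-∷ x y ys with toℕ y ℕ.<ᵇ toℕ x
    ... | true  = refl
    ... | false = refl

    smaller-↭ : ∀ x {xs ys} → xs ↭ ys → smaller x xs ≡ smaller x ys
    smaller-↭ x ↭-refl = refl
    smaller-↭ x (prep y p) = trans (smaller-∷ x y _) (trans (cong ((less y x) ℕ.+_) (smaller-↭ x p)) (sym (smaller-∷ x y _)))
    smaller-↭ x {.(y ∷ z ∷ xs)} {.(z ∷ y ∷ ys)} (swap {xs} {ys} y z p) = begin
      smaller x (y ∷ z ∷ xs) ≡⟨ trans (smaller-∷ x y (z ∷ xs)) (cong ((less y x) ℕ.+_) (smaller-∷ x z xs)) ⟩
      less y x ℕ.+ (less z x ℕ.+ smaller x xs) ≡⟨ cong (λ t → less y x ℕ.+ (less z x ℕ.+ t)) (smaller-↭ x p) ⟩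
      less y x ℕ.+ (less z x ℕ.+ smaller x ys) ≡⟨ x∙yz≈y∙xz (less y x) (less z x) (smaller x ys) ⟩
      less z x ℕ.+ (less y x ℕ.+ smaller x ys) ≡⟨ sym (trans (smaller-∷ x z (y ∷ ys)) (cong ((less z x) ℕ.+_) (smaller-∷ x y ys))) ⟩
      smaller x (z ∷ y ∷ ys) ∎
      where open ≡-Reasoning
            open import Algebra.Properties.CommutativeSemigroup ℕₚ.+-commutativeSemigroup using (x∙yz≈y∙xz)
    smaller-↭ x (↭-trans p q) = trans (smaller-↭ x p) (smaller-↭ x q)

    less-sign : ∀ x y → x ≢ y → negOnePowℚ (less y x) ≡ - negOnePowℚ (less x y)
    less-sign x y ne with toℕ y ℕ.<ᵇ toℕ x in yx | toℕ x ℕ.<ᵇ toℕ y in xy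
    ... | true  | false = refl
    ... | false | true  = refl
    ... | true  | true  = ⊥-elim (ℕₚ.<-asym (ℕₚ.<ᵇ⇒< (toℕ y) (toℕ x) (subst T (sym yx) _)) (ℕₚ.<ᵇ⇒< (toℕ x) (toℕ y) (subst T (sym xy) _)))
    ... | false | false = ⊥-elim (ne (Finₚ.toℕ-injective (ℕₚ.≤-antisym (≥ yx) (≥ xy))))
      where
      ≥ : ∀ {a b} → (a ℕ.<ᵇ b) ≡ false → b ℕ.≤ a
      ≥ {a} {b} f = ℕₚ.≮⇒≥ (λ lt → subst T f (ℕₚ.<⇒<ᵇ lt))

    -- The constructor `swap` also permutes the tails, whose signs may differ. Multiplying by the
    -- sign of the opposite tail compares the heads without computing either tail sign.
    ε-swap : ∀ x y {xs ys} → x ≢ y → xs ↭ ys → ε (x ∷ y ∷ xs) * ε ys ≡ - (ε (y ∷ x ∷ ys) * ε xs)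
    ε-swap x y {xs} {ys} ne p = begin
      ε (x ∷ y ∷ xs) * ε ys ≡⟨ cong (_* ε ys) (expand x y xs) ⟩
      a * b * (c * ε xs) * ε ys ≡⟨ cong (λ t → t * b * (c * ε xs) * ε ys) (less-sign x y ne) ⟩
      - a' * b * (c * ε xs) * ε ys ≡⟨ solve 5 (λ a b c e f → (:- a) :* b :* (c :* e) :* f := :- (a :* c :* (b :* f) :* e)) refl a' b c (ε xs) (ε ys) ⟩
      - (a' * c * (b * ε ys) * ε xs) ≡⟨ cong₂ (λ s t → - (a' * s * (t * ε ys) * ε xs)) (cong negOnePowℚ (smaller-↭ y p)) (cong negOnePowℚ (smaller-↭ x p)) ⟩
      - (a' * negOnePowℚ (smaller y ys) * (negOnePowℚ (smaller x ys) * ε ys) * ε xs) ≡⟨ cong (λ t → - (t * ε xs)) (sym (expand y x ys)) ⟩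
      - (ε (y ∷ x ∷ ys) * ε xs) ∎
      where
      open ≡-Reasoning
      a = negOnePowℚ (less y x)
      a' = negOnePowℚ (less x y)
      b = negOnePowℚ (smaller x xs)
      c = negOnePowℚ (smaller y xs)
      expand : ∀ x y xs → ε (x ∷ y ∷ xs) ≡ negOnePowℚ (less y x) * negOnePowℚ (smaller x xs) * (negOnePowℚ (smaller y xs) * ε xs)
      expand x y xs = trans (ε-∷ x (y ∷ xs)) (cong₂ _*_
        (trans (cong negOnePowℚ (smaller-∷ x y xs)) (negOnePowℚ-+ (less y x) (smaller x xs))) (ε-∷ y xs))

  -- Sign and function change by the same factor under a permutation. Distinctness enters through
  -- `less-sign`: exchanging equal entries would leave the number of inversions unchanged.
  alternating-↭ : ∀ {F : List (Fin N) → ℚ} → Alternating F → ∀ {xs ys} → xs ↭ ys → Unique xs →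
    inversionSign xs * F xs ≡ inversionSign ys * F ys
  alternating-↭ h ↭-refl u = refl
  alternating-↭ {F} h (prep {xs} {ys} x p) (_ ∷ u) = begin
    ε (x ∷ xs) * F (x ∷ xs) ≡⟨ cong (_* F (x ∷ xs)) (ε-∷ x xs) ⟩
    negOnePowℚ (smaller x xs) * ε xs * F (x ∷ xs) ≡⟨ ℚₚ.*-assoc (negOnePowℚ (smaller x xs)) (ε xs) (F (x ∷ xs)) ⟩
    negOnePowℚ (smaller x xs) * (ε xs * F (x ∷ xs))
      ≡⟨ cong₂ _*_ (cong negOnePowℚ (smaller-↭ x p)) (alternating-↭ (alternating-∷ h x) p u) ⟩
    negOnePowℚ (smaller x ys) * (ε ys * F (x ∷ ys)) ≡⟨ sym (ℚₚ.*-assoc (negOnePowℚ (smaller x ys)) (ε ys) (F (x ∷ ys))) ⟩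
    negOnePowℚ (smaller x ys) * ε ys * F (x ∷ ys) ≡⟨ cong (_* F (x ∷ ys)) (sym (ε-∷ x ys)) ⟩
    ε (x ∷ ys) * F (x ∷ ys) ∎
    where open ≡-Reasoning
  alternating-↭ {F} h (swap {xs} {ys} x y p) ((x≢y ∷ _) ∷ (_ ∷ u)) = begin
    ε (x ∷ y ∷ xs) * F (x ∷ y ∷ xs)
      ≡⟨ solve 2 (λ e f → e :* f := e :* (con 1ℚ :* f)) refl (ε (x ∷ y ∷ xs)) _ ⟩
    -- The factor 1 is written as the square of the tail's sign, one copy serving the induction
    -- hypothesis and the other `ε-swap`.
    ε (x ∷ y ∷ xs) * (1ℚ * F (x ∷ y ∷ xs)) ≡⟨ cong (λ t → ε (x ∷ y ∷ xs) * (t * F (x ∷ y ∷ xs))) (sym (negOnePowℚ-square (inversions (map toℕ xs)))) ⟩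
    ε (x ∷ y ∷ xs) * (ε xs * ε xs * F (x ∷ y ∷ xs))
      ≡⟨ solve 3 (λ e s f → e :* (s :* s :* f) := e :* s :* (s :* f)) refl (ε (x ∷ y ∷ xs)) (ε xs) _ ⟩
    ε (x ∷ y ∷ xs) * ε xs * (ε xs * F (x ∷ y ∷ xs))
      ≡⟨ cong ((ε (x ∷ y ∷ xs) * ε xs) *_) (alternating-↭ (alternating-∷ (alternating-∷ h x) y) p u) ⟩
    ε (x ∷ y ∷ xs) * ε xs * (ε ys * F (x ∷ y ∷ ys))
      ≡⟨ solve 4 (λ e s t f → e :* s :* (t :* f) := (e :* t) :* s :* f) refl (ε (x ∷ y ∷ xs)) (ε xs) (ε ys) _ ⟩
    (ε (x ∷ y ∷ xs) * ε ys) * ε xs * F (x ∷ y ∷ ys)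
      ≡⟨ cong₂ (λ s t → s * ε xs * t) (ε-swap x y x≢y p) (h .exchange [] x y ys) ⟩
    - (ε (y ∷ x ∷ ys) * ε xs) * ε xs * - F (y ∷ x ∷ ys)
      ≡⟨ solve 3 (λ e s f → (:- (e :* s)) :* s :* (:- f) := e :* ((s :* s) :* f)) refl (ε (y ∷ x ∷ ys)) (ε xs) _ ⟩
    ε (y ∷ x ∷ ys) * ((ε xs * ε xs) * F (y ∷ x ∷ ys)) ≡⟨ cong (λ t → ε (y ∷ x ∷ ys) * (t * F (y ∷ x ∷ ys))) (negOnePowℚ-square (inversions (map toℕ xs))) ⟩
    ε (y ∷ x ∷ ys) * (1ℚ * F (y ∷ x ∷ ys)) ≡⟨ cong ((ε (y ∷ x ∷ ys)) *_) (ℚₚ.*-identityˡ _) ⟩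
    ε (y ∷ x ∷ ys) * F (y ∷ x ∷ ys) ∎
    where open ≡-Reasoning
  alternating-↭ h (↭-trans p q) u = trans (alternating-↭ h p u) (alternating-↭ h q (unique-↭ p u))

-- Linear dependence and two-sided inverses

module _ where
  open FiniteSum (CommutativeRing.+-commutativeMonoid ℚₚ.+-*-commutativeRing) using (sum-remove)
  open ≡-Reasoning

  x*y≡0⇒y≡0 : ∀ {x y} → x ≢ 0ℚ → x * y ≡ 0ℚ → y ≡ 0ℚ
  x*y≡0⇒y≡0 {x} {y} ne h with ℚ-inverse x ne
  ... | r , rx = begin
    y           ≡⟨ sym (ℚₚ.*-identityˡ y) ⟩
    1ℚ * y      ≡⟨ cong (_* y) (sym rx) ⟩
    r * x * y   ≡⟨ ℚₚ.*-assoc r x y ⟩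
    r * (x * y) ≡⟨ cong (r *_) h ⟩
    r * 0ℚ      ≡⟨ ℚₚ.*-zeroʳ r ⟩
    0ℚ ∎

  -- Gaussian elimination on the first coordinate. If it vanishes on all vectors, one vector is
  -- dropped together with that coordinate; otherwise a pivot `p` clears it from the remaining
  -- vectors.
  dependent : ∀ n (V : Fin (suc n) → Fin n → ℚ) →
    Σ (Fin (suc n) → ℚ) λ c → (∃ λ i → c i ≢ 0ℚ) × (∀ j → ∑ℚ (λ i → c i * V i j) ≡ 0ℚ)
  dependent zero V = (λ _ → 1ℚ) , (zero , λ ()) , λ ()
  dependent (suc n) V with any? (λ i → ¬? (V i zero ℚₚ.≟ 0ℚ))
  ... | no none = c⁺ , (suc i₀ , c≢0) , λ
      { zero → ∑ℚ-zero (λ i → trans (cong ((c⁺ i) *_) (column₀ i)) (ℚₚ.*-zeroʳ (c⁺ i)))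
      ; (suc j) → trans (cong₂ _+_ (ℚₚ.*-zeroˡ (V zero (suc j))) (rel j)) refl }
    where
    column₀ : ∀ i → V i zero ≡ 0ℚ
    column₀ i with V i zero ℚₚ.≟ 0ℚ
    ... | yes eq = eq
    ... | no ne  = ⊥-elim (none (i , ne))
    ih = dependent n (λ i j → V (suc i) (suc j))
    c = proj₁ ih
    c⁺ : Fin (suc (suc n)) → ℚ
    c⁺ zero    = 0ℚ
    c⁺ (suc i) = c i
    i₀ = proj₁ (proj₁ (proj₂ ih))
    c≢0 = proj₂ (proj₁ (proj₂ ih))
    rel = proj₂ (proj₂ ih)
  ... | yes (p , Vp≢0) = c⁺ , (punchIn p i₀ , λ eq → c≢0 (trans (sym (c⁺-other i₀)) eq)) , rel⁺
    where
    r = proj₁ (ℚ-inverse (V p zero) Vp≢0)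
    rV = proj₂ (ℚ-inverse (V p zero) Vp≢0)
    q : Fin (suc n) → ℚ
    q i = V (punchIn p i) zero * r
    ih = dependent n (λ i j → V (punchIn p i) (suc j) - q i * V p (suc j))
    c = proj₁ ih
    i₀ = proj₁ (proj₁ (proj₂ ih))
    c≢0 = proj₂ (proj₁ (proj₂ ih))
    rel = proj₂ (proj₂ ih)
    c⁺ : Fin (suc (suc n)) → ℚ
    -- The coefficient of the pivot collects the multiples of `V p` subtracted from the other
    -- vectors, so the combination of the original vectors equals that of the reduced ones.
    c⁺ = Vector.insertAt c p (- ∑ℚ (λ i → c i * q i))
    c⁺-other : ∀ i → c⁺ (punchIn p i) ≡ c i
    c⁺-other = Vectorₚ.insertAt-punchIn c p _
    reduce : ∀ j → ∑ℚ (λ i → c⁺ i * V i j) ≡ ∑ℚ (λ i → c i * (V (punchIn p i) j - q i * V p j))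
    reduce j = begin
      ∑ℚ (λ i → c⁺ i * V i j) ≡⟨ sum-remove {i = p} (λ i → c⁺ i * V i j) ⟩
      c⁺ p * V p j + ∑ℚ (λ i → c⁺ (punchIn p i) * V (punchIn p i) j)
        ≡⟨ cong₂ _+_ (cong (_* V p j) (Vectorₚ.insertAt-lookup c p _)) (∑ℚ-cong (λ i → cong (_* V (punchIn p i) j) (c⁺-other i))) ⟩
      - ∑ℚ (λ i → c i * q i) * V p j + ∑ℚ (λ i → c i * V (punchIn p i) j)
        ≡⟨ solve 3 (λ s v t → (:- s) :* v :+ t := t :+ s :* (:- v)) refl (∑ℚ (λ i → c i * q i)) (V p j) _ ⟩
      ∑ℚ (λ i → c i * V (punchIn p i) j) + ∑ℚ (λ i → c i * q i) * - V p j
        ≡⟨ cong ((∑ℚ (λ i → c i * V (punchIn p i) j)) +_) (*-distribʳ-∑ℚ (- V p j) (λ i → c i * q i)) ⟩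
      ∑ℚ (λ i → c i * V (punchIn p i) j) + ∑ℚ (λ i → c i * q i * - V p j)
        ≡⟨ sym (∑ℚ-distrib-+ (λ i → c i * V (punchIn p i) j) (λ i → c i * q i * - V p j)) ⟩
      ∑ℚ (λ i → c i * V (punchIn p i) j + c i * q i * - V p j)
        ≡⟨ ∑ℚ-cong (λ i → solve 4 (λ c v q w → c :* v :+ c :* q :* (:- w) := c :* (v :- q :* w)) refl (c i) (V (punchIn p i) j) (q i) (V p j)) ⟩
      ∑ℚ (λ i → c i * (V (punchIn p i) j - q i * V p j)) ∎
    rel⁺ : ∀ j → ∑ℚ (λ i → c⁺ i * V i j) ≡ 0ℚ
    rel⁺ zero = trans (reduce zero) (∑ℚ-zero (λ i → begin
      c i * (V (punchIn p i) zero - V (punchIn p i) zero * r * V p zero)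
        ≡⟨ solve 4 (λ c v r w → c :* (v :- v :* r :* w) := c :* (v :- v :* (r :* w))) refl (c i) (V (punchIn p i) zero) r (V p zero) ⟩
      c i * (V (punchIn p i) zero - V (punchIn p i) zero * (r * V p zero))
        ≡⟨ cong (λ t → c i * (V (punchIn p i) zero - V (punchIn p i) zero * t)) rV ⟩
      c i * (V (punchIn p i) zero - V (punchIn p i) zero * 1ℚ)
        ≡⟨ solve 2 (λ c v → c :* (v :- v :* con 1ℚ) := con 0ℚ) refl (c i) (V (punchIn p i) zero) ⟩
      0ℚ ∎))
    rel⁺ (suc j) = trans (reduce (suc j)) (rel j)

  -- The unit vector at `l` and the columns of `M` are `n + 1` vectors in dimension `n`, hence
  -- dependent. Applying `A` to the relation identifies its coefficients as multiples of `c zero`,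
  -- which is therefore nonzero, and dividing by it writes the unit vector through the columns of
  -- `M`.
  left-inverse⇒right-inverse : ∀ {n} (A M : Fin n → Fin n → ℚ) →
    (∀ i k → ∑ℚ (λ j → A i j * M j k) ≡ kronecker i k) →
    ∀ j l → ∑ℚ (λ k → M j k * A k l) ≡ kronecker j l
  left-inverse⇒right-inverse {n} A M AM j l = begin
    ∑ℚ (λ k → M j k * A k l) ≡⟨ solve 2 (λ x y → x := y :+ (:- (y :+ (con (- 1ℚ) :* x)))) refl (∑ℚ (λ k → M j k * A k l)) (kronecker j l) ⟩
    kronecker j l + - (kronecker j l + (- 1ℚ) * ∑ℚ (λ k → M j k * A k l))
      ≡⟨ cong (λ t → kronecker j l + - t) (x*y≡0⇒y≡0 c₀≢0 scaled) ⟩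
    kronecker j l + - 0ℚ ≡⟨ solve 1 (λ y → y :+ (:- con 0ℚ) := y) refl (kronecker j l) ⟩
    kronecker j l ∎
    where
    V : Fin (suc n) → Fin n → ℚ
    V zero    j = kronecker j l
    V (suc k) j = M j k
    dep = dependent n V
    c : Fin (suc n) → ℚ
    c = proj₁ dep
    rel : ∀ j → c zero * kronecker j l + ∑ℚ (λ k → c (suc k) * M j k) ≡ 0ℚ
    rel = proj₂ (proj₂ dep)
    solved : ∀ i → c zero * A i l + c (suc i) ≡ 0ℚ
    solved i = begin
      c zero * A i l + c (suc i)
        ≡⟨ cong₂ _+_ left right ⟩
      ∑ℚ (λ j → A i j * (c zero * kronecker j l)) + ∑ℚ (λ j → ∑ℚ (λ k → A i j * (c (suc k) * M j k)))
        ≡⟨ cong ((∑ℚ (λ j → A i j * (c zero * kronecker j l))) +_) (∑ℚ-cong (λ j → sym (*-distribˡ-∑ℚ (A i j) (λ k → c (suc k) * M j k)))) ⟩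
      ∑ℚ (λ j → A i j * (c zero * kronecker j l)) + ∑ℚ (λ j → A i j * ∑ℚ (λ k → c (suc k) * M j k))
        ≡⟨ sym (∑ℚ-distrib-+ (λ j → A i j * (c zero * kronecker j l)) (λ j → A i j * ∑ℚ (λ k → c (suc k) * M j k))) ⟩
      ∑ℚ (λ j → A i j * (c zero * kronecker j l) + A i j * ∑ℚ (λ k → c (suc k) * M j k))
        ≡⟨ ∑ℚ-zero (λ j → trans (sym (ℚₚ.*-distribˡ-+ (A i j) (c zero * kronecker j l) _)) (trans (cong ((A i j) *_) (rel j)) (ℚₚ.*-zeroʳ (A i j)))) ⟩
      0ℚ ∎
      where
      left : c zero * A i l ≡ ∑ℚ (λ j → A i j * (c zero * kronecker j l))
      left = sym (trans (∑ℚ-only l (λ j ne → trans (cong (λ t → A i j * (c zero * t)) (kronecker-other ne))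
                (solve 2 (λ a c → a :* (c :* con 0ℚ) := con 0ℚ) refl (A i j) (c zero))))
             (trans (cong (λ t → A i l * (c zero * t)) (kronecker-self l)) (solve 2 (λ a c → a :* (c :* con 1ℚ) := c :* a) refl (A i l) (c zero))))
      right : c (suc i) ≡ ∑ℚ (λ j → ∑ℚ (λ k → A i j * (c (suc k) * M j k)))
      right = sym (begin
        ∑ℚ (λ j → ∑ℚ (λ k → A i j * (c (suc k) * M j k))) ≡⟨ ∑ℚ-comm (λ j k → A i j * (c (suc k) * M j k)) ⟩
        ∑ℚ (λ k → ∑ℚ (λ j → A i j * (c (suc k) * M j k)))
          ≡⟨ ∑ℚ-cong (λ k → ∑ℚ-cong (λ j → solve 3 (λ a c m → a :* (c :* m) := c :* (a :* m)) refl (A i j) (c (suc k)) (M j k))) ⟩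
        ∑ℚ (λ k → ∑ℚ (λ j → c (suc k) * (A i j * M j k))) ≡⟨ ∑ℚ-cong (λ k → trans (sym (*-distribˡ-∑ℚ (c (suc k)) (λ j → A i j * M j k))) (cong ((c (suc k)) *_) (AM i k))) ⟩
        ∑ℚ (λ k → c (suc k) * kronecker i k) ≡⟨ ∑ℚ-only i (λ k ne → trans (cong ((c (suc k)) *_) (kronecker-other (λ eq → ne (sym eq)))) (ℚₚ.*-zeroʳ (c (suc k)))) ⟩
        c (suc i) * kronecker i i ≡⟨ trans (cong ((c (suc i)) *_) (kronecker-self i)) (ℚₚ.*-identityʳ (c (suc i))) ⟩
        c (suc i) ∎)
    c-suc : ∀ k → c (suc k) ≡ - (c zero * A k l)
    c-suc k = trans (solve 2 (λ x y → x := (y :+ x) :+ (:- y)) refl (c (suc k)) (c zero * A k l))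
      (trans (cong (λ t → t + - (c zero * A k l)) (solved k)) (ℚₚ.+-identityˡ _))
    some≢0 : ∃ λ i → c i ≢ 0ℚ
    some≢0 = proj₁ (proj₂ dep)
    c₀≢0 : c zero ≢ 0ℚ
    c₀≢0 eq with some≢0
    ... | zero  , ne = ne eq
    ... | suc k , ne = ne (trans (c-suc k) (trans (cong (λ t → - (t * A k l)) eq) (cong -_ (ℚₚ.*-zeroˡ (A k l)))))
    scaled : c zero * (kronecker j l + (- 1ℚ) * ∑ℚ (λ k → M j k * A k l)) ≡ 0ℚ
    scaled = begin
      c zero * (kronecker j l + (- 1ℚ) * ∑ℚ (λ k → M j k * A k l))
        ≡⟨ solve 3 (λ c d s → c :* (d :+ con (- 1ℚ) :* s) := c :* d :+ (:- c) :* s) refl (c zero) (kronecker j l) _ ⟩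
      c zero * kronecker j l + - c zero * ∑ℚ (λ k → M j k * A k l)
        ≡⟨ cong ((c zero * kronecker j l) +_) (trans (*-distribˡ-∑ℚ (- c zero) (λ k → M j k * A k l))
             (∑ℚ-cong (λ k → trans (solve 3 (λ c m a → (:- c) :* (m :* a) := (:- (c :* a)) :* m) refl (c zero) (M j k) (A k l))
                              (cong (_* M j k) (sym (c-suc k)))))) ⟩
      c zero * kronecker j l + ∑ℚ (λ k → c (suc k) * M j k) ≡⟨ rel j ⟩
      0ℚ ∎

-- Simplicial posets and restriction to a cell

module Faces (P : SimplicialPoset) where
  open SimplicialPoset P renaming (refl to ≤-refl; antisym to ≤-antisym; trans to ≤-trans)

  infix 4 _⊑_
  _⊑_ : Fin N → Fin N → Set
  _⊑_ = _≤P_ P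

  -- The rank is a parameter `r`, not `rk y`, so that a rank known only through an equation can be
  -- substituted into the boolean structure.
  module Interval (y : Fin N) {r : ℕ} (B : BooleanInterval N le y r) where
    open BooleanInterval B

    vertex : Fin r → Fin N
    vertex i = from ⁅ i ⁆

    from≡ : ∀ s (p : from s ⊑ y) → to (from s) p ≡ s
    from≡ s p = trans (cong (to (from s)) (T-irrelevant p (from≤ s))) (to-from s)

    from-⊆ : ∀ s w (p : w ⊑ y) → from s ⊑ w → s ⊆ to w p
    from-⊆ s w p h = subst (_⊆ to w p) (from≡ s (from≤ s)) (to-mono (from s) w (from≤ s) p h)

    ⊆-from : ∀ s w (p : w ⊑ y) → s ⊆ to w p → from s ⊑ w
    ⊆-from s w p h = to-reflect (from s) w (from≤ s) p (subst (_⊆ to w p) (sym (from≡ s (from≤ s))) h)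

    vertex-∈ : ∀ i w (p : w ⊑ y) → vertex i ⊑ w → i ∈ to w p
    vertex-∈ i w p h = from-⊆ ⁅ i ⁆ w p h (Subsetₚ.x∈⁅x⁆ i)

    ∈-vertex : ∀ i w (p : w ⊑ y) → i ∈ to w p → vertex i ⊑ w
    ∈-vertex i w p i∈w = ⊆-from ⁅ i ⁆ w p (λ j∈ → subst (_∈ to w p) (sym (Subsetₚ.x∈⁅y⁆⇒x≡y i j∈)) i∈w)

    vertex-from : ∀ i s → vertex i ⊑ from s → i ∈ s
    vertex-from i s h = subst (i ∈_) (from≡ s (from≤ s)) (vertex-∈ i (from s) (from≤ s) h)

    from-vertex : ∀ i s → i ∈ s → vertex i ⊑ from s
    from-vertex i s h = ∈-vertex i (from s) (from≤ s) (subst (i ∈_) (sym (from≡ s (from≤ s))) h)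

    vertex-reflects : ∀ {w w'} → w ⊑ y → w' ⊑ y → (∀ i → vertex i ⊑ w → vertex i ⊑ w') → w ⊑ w'
    vertex-reflects {w} {w'} p p' h = to-reflect w w' p p' (λ {i} i∈ → vertex-∈ i w' p' (h i (∈-vertex i w p i∈)))

    vertex-antichain : ∀ {i j} → vertex i ⊑ vertex j → i ≡ j
    vertex-antichain {i} {j} h = Subsetₚ.x∈⁅y⁆⇒x≡y j (vertex-from i ⁅ j ⁆ h)

    vertex-injective : ∀ {i j} → vertex i ≡ vertex j → i ≡ j
    vertex-injective {i} eq = vertex-antichain (subst (vertex i ⊑_) eq (≤-refl _))

    vertex⋢bot : ∀ i → ¬ (vertex i ⊑ bot)
    vertex⋢bot i h = Subsetₚ.∉⊥ (vertex-from i ∅ (≤-trans _ _ _ h (bot-min (from ∅))))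

  -- Rank 0 would force `x` to be `bot`. In rank at least 2 two different vertices would lie below
  -- `x`, both different from `bot`, hence both equal to `x`.
  minimal⇒atom : ∀ x → x ≢ bot → (∀ u → u ⊑ x → u ≡ bot ⊎ u ≡ x) → IsAtom P x
  minimal⇒atom x x≢bot h with rk x | boolean x
  ... | 0 | B = ⊥-elim (x≢bot (≤-antisym x bot (vertex-reflects (≤-refl x) (bot-min x) (λ ())) (bot-min x)))
    where open Interval x B
  ... | 1 | B = refl
  ... | suc (suc r) | B = ⊥-elim (contra (vertex-antichain (subst (_⊑ vertex (suc zero)) (sym (vertex≡x zero))
            (subst (x ⊑_) (sym (vertex≡x (suc zero))) (≤-refl x)))))
    where
    open Interval x B
    open BooleanInterval B using (from≤)
    vertex≡x : ∀ i → vertex i ≡ x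
    vertex≡x i with h (vertex i) (from≤ ⁅ i ⁆)
    ... | inj₁ eq = ⊥-elim (vertex⋢bot i (subst (_⊑ bot) (sym eq) (≤-refl bot)))
    ... | inj₂ eq = eq
    contra : ¬ (Fin.zero {suc r} ≡ suc zero)
    contra ()

  module _ {x : Fin N} (atom : IsAtom P x) where
    private
      B : BooleanInterval N le x 1
      B = subst (BooleanInterval N le x) atom (boolean x)
    open Interval x B

    atom⋢bot : ¬ (x ⊑ bot)
    atom⋢bot h = vertex⋢bot zero (≤-trans _ _ _ (BooleanInterval.from≤ B ⁅ zero ⁆) h)

    atom-minimal : ∀ u → u ⊑ x → u ≡ bot ⊎ u ≡ x
    atom-minimal u p with T? (le (vertex zero) u)
    ... | yes v = inj₂ (≤-antisym u x p (vertex-reflects (≤-refl x) p (λ { zero _ → v })))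
    ... | no ¬v = inj₁ (≤-antisym u bot (vertex-reflects p (bot-min x) (λ { zero v → ⊥-elim (¬v v) })) (bot-min u))

    atom-below-atom : ∀ {x'} → IsAtom P x' → x' ⊑ x → x' ≡ x
    atom-below-atom {x'} atom' p with atom-minimal x' p
    ... | inj₂ eq = eq
    ... | inj₁ eq = ⊥-elim (no-bot (trans (sym (cong rk eq)) atom'))
      where
      no-bot : ¬ (rk bot ≡ 1)
      no-bot r = Interval.vertex⋢bot bot (subst (BooleanInterval N le bot) r (boolean bot)) zero
        (BooleanInterval.from≤ (subst (BooleanInterval N le bot) r (boolean bot)) ⁅ zero ⁆)

  module Vertices (y : Fin N) where
    open Interval y (boolean y) public
    open BooleanInterval (boolean y) public using (to; from; from≤)

    vertex≤ : ∀ i → vertex i ⊑ y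
    vertex≤ i = from≤ ⁅ i ⁆

    vertex-atom : ∀ i → IsAtom P (vertex i)
    vertex-atom i = minimal⇒atom (vertex i) (λ eq → vertex⋢bot i (subst (_⊑ bot) (sym eq) (≤-refl bot))) min
      where
      min : ∀ u → u ⊑ vertex i → u ≡ bot ⊎ u ≡ vertex i
      min u p with T? (le (vertex i) u)
      ... | yes q = inj₂ (≤-antisym u (vertex i) p q)
      ... | no ¬q = inj₁ (≤-antisym u bot (vertex-reflects (≤-trans _ _ _ p (vertex≤ i)) (bot-min y)
              (λ j q → ⊥-elim (¬q (subst (λ k → vertex k ⊑ u) (vertex-antichain (≤-trans _ _ _ q p)) q)))) (bot-min u))

    atom-vertex : ∀ {x} → IsAtom P x → x ⊑ y → ∃ λ i → vertex i ≡ x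
    atom-vertex {x} atom p with any? (λ i → T? (le (vertex i) x))
    ... | yes (i , q) = i , atom-below-atom atom (vertex-atom i) q
    ... | no none = ⊥-elim (atom⋢bot atom (vertex-reflects p (bot-min y) (λ i q → ⊥-elim (none (i , q)))))

    atoms-reflect : ∀ {w w'} → w ⊑ y → w' ⊑ y → (∀ x → IsAtom P x → x ⊑ w → x ⊑ w') → w ⊑ w'
    atoms-reflect p p' h = vertex-reflects p p' (λ i → h (vertex i) (vertex-atom i))

    vertex-enumerates : EnumAtoms P y vertex
    vertex-enumerates = (λ k → vertex-atom k , vertex≤ k) , (λ _ _ → vertex-injective) , λ _ → atom-vertex

    module _ {i j : Fin N} (p : i ⊑ y) (q : j ⊑ y) where
      -- Within a boolean interval this is the unique minimal upper bound, so the sum in a face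
      -- relation of `below P y` has a single summand.
      join : Fin N
      join = from (to i p ∪ to j q)

      join≤ : join ⊑ y
      join≤ = from≤ _

      left≤join : i ⊑ join
      left≤join = vertex-reflects p join≤ (λ k h → from-vertex k _ (Subsetₚ.x∈p∪q⁺ (inj₁ (vertex-∈ k i p h))))

      right≤join : j ⊑ join
      right≤join = vertex-reflects q join≤ (λ k h → from-vertex k _ (Subsetₚ.x∈p∪q⁺ (inj₂ (vertex-∈ k j q h))))

      atom≤join : ∀ {x} → IsAtom P x → x ⊑ join → x ⊑ i ⊎ x ⊑ j
      atom≤join {x} atom h with atom-vertex atom (≤-trans _ _ _ h join≤)
      ... | k , refl with Subsetₚ.x∈p∪q⁻ (to i p) (to j q) (vertex-from k _ h)
      ... | inj₁ k∈ = inj₁ (∈-vertex k i p k∈)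
      ... | inj₂ k∈ = inj₂ (∈-vertex k j q k∈)

      join-least : ∀ {w} → w ⊑ y → i ⊑ w → j ⊑ w → join ⊑ w
      join-least wy iw jw = atoms-reflect join≤ wy λ x atom h → case atom≤join atom h of λ
        { (inj₁ xi) → ≤-trans _ _ _ xi iw ; (inj₂ xj) → ≤-trans _ _ _ xj jw }

  enumerations-≤ : ∀ {a b z} {f : Fin a → Fin N} {g : Fin b → Fin N} →
    EnumAtoms P z f → EnumAtoms P z g → a ℕ.≤ b
  enumerations-≤ {f = f} {g} (f-atoms , f-inj , _) (_ , _ , g-onto) =
    Finₚ.injective⇒≤ {f = λ k → proj₁ (index k)}
      (λ {k} {k'} eq → f-inj k k' (trans (sym (proj₂ (index k))) (trans (cong g eq) (proj₂ (index k')))))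
    where index = λ k → g-onto (f k) (proj₁ (f-atoms k)) (proj₂ (f-atoms k))

  enumerations-↭ : ∀ {a b z} {f : Fin a → Fin N} {g : Fin b → Fin N} →
    EnumAtoms P z f → EnumAtoms P z g → tabulate f ↭ tabulate g
  enumerations-↭ {f = f} {g} (f-atoms , f-inj , f-onto) (g-atoms , g-inj , g-onto) =
    ∼bag⇒↭ (unique∧set⇒bag (tabulate⁺ (λ {i} {j} → f-inj i j)) (tabulate⁺ (λ {i} {j} → g-inj i j))
      (mk⇔ (convert f g f-atoms g-onto) (convert g f g-atoms f-onto)))
    where
    open import Data.List.Membership.Propositional renaming (_∈_ to _∈L_) using ()
    convert : ∀ {a b z} (f : Fin a → Fin N) (g : Fin b → Fin N) → (∀ k → IsAtom P (f k) × f k ⊑ z) →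
      (∀ x → IsAtom P x → x ⊑ z → ∃ λ k → g k ≡ x) → ∀ {x} → x ∈L tabulate f → x ∈L tabulate g
    convert f g f-atoms g-onto x∈ with ∈-tabulate⁻ x∈
    ... | k , refl with g-onto (f k) (proj₁ (f-atoms k)) (proj₂ (f-atoms k))
    ... | l , eq = subst (_∈L tabulate g) eq (∈-tabulate⁺ l)

  module Facets {d : ℕ} {y : Fin N} {o : Fin (suc d) → Fin N} (enum : EnumAtoms P y o) (k : Fin (suc d)) where
    open Vertices y
    private
      o-atom : ∀ k → IsAtom P (o k)
      o-atom k = proj₁ (proj₁ enum k)
      o≤ : ∀ k → o k ⊑ y
      o≤ k = proj₂ (proj₁ enum k)
      i₀ = atom-vertex (o-atom k) (o≤ k)

    face : Fin N
    face = from (∁ ⁅ proj₁ i₀ ⁆)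

    face≤ : face ⊑ y
    face≤ = from≤ _

    ⋢face : ¬ (o k ⊑ face)
    ⋢face h = Subsetₚ.x∈∁p⇒x∉p (vertex-from (proj₁ i₀) _ (subst (_⊑ face) (sym (proj₂ i₀)) h)) (Subsetₚ.x∈⁅x⁆ _)

    ⊑face : ∀ {x} → IsAtom P x → x ⊑ y → x ≢ o k → x ⊑ face
    ⊑face {x} atom p ne with atom-vertex atom p
    ... | i , refl = from-vertex i _ (Subsetₚ.x∉p⇒x∈∁p (λ i∈ → ne (trans (cong vertex (Subsetₚ.x∈⁅y⁆⇒x≡y _ i∈)) (proj₂ i₀))))

    private
      other : ∀ {z} → z ⊑ y → ¬ (o k ⊑ z) → ∀ x → IsAtom P x → x ⊑ z → ∃ λ j → o (punchIn k j) ≡ x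
      other z≤y ok⋢z x atom p with proj₂ (proj₂ enum) x atom (≤-trans _ _ _ p z≤y)
      ... | l , refl = punchOut k≢l , cong o (Finₚ.punchIn-punchOut k≢l)
        where
        k≢l : k ≢ l
        k≢l refl = ok⋢z p

    face-enumerates : EnumAtoms P face (o ∘ punchIn k)
    face-enumerates =
      (λ j → o-atom _ , ⊑face (o-atom _) (o≤ _) (λ eq → Finₚ.punchInᵢ≢i k j (proj₁ (proj₂ enum) _ _ eq))) ,
      (λ j j' eq → Finₚ.punchIn-injective k j j' (proj₁ (proj₂ enum) _ _ eq)) ,
      other face≤ ⋢face

    face-rank : rk face ≡ d
    face-rank = ℕₚ.≤-antisym
      (enumerations-≤ (Vertices.vertex-enumerates face) face-enumerates)
      (enumerations-≤ face-enumerates (Vertices.vertex-enumerates face))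

    -- If an atom x of the facet were missing from z, prepending it to the d atoms of z
    -- would inject suc d atoms into the d atoms of the facet.
    face-unique : ∀ {z} → rk z ≡ d → z ⊑ y → ¬ (o k ⊑ z) → z ≡ face
    face-unique {z} rz z≤y ok⋢z = ≤-antisym z face
      (atoms-reflect z≤y face≤ (λ x atom p → ⊑face atom (≤-trans _ _ _ p z≤y) (λ { refl → ok⋢z p })))
      (atoms-reflect face≤ z≤y descend)
      where
      module Z = Vertices z
      index : ∀ i → ∃ λ j → o (punchIn k j) ≡ Z.vertex i
      index i = other z≤y ok⋢z (Z.vertex i) (Z.vertex-atom i) (Z.vertex≤ i)
      index-injective : ∀ {i i'} → proj₁ (index i) ≡ proj₁ (index i') → i ≡ i'
      index-injective {i} {i'} eq =
        Z.vertex-injective (trans (sym (proj₂ (index i))) (trans (cong (o ∘ punchIn k) eq) (proj₂ (index i'))))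
      descend : ∀ x → IsAtom P x → x ⊑ face → x ⊑ z
      descend x atom p with T? (le x z)
      ... | yes q = q
      ... | no ¬q = ⊥-elim (ℕₚ.<-irrefl refl (subst (λ r → suc r ℕ.≤ d) rz (Finₚ.injective⇒≤ {f = extended} inj)))
        where
        jx = other face≤ ⋢face x atom p
        misses : ∀ i → proj₁ jx ≢ proj₁ (index i)
        misses i eq = ¬q (subst (_⊑ z) (trans (sym (proj₂ (index i))) (trans (cong (o ∘ punchIn k) (sym eq)) (proj₂ jx))) (Z.vertex≤ i))
        extended : Fin (suc (rk z)) → Fin d
        extended zero    = proj₁ jx
        extended (suc i) = proj₁ (index i)
        inj : ∀ {i i'} → extended i ≡ extended i' → i ≡ i'
        inj {zero}  {zero}   eq = refl
        inj {zero}  {suc i'} eq = ⊥-elim (misses i' eq)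
        inj {suc i} {zero}   eq = ⊥-elim (misses i (sym eq))
        inj {suc i} {suc i'} eq = cong suc (index-injective eq)

allF⇒ : ∀ {n} (f : Fin n → Bool) → T (allF f) → ∀ i → T (f i)
allF⇒ {n} f h i = All.lookup (Allₚ.all⁺ f (allFin n) h) (∈-allFin i)

⇒allF : ∀ {n} (f : Fin n → Bool) → (∀ i → T (f i)) → T (allF f)
⇒allF {n} f h = Allₚ.all⁻ f (Allₚ.tabulate⁺ h)

⇒anyF : ∀ {n} (f : Fin n → Bool) i → T (f i) → T (anyF f)
⇒anyF f i h = Anyₚ.any⁺ f (lose (∈-allFin i) h)

module _ {k : ℕ} where
  difference-zero : ∀ {p q : Poly k} → p -P q ≋ 0P → p ≋ q
  difference-zero {p} {q} h = lin-ext λ φ rφ → begin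
    lin φ p ≡⟨ solve 2 (λ x y → x := (x :+ con (- 1ℚ) :* y) :+ y) refl (lin φ p) (lin φ q) ⟩
    (lin φ p + (- 1ℚ) * lin φ q) + lin φ q
      ≡⟨ cong (_+ lin φ q) (trans (sym (trans (lin-++ φ p _) (cong ((lin φ p) +_) (lin-scale φ (- 1ℚ) q)))) (lin-≋ rφ h)) ⟩
    0ℚ + lin φ q ≡⟨ ℚₚ.+-identityˡ _ ⟩
    lin φ q ∎
    where open ≡-Reasoning

  zero-difference : ∀ {p q : Poly k} → p ≋ q → p -P q ≋ 0P
  zero-difference {p} {q} h = ≋-trans (+P-congʳ (-P q) h) (+P-inverseʳ q)

  -- Each `g z` is spread over the indices `i` with `o i ≡ z`, at most one by injectivity, and the
  -- order of summation is exchanged.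
  ∑-reindex : ∀ {n d} (o : Fin d → Fin n) → (∀ i j → o i ≡ o j → i ≡ j) →
    (g : Fin n → Poly k) → (∀ z → (∀ i → o i ≢ z) → g z ≋ 0P) → ∑ g ≋ ∑ (λ i → g (o i))
  ∑-reindex {n} {d} o inj g supp = begin
    ∑ g                         ≈⟨ ∑-cong column ⟩
    ∑ (λ z → ∑ (λ i → χ i z))   ≈⟨ ∑-comm (λ z i → χ i z) ⟩
    ∑ (λ i → ∑ (λ z → χ i z))   ≈⟨ ∑-cong (λ i → ≋-trans (∑-only (o i) (λ z ne → ≋-reflexive (χ-other i z (λ eq → ne (sym eq))))) (≋-reflexive (χ-self i))) ⟩
    ∑ (λ i → g (o i)) ∎
    where
    open ≋-Reasoning
    χ : Fin d → Fin n → Poly k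
    χ i z = if does (o i Fin.≟ z) then g z else 0P
    χ-other : ∀ i z → o i ≢ z → χ i z ≡ 0P
    χ-other i z ne with o i Fin.≟ z
    ... | yes eq = ⊥-elim (ne eq)
    ... | no _   = refl
    χ-self : ∀ i → χ i (o i) ≡ g (o i)
    χ-self i with o i Fin.≟ o i
    ... | yes _ = refl
    ... | no ne = ⊥-elim (ne refl)
    column : ∀ z → g z ≋ ∑ (λ i → χ i z)
    column z with any? (λ i → o i Fin.≟ z)
    ... | yes (i , refl) = ≋-sym (≋-trans (∑-only i (λ j ne → ≋-reflexive (χ-other j (o i) (λ eq → ne (inj j i eq))))) (≋-reflexive (χ-self i)))
    ... | no none = ≋-trans (supp z (λ i eq → none (i , eq))) (≋-sym (∑-zero (λ i → ≋-reflexive (χ-other i z (λ eq → none (i , eq))))))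

-- The substitution x_{o k} ↦ f k on the face ring of [0̂, y], a polynomial ring.
module Restriction (P : SimplicialPoset) {y : Elem P} {d : ℕ}
  {o : Fin d → Elem P} (enum : EnumAtoms P y o) {l : ℕ} (f : Fin d → Poly l) where
  open SimplicialPoset P renaming (refl to ≤-refl; antisym to ≤-antisym; trans to ≤-trans)
  open Faces P
  open Vertices y using (join; join≤; left≤join; right≤join; atom≤join; join-least)

  private
    o-atom : ∀ k → IsAtom P (o k)
    o-atom k = proj₁ (proj₁ enum k)
    o≤ : ∀ k → o k ⊑ y
    o≤ k = proj₂ (proj₁ enum k)

  mark : Fin N → Fin d → Poly l
  mark w k = if le (o k) w then f k else 1P

  mark-in : ∀ {w k} → o k ⊑ w → mark w k ≡ f k
  mark-in h rewrite T⇒true h = refl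

  mark-out : ∀ {w k} → ¬ (o k ⊑ w) → mark w k ≡ 1P
  mark-out h rewrite ¬T⇒false h = refl

  -- The face ring of a boolean interval identifies an element with the product of its atoms, so the
  -- images of the atoms force this value; elements not below `y` are zero there.
  value : Fin N → Poly l
  value w = if le w y then ∏ (mark w) else 0P

  value-in : ∀ {w} → w ⊑ y → value w ≡ ∏ (mark w)
  value-in h rewrite T⇒true h = refl

  value-out : ∀ {w} → ¬ (w ⊑ y) → value w ≡ 0P
  value-out h rewrite ¬T⇒false h = refl

  value-bot : value bot ≋ 1P
  value-bot = ≋-trans (≋-reflexive (value-in (bot-min y)))
    (∏-one (λ k → ≋-reflexive (mark-out (atom⋢bot (o-atom k)))))

  value-atom : ∀ k → value (o k) ≋ f k
  value-atom k = ≋-trans (≋-reflexive (value-in (o≤ k)))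
    (≋-trans (∏-only k (λ j ne → ≋-reflexive (mark-out (λ h → ne (proj₁ (proj₂ enum) j k (atom-below-atom (o-atom k) (o-atom j) h))))))
      (≋-reflexive (mark-in (≤-refl (o k)))))

  module _ {i j w : Fin N} (p : i ⊑ y) (q : j ⊑ y) (glb : IsGLB P w i j) where
    private
      v = join p q

    -- A vertex lies below `i` and `j` together as often as below their meet and join together. Each
    -- of the four cases uses one half of this for the meet and one for the join.
    mark-product : ∀ k → mark i k *P mark j k ≋ mark w k *P mark v k
    mark-product k with T? (le (o k) i) | T? (le (o k) j)
    ... | yes a | yes b = ≋-reflexive (cong₂ _*P_ (trans (mark-in a) (sym (mark-in (proj₂ (proj₂ glb) (o k) a b))))
                                                  (trans (mark-in b) (sym (mark-in (≤-trans _ _ _ a (left≤join p q))))))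
    ... | yes a | no b  = ≋-trans (≋-reflexive (cong₂ _*P_ (trans (mark-in a) (sym (mark-in (≤-trans _ _ _ a (left≤join p q)))))
                                     (trans (mark-out b) (sym (mark-out (λ h → b (≤-trans _ _ _ h (proj₁ (proj₂ glb)))))))))
                            (*P-comm (mark v k) (mark w k))
    ... | no a  | yes b = ≋-reflexive (cong₂ _*P_ (trans (mark-out a) (sym (mark-out (λ h → a (≤-trans _ _ _ h (proj₁ glb))))))
                                                  (trans (mark-in b) (sym (mark-in (≤-trans _ _ _ b (right≤join p q))))))
    ... | no a  | no b  = ≋-reflexive (cong₂ _*P_ (trans (mark-out a) (sym (mark-out (λ h → a (≤-trans _ _ _ h (proj₁ glb))))))
                                                  (trans (mark-out b) (sym (mark-out (λ h → case atom≤join p q (o-atom k) h of λ { (inj₁ x) → a x ; (inj₂ x) → b x })))))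

    value-product : value i *P value j ≋ value w *P value v
    value-product = begin
      value i *P value j           ≡⟨ cong₂ _*P_ (value-in p) (value-in q) ⟩
      ∏ (mark i) *P ∏ (mark j)     ≈⟨ ≋-sym (∏-distrib-* (mark i) (mark j)) ⟩
      ∏ (λ k → mark i k *P mark j k) ≈⟨ ∏-cong mark-product ⟩
      ∏ (λ k → mark w k *P mark v k) ≈⟨ ∏-distrib-* (mark w) (mark v) ⟩
      ∏ (mark w) *P ∏ (mark v)     ≡⟨ sym (cong₂ _*P_ (value-in (≤-trans _ _ _ (proj₁ glb) p)) (value-in (join≤ p q))) ⟩
      value w *P value v ∎
      where open ≋-Reasoning

    private
      S = below P y

    upper-bound : ∀ {z} → T (isUB P S i j z) → z ⊑ y × i ⊑ z × j ⊑ z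
    upper-bound h with Equivalence.to T-∧ h
    ... | zy , h' with Equivalence.to T-∧ h'
    ... | iz , jz = zy , iz , jz

    join-isUB : T (isUB P S i j v)
    join-isUB = Equivalence.from T-∧ (join≤ p q , Equivalence.from T-∧ (left≤join p q , right≤join p q))

    isMUB-join : isMUB P S i j v ≡ true
    isMUB-join = T⇒true (Equivalence.from T-∧ (join-isUB , ⇒allF _ minimal))
      where
      minimal : ∀ u → T (not (isUB P S i j u ∧ le u v) ∨ eqF P u v)
      minimal u with isUB P S i j u ∧ le u v in eq
      ... | false = _
      ... | true with Equivalence.to T-∧ (subst T (sym eq) _)
      ... | ub , u≤v with upper-bound ub | u Fin.≟ v
      ... | _            | yes _ = _
      ... | uy , iu , ju | no ne = ⊥-elim (ne (≤-antisym u v u≤v (join-least p q uy iu ju)))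

    isMUB-other : ∀ z → z ≢ v → isMUB P S i j z ≡ false
    isMUB-other z ne = ¬T⇒false λ h → contra (Equivalence.to T-∧ h)
      where
      contra : T (isUB P S i j z) × T (allF (λ u → not (isUB P S i j u ∧ le u z) ∨ eqF P u z)) → ⊥
      contra (ub , minimal) with upper-bound ub | allF⇒ _ minimal v
      ... | zy , iz , jz | h
        rewrite T⇒true join-isUB | T⇒true (join-least p q zy iz jz) with v Fin.≟ z
      ... | yes eq = ne (sym eq)
      ... | no _   = h

    value-mubs : evalP (sumP (map var (mubs P S i j))) value ≋ value v
    value-mubs = begin
      evalP (sumP (map var (mubs P S i j))) value ≈⟨ evalP-cong (∑-filter N (isMUB P S i j) var) (λ _ → ≋-refl) ⟩
      evalP (∑ (λ z → if isMUB P S i j z then var z else 0P)) value ≈⟨ evalP-∑ (λ z → if isMUB P S i j z then var z else 0P) value ⟩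
      ∑ (λ z → evalP (if isMUB P S i j z then var z else 0P) value)
        ≈⟨ ∑-only v (λ z ne → ≋-reflexive (cong (λ b → evalP (if b then var z else 0P) value) (isMUB-other z ne))) ⟩
      evalP (if isMUB P S i j v then var v else 0P) value ≡⟨ cong (λ b → evalP (if b then var v else 0P) value) isMUB-join ⟩
      evalP (var v) value ≈⟨ evalP-var v value ⟩
      value v ∎
      where open ≋-Reasoning

  evalP-minus : ∀ (p q : Poly N) → evalP (p -P q) value ≋ evalP p value -P evalP q value
  evalP-minus p q = ≋-trans (evalP-+ p (scaleP (- 1ℚ) q) value) (+P-congˡ (evalP p value) (evalP-scale (- 1ℚ) q value))

  generator-vanishes : ∀ {g} → FaceGen P (below P y) g → evalP g value ≋ 0P
  generator-vanishes (inj₁ refl) = ≋-trans (evalP-minus (var bot) 1P)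
    (zero-difference (≋-trans (evalP-var bot value) (≋-trans value-bot (≋-sym (evalP-const 1ℚ value)))))
  generator-vanishes (inj₂ (inj₁ (z , out , refl))) =
    ≋-trans (evalP-var z value) (≋-reflexive (value-out (λ h → subst T out h)))
  -- Elements below `y` have the upper bound `y`, so a generator of this kind cannot occur.
  generator-vanishes (inj₂ (inj₂ (i , j , i≤ , j≤ , inj₁ (none , refl)))) =
    ⊥-elim (subst T none (⇒anyF (isUB P (below P y) i j) y (Equivalence.from T-∧ (≤-refl y ,
      Equivalence.from T-∧ (Equivalence.from T-≡ i≤ , Equivalence.from T-≡ j≤)))))
  generator-vanishes (inj₂ (inj₂ (i , j , i≤ , j≤ , inj₂ (w , glb , refl)))) =
    ≋-trans (evalP-minus (var i *P var j) (var w *P sumP (map var (mubs P (below P y) i j))))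
      (zero-difference (≋-trans (evalP-* (var i) (var j) value)
        (≋-trans (*P-cong (evalP-var i value) (evalP-var j value))
          (≋-trans (value-product p q glb)
            (≋-sym (≋-trans (evalP-* (var w) (sumP (map var (mubs P (below P y) i j))) value)
              (*P-cong (evalP-var w value) (value-mubs p q glb))))))))
    where
    p = Equivalence.from T-≡ i≤
    q = Equivalence.from T-≡ j≤

  -- The congruence is a bare ideal membership. Evaluation at `value` kills the generators and turns
  -- it into an equality of polynomials.
  congruent⇒equal : ∀ g h → _≡[_]_ P g (below P y) h → evalP g value ≋ evalP h value
  congruent⇒equal g h (r , a , b , gens , eq) = difference-zero (begin
    evalP g value -P evalP h value ≈⟨ ≋-sym (evalP-minus g h) ⟩
    evalP (g -P h) value ≈⟨ evalP-cong {p = g -P h} (≋-trans (mk≋ eq) (≋-reflexive (∑-allFin r (λ i → a i *P b i)))) (λ _ → ≋-refl) ⟩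
    evalP (∑ (λ i → a i *P b i)) value ≈⟨ evalP-∑ (λ i → a i *P b i) value ⟩
    ∑ (λ i → evalP (a i *P b i) value) ≈⟨ ∑-zero (λ i → ≋-trans (evalP-* (a i) (b i) value)
        (≋-trans (*P-congˡ (evalP (a i) value) (generator-vanishes (gens i))) (zeroʳ (evalP (a i) value)))) ⟩
    0P ∎)
    where open ≋-Reasoning

  evalP-linear : ∀ (c : Fin N → ℚ) → (∀ z → ¬ IsAtom P z → c z ≡ 0ℚ) →
    evalP (linP P c) value ≋ ∑ (λ k → scaleP (c (o k)) (f k))
  evalP-linear c c-atoms = begin
    evalP (linP P c) value ≈⟨ evalP-linV c value ⟩
    ∑ (λ z → scaleP (c z) (value z)) ≈⟨ ∑-reindex o (proj₁ (proj₂ enum)) (λ z → scaleP (c z) (value z)) supp ⟩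
    ∑ (λ k → scaleP (c (o k)) (value (o k))) ≈⟨ ∑-cong (λ k → scaleP-cong (c (o k)) (value-atom k)) ⟩
    ∑ (λ k → scaleP (c (o k)) (f k)) ∎
    where
    open ≋-Reasoning
    supp : ∀ z → (∀ k → o k ≢ z) → scaleP (c z) (value z) ≋ 0P
    supp z ne with rk z ℕ.≟ 1 | T? (le z y)
    ... | no ¬atom | _     = ≋-trans (≋-reflexive (cong (λ x → scaleP x (value z)) (c-atoms z ¬atom)))
                               (≋-trans (scaleP-≋ 0ℚ (value z)) (≋-trans (*P-congʳ (value z) constP-0) (zeroˡ (value z))))
    ... | yes atom | yes h = let (k , eq) = proj₂ (proj₂ enum) z atom h in ⊥-elim (ne k eq)
    ... | yes _    | no h  = ≋-reflexive (cong (scaleP (c z)) (value-out h))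

-- Non zero divisors and the cancellation of denominators

module _ {k : ℕ} where
  ∏-zero : ∀ {n} {f : Fin n → Poly k} i → f i ≋ 0P → ∏ f ≋ 0P
  ∏-zero {suc n} {f} zero    h = ≋-trans (*P-congʳ (∏ (f ∘ suc)) h) (zeroˡ (∏ (f ∘ suc)))
  ∏-zero {suc n} {f} (suc i) h = ≋-trans (*P-congˡ (f zero) (∏-zero {f = f ∘ suc} i h)) (zeroʳ (f zero))

  *P-leftComm : ∀ (p q r : Poly k) → p *P (q *P r) ≋ q *P (p *P r)
  *P-leftComm p q r = ≋-trans (≋-sym (*P-assoc p q r))
    (≋-trans (*P-congʳ r (*P-comm p q)) (*P-assoc q p r))

  prodP-↭ : ∀ {A : Set} (ψ : A → Poly k) {xs ys} → xs ↭ ys → prodP (map ψ xs) ≋ prodP (map ψ ys)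
  prodP-↭ ψ ↭-refl = ≋-refl
  prodP-↭ ψ (prep x p) = *P-congˡ (ψ x) (prodP-↭ ψ p)
  prodP-↭ ψ (swap {xs} {ys} x y p) = begin
    ψ x *P (ψ y *P prodP (map ψ xs)) ≈⟨ *P-congˡ (ψ x) (*P-congˡ (ψ y) (prodP-↭ ψ p)) ⟩
    ψ x *P (ψ y *P prodP (map ψ ys)) ≈⟨ *P-leftComm (ψ x) (ψ y) _ ⟩
    ψ y *P (ψ x *P prodP (map ψ ys)) ∎
    where
    open ≋-Reasoning
  prodP-↭ ψ (↭-trans p q) = ≋-trans (prodP-↭ ψ p) (prodP-↭ ψ q)

  prodP-tabulate : ∀ {A : Set} (ψ : A → Poly k) {n} (c : Fin n → A) → prodP (map ψ (tabulate c)) ≡ ∏ (λ i → ψ (c i))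
  prodP-tabulate ψ c = trans (cong prodP (Listₚ.map-tabulate c ψ)) (∏-tabulate (λ i → ψ (c i)))

  nzd-resp : ∀ {p q : Poly k} → p ≋ q → NonZeroDivisor p → NonZeroDivisor q
  nzd-resp pq h x eq = h x (≋-trans (*P-congʳ x pq) eq)

  nzd-* : ∀ {p q : Poly k} → NonZeroDivisor p → NonZeroDivisor q → NonZeroDivisor (p *P q)
  nzd-* {p} {q} hp hq x eq = hq x (hp (q *P x) (≋-trans (≋-sym (*P-assoc p q x)) eq))

  nzd-1 : NonZeroDivisor (1P {k})
  nzd-1 x eq = ≋-trans (≋-sym (*P-identityˡ x)) eq

  nzd-∏ : ∀ {n} {f : Fin n → Poly k} → (∀ i → NonZeroDivisor (f i)) → NonZeroDivisor (∏ f)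
  nzd-∏ {zero}  h = nzd-1
  nzd-∏ {suc n} {f} h = nzd-* {f zero} {∏ (f ∘ suc)} (h zero) (nzd-∏ (h ∘ suc))

  nzd-const : ∀ {c} → c ≢ 0ℚ → NonZeroDivisor (constP {k} c)
  nzd-const {c} ne x eq with ℚ-inverse c ne
  ... | r , rc = begin
    x                            ≈⟨ ≋-sym (*P-identityˡ x) ⟩
    constP 1ℚ *P x               ≡⟨ cong (λ t → constP t *P x) (sym rc) ⟩
    constP (r * c) *P x          ≈⟨ *P-congʳ x (constP-* r c) ⟩
    constP r *P constP c *P x    ≈⟨ *P-assoc (constP r) (constP c) x ⟩
    constP r *P (constP c *P x)  ≈⟨ *P-congˡ (constP r) eq ⟩
    constP r *P 0P               ≈⟨ zeroʳ (constP r) ⟩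
    0P ∎
    where open ≋-Reasoning

  nzd-cancel : ∀ {p} → NonZeroDivisor p → ∀ {x y : Poly k} → p *P x ≋ p *P y → x ≋ y
  nzd-cancel {p} h {x} {y} eq = difference-zero (h (x -P y) (begin
    p *P (x -P y)                        ≈⟨ *P-distribˡ p x (scaleP (- 1ℚ) y) ⟩
    p *P x +P p *P scaleP (- 1ℚ) y       ≈⟨ +P-cong eq (≋-trans (*P-congˡ p (scaleP-≋ (- 1ℚ) y)) (*P-leftComm p (constP (- 1ℚ)) y)) ⟩
    p *P y +P constP (- 1ℚ) *P (p *P y)  ≈⟨ +P-congˡ (p *P y) (≋-sym (scaleP-≋ (- 1ℚ) (p *P y))) ⟩
    p *P y -P p *P y                     ≈⟨ +P-inverseʳ (p *P y) ⟩
    0P ∎))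
    where
    open ≋-Reasoning

  Divides : Poly k → Poly k → Set
  Divides ℓ p = ∃ λ q → p ≋ ℓ *P q

  -- The fraction a / D has a denominator that is invertible along ℓ.
  Regular : Poly k → Poly k → Poly k → Set
  Regular ℓ a D = Σ (Poly k) λ V → Σ (Poly k) λ U →
    (a *P V ≋ U *P D) × (∀ q → Divides ℓ (q *P V) → Divides ℓ q)

  -- Regularity along the head gives `ℓ` dividing `a *P V`, hence `a`. Cancelling `ℓ` leaves the
  -- fraction unchanged, so regularity along the remaining forms persists; repeated or proportional
  -- forms need no separate treatment.
  product-divides : ∀ xs a → All.All NonZeroDivisor xs → All.All (λ ℓ → Regular ℓ a (prodP xs)) xs →
    Divides (prodP xs) a
  product-divides [] a [] [] = a , ≋-sym (*P-identityˡ a)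
  product-divides (ℓ ∷ xs) a (nz ∷ nzs) ((V , U , aV , cop) ∷ regs) =
    conclude (cop a (U *P prodP xs , ≋-trans aV (*P-leftComm U ℓ (prodP xs))))
    where
    descend : ∀ {a'} → a ≋ ℓ *P a' → ∀ {ℓ'} → Regular ℓ' a (ℓ *P prodP xs) → Regular ℓ' a' (prodP xs)
    descend {a'} eq (V' , U' , aV' , cop') = V' , U' , nzd-cancel {ℓ} nz
      (≋-trans (≋-sym (*P-assoc ℓ a' V')) (≋-trans (*P-congʳ V' (≋-sym eq))
        (≋-trans aV' (*P-leftComm U' ℓ (prodP xs))))) , cop'
    finish : ∀ {a'} → a ≋ ℓ *P a' → Divides (prodP xs) a' → Divides (ℓ *P prodP xs) a
    finish eq (q , eq') = q , ≋-trans eq (≋-trans (*P-congˡ ℓ eq') (≋-sym (*P-assoc ℓ (prodP xs) q)))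
    conclude : Divides ℓ a → Divides (ℓ *P prodP xs) a
    conclude (a' , eq) = finish eq (product-divides xs a' nzs (All.map (λ {ℓ'} → descend {a'} eq {ℓ'}) regs))

-- Reduction modulo the linear form ℓ = Σ uᵢ tᵢ, realised by solving ℓ = 0 for t_{i₀}.
module Modulo {d : ℕ} (u : Fin d → ℚ) (i₀ : Fin d) (r : ℚ) (ru : r * u i₀ ≡ 1ℚ) where
  open ≡-Reasoning

  ℓ : Poly d
  ℓ = linV u

  private
    w : Poly d
    w = scaleP (- r) ℓ
  open Shear i₀ w

  σ : Poly d → Poly d
  σ = shear

  σ-cong : ∀ {p q} → p ≋ q → σ p ≋ σ q
  σ-cong pq = evalP-cong pq (λ _ → ≋-refl)

  σ-* : ∀ p q → σ (p *P q) ≋ σ p *P σ q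
  σ-* p q = evalP-* p q _

  σ-const : ∀ c → σ (constP c) ≋ constP c
  σ-const c = evalP-const c (λ j → var j +P step j)

  σ-∑ : ∀ {n} (f : Fin n → Poly d) → σ (∑ f) ≋ ∑ (λ i → σ (f i))
  σ-∑ f = evalP-∑ f (λ j → var j +P step j)

  σ-∏ : ∀ {n} (f : Fin n → Poly d) → σ (∏ f) ≋ ∏ (λ i → σ (f i))
  σ-∏ f = evalP-∏ f (λ j → var j +P step j)

  -- The coordinate vector of `σ (linV v)`. It vanishes exactly when `v` is a multiple of `u`, so
  -- proportionality to `ℓ` can be decided coordinate by coordinate.
  reduce : (Fin d → ℚ) → Fin d → ℚ
  reduce v i = v i + - (v i₀ * r) * u i

  σ-linV : ∀ v → σ (linV v) ≋ linV (reduce v)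
  σ-linV v = ≋-trans (shear-linV v) (≋-trans (+P-congˡ (linV v) (lin-ext λ φ _ → begin
      lin φ (scaleP (v i₀) w)           ≡⟨ trans (lin-scale φ (v i₀) w) (cong ((v i₀) *_) (lin-scale φ (- r) ℓ)) ⟩
      v i₀ * (- r * lin φ ℓ)            ≡⟨ solve 3 (λ a b c → a :* ((:- b) :* c) := (:- (a :* b)) :* c) refl (v i₀) r (lin φ ℓ) ⟩
      - (v i₀ * r) * lin φ ℓ            ≡⟨ sym (lin-scale φ (- (v i₀ * r)) ℓ) ⟩
      lin φ (scaleP (- (v i₀ * r)) ℓ) ∎))
    (linV-combine v (- (v i₀ * r)) u))

  linV-zero : ∀ {v : Fin d → ℚ} → (∀ i → v i ≡ 0ℚ) → linV v ≋ 0P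
  linV-zero {v} h = lin-ext λ φ rφ → trans (lin-linV φ v)
    (∑ℚ-zero (λ j → trans (cong (_* lin φ (var j)) (h j)) (ℚₚ.*-zeroˡ (lin φ (var j)))))

  reduce-self : ∀ i → reduce u i ≡ 0ℚ
  reduce-self i = begin
    u i + - (u i₀ * r) * u i ≡⟨ cong (λ t → u i + - t * u i) (trans (ℚₚ.*-comm (u i₀) r) ru) ⟩
    u i + - 1ℚ * u i ≡⟨ solve 1 (λ x → x :+ con (- 1ℚ) :* x := con 0ℚ) refl (u i) ⟩
    0ℚ ∎

  σℓ≋0 : σ ℓ ≋ 0P
  σℓ≋0 = ≋-trans (σ-linV u) (linV-zero {reduce u} reduce-self)

  reduce-zero : ∀ {v} → (∀ i → reduce v i ≡ 0ℚ) → ∀ i → v i ≡ (v i₀ * r) * u i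
  reduce-zero {v} h i = trans (solve 2 (λ x y → x := (x :+ (:- y)) :+ y) refl (v i) (v i₀ * r * u i))
    (trans (cong (_+ v i₀ * r * u i) (trans (cong ((v i) +_) (ℚₚ.neg-distribˡ-* (v i₀ * r) (u i))) (h i))) (ℚₚ.+-identityˡ _))

  private
    w*≋ : ∀ q → w *P q ≋ scaleP (- r) (ℓ *P q)
    w*≋ q = ≋-trans (*P-congʳ q (scaleP-≋ (- r) ℓ)) (≋-trans (*P-assoc (constP (- r)) ℓ q) (≋-sym (scaleP-≋ (- r) (ℓ *P q))))

    cancel-w : ∀ {p q} → p +P w *P q ≋ 0P → p ≋ ℓ *P (constP r *P q)
    cancel-w {p} {q} h = ≋-trans (lin-ext λ φ rφ → begin
      lin φ p ≡⟨ solve 2 (λ p s → p := (p :+ s) :+ con (- 1ℚ) :* s) refl (lin φ p) (lin φ (w *P q)) ⟩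
      (lin φ p + lin φ (w *P q)) + (- 1ℚ) * lin φ (w *P q)
        ≡⟨ cong (_+ (- 1ℚ) * lin φ (w *P q)) (trans (sym (lin-++ φ p (w *P q))) (lin-≋ rφ h)) ⟩
      0ℚ + (- 1ℚ) * lin φ (w *P q) ≡⟨ cong (λ t → 0ℚ + (- 1ℚ) * t) (trans (lin-≋ rφ (w*≋ q)) (lin-scale φ (- r) (ℓ *P q))) ⟩
      0ℚ + (- 1ℚ) * (- r * lin φ (ℓ *P q)) ≡⟨ solve 2 (λ r x → con 0ℚ :+ con (- 1ℚ) :* ((:- r) :* x) := r :* x) refl r (lin φ (ℓ *P q)) ⟩
      r * lin φ (ℓ *P q) ≡⟨ sym (lin-scale φ r (ℓ *P q)) ⟩
      lin φ (scaleP r (ℓ *P q)) ∎)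
      (≋-trans (scaleP-≋ r (ℓ *P q)) (*P-leftComm (constP r) ℓ q))

  -- By `shear-mod`, `σ p` and `p` differ by a multiple of `w`, and `w` is `- r` times `ℓ`.
  σ-zero⇒divides : ∀ {p} → σ p ≋ 0P → Divides ℓ p
  σ-zero⇒divides {p} h = constP r *P proj₁ (shear-mod p) , cancel-w (≋-trans (≋-sym (proj₂ (shear-mod p))) h)

  u≢0 : u i₀ ≢ 0ℚ
  u≢0 eq with () ← trans (sym ru) (trans (cong (r *_) eq) (ℚₚ.*-zeroʳ r))

  ℓ-nzd : NonZeroDivisor ℓ
  ℓ-nzd = linV-nzd u i₀ u≢0

-- ι_y in coordinates, for y with atoms enumerated by o and L x standing for ι_y(x).
module CellRestriction (P : SimplicialPoset) {d : ℕ} (Θ : Fin d → Elem P → ℚ) (Θ₁ : DegreeOne P Θ)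
  {y : Elem P} {o : Fin d → Elem P} (enum : EnumAtoms P y o)
  (L : Elem P → Poly d)
  (hL : ∀ x → IsAtom P x → _≤P_ P x y → _≡[_]_ P (var x) (below P y) (evalP (L x) (θP P Θ))) where
  open SimplicialPoset P using (N)

  column : Fin N → Fin d → ℚ
  column x j = coeff (L x) (unitMon j)

  private
    atom : ∀ k → IsAtom P (o k)
    atom k = proj₁ (proj₁ enum k)
    bound : ∀ k → _≤P_ P (o k) y
    bound k = proj₂ (proj₁ enum k)

    coeff-var : ∀ (k k' : Fin d) → coeff (var k) (unitMon k') ≡ kronecker k' k
    coeff-var k k' = trans (sym (at (*-identityʳ (var k)) (unitMon k'))) (go (k Fin.≟ k'))
      where
      go : Dec (k ≡ k') → coeff (var k *P 1P {d}) (unitMon k') ≡ kronecker k' k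
      go (yes refl) = trans (coeff-var*-unit k (1P {d})) (trans (coeff-const-𝟎 {d} 1ℚ) (sym (kronecker-self k)))
      go (no ne)    = trans (coeff-var*-other ne 1P) (sym (kronecker-other (λ eq → ne (sym eq))))

  -- Sending the atoms of `y` to variables turns the congruence for `o k'` into an identity in which
  -- each `θ_j` is a linear form. Comparing linear parts gives the duality, before `L (o k')` is
  -- known to be linear.
  pairing : ∀ k k' → ∑ℚ (λ j → Θ j (o k) * column (o k') j) ≡ kronecker k k'
  pairing k k' = begin
    ∑ℚ (λ j → Θ j (o k) * column (o k') j) ≡⟨ ∑ℚ-cong (λ j → ℚₚ.*-comm (Θ j (o k)) (column (o k') j)) ⟩
    ∑ℚ (λ j → column (o k') j * Θ j (o k)) ≡⟨ sym (LinearPart.linear-part (λ j k → Θ j (o k)) (L (o k')) k) ⟩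
    coeff (evalP (L (o k')) (λ j → linV (λ k → Θ j (o k)))) (unitMon k) ≡⟨ sym (at substituted (unitMon k)) ⟩
    coeff (var k') (unitMon k) ≡⟨ coeff-var k' k ⟩
    kronecker k k' ∎
    where
    open ≡-Reasoning
    open Restriction P enum var
    substituted : var k' ≋ evalP (L (o k')) (λ j → linV (λ k → Θ j (o k)))
    substituted = ≋-trans (≋-sym (≋-trans (evalP-var (o k') value) (value-atom k')))
      (≋-trans (congruent⇒equal (var (o k')) (evalP (L (o k')) (θP P Θ)) (hL (o k') (atom k') (bound k')))
        (≋-trans (evalP-∘ (θP P Θ) value (L (o k')))
          (evalP-cong (≋-refl {p = L (o k')}) (λ j → ≋-trans (evalP-linear (Θ j) (Θ₁ j)) (≋-reflexive (sym (linV-∑ (λ k → Θ j (o k)))))))))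

  copairing : ∀ i l → ∑ℚ (λ k → column (o k) i * Θ l (o k)) ≡ kronecker i l
  copairing = left-inverse⇒right-inverse (λ k j → Θ j (o k)) (λ j k → column (o k) j) pairing

  private
    linear : Fin d → Poly d
    linear k = linV (column (o k))
    open Restriction P enum linear renaming (value to value₁; value-atom to value₁-atom; congruent⇒equal to congruent₁; evalP-linear to evalP-linear₁)

    θ-value : ∀ l → evalP (θP P Θ l) value₁ ≋ var l
    θ-value l = ≋-trans (evalP-linear₁ (Θ l) (Θ₁ l)) (lin-ext λ φ rφ → begin
      lin φ (∑ (λ k → scaleP (Θ l (o k)) (linear k))) ≡⟨ lin-∑ φ (λ k → scaleP (Θ l (o k)) (linear k)) ⟩
      ∑ℚ (λ k → lin φ (scaleP (Θ l (o k)) (linear k)))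
        ≡⟨ ∑ℚ-cong (λ k → trans (lin-scale φ (Θ l (o k)) (linear k)) (trans (cong ((Θ l (o k)) *_) (lin-linV φ (column (o k))))
             (*-distribˡ-∑ℚ (Θ l (o k)) (λ j → column (o k) j * lin φ (var j))))) ⟩
      ∑ℚ (λ k → ∑ℚ (λ j → Θ l (o k) * (column (o k) j * lin φ (var j)))) ≡⟨ ∑ℚ-comm (λ k j → Θ l (o k) * (column (o k) j * lin φ (var j))) ⟩
      ∑ℚ (λ j → ∑ℚ (λ k → Θ l (o k) * (column (o k) j * lin φ (var j))))
        ≡⟨ ∑ℚ-cong (λ j → trans (∑ℚ-cong (λ k → solve 3 (λ a b c → a :* (b :* c) := (b :* a) :* c) refl (Θ l (o k)) (column (o k) j) (lin φ (var j))))
             (trans (sym (*-distribʳ-∑ℚ (lin φ (var j)) (λ k → column (o k) j * Θ l (o k)))) (cong (_* lin φ (var j)) (copairing j l)))) ⟩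
      ∑ℚ (λ j → kronecker j l * lin φ (var j))
        ≡⟨ ∑ℚ-only l (λ j ne → trans (cong (_* lin φ (var j)) (kronecker-other ne)) (ℚₚ.*-zeroˡ (lin φ (var j)))) ⟩
      kronecker l l * lin φ (var l) ≡⟨ trans (cong (_* lin φ (var l)) (kronecker-self l)) (ℚₚ.*-identityˡ (lin φ (var l))) ⟩
      lin φ (var l) ∎)
      where open ≡-Reasoning

  -- Under the substitution `o k ↦ linV (column (o k))` each `θ_l` becomes `var l`, by `copairing`.
  -- Evaluating the congruence between `α` and `ι(θ)` therefore returns `ι`.
  restriction : ∀ α ι → _≡[_]_ P α (below P y) (evalP ι (θP P Θ)) →
    ι ≋ evalP α (Restriction.value P enum (λ k → linV (column (o k))))
  restriction α ι h = ≋-sym (≋-trans (congruent₁ α (evalP ι (θP P Θ)) h) (≋-trans (evalP-∘ (θP P Θ) value₁ ι)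
    (≋-trans (evalP-cong (≋-refl {p = ι}) θ-value) (evalP-id ι))))

  -- `L (o k)` is given as an arbitrary polynomial satisfying a congruence; `restriction`, applied
  -- to the atom itself, shows that it equals its linear part.
  L-linear : ∀ k → L (o k) ≋ linV (column (o k))
  L-linear k = ≋-trans (restriction (var (o k)) (L (o k)) (hL (o k) (atom k) (bound k))) (≋-trans (evalP-var (o k) value₁) (value₁-atom k))

  -- Expansion in the basis of columns: the coefficient at `o k` is obtained by pairing with the
  -- values of the `θ_l` at `o k`.
  expand : ∀ (v : Fin d → ℚ) i → v i ≡ ∑ℚ (λ k → ∑ℚ (λ l → v l * Θ l (o k)) * column (o k) i)
  expand v i = sym (begin
    ∑ℚ (λ k → ∑ℚ (λ l → v l * Θ l (o k)) * column (o k) i)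
      ≡⟨ ∑ℚ-cong (λ k → *-distribʳ-∑ℚ (column (o k) i) (λ l → v l * Θ l (o k))) ⟩
    ∑ℚ (λ k → ∑ℚ (λ l → v l * Θ l (o k) * column (o k) i)) ≡⟨ ∑ℚ-comm (λ k l → v l * Θ l (o k) * column (o k) i) ⟩
    ∑ℚ (λ l → ∑ℚ (λ k → v l * Θ l (o k) * column (o k) i))
      ≡⟨ ∑ℚ-cong (λ l → trans (∑ℚ-cong (λ k → solve 3 (λ v t c → v :* t :* c := v :* (c :* t)) refl (v l) (Θ l (o k)) (column (o k) i)))
           (trans (sym (*-distribˡ-∑ℚ (v l) (λ k → column (o k) i * Θ l (o k)))) (cong ((v l) *_) (copairing i l)))) ⟩
    ∑ℚ (λ l → v l * kronecker i l)
      ≡⟨ ∑ℚ-only i (λ l ne → trans (cong ((v l) *_) (kronecker-other (λ eq → ne (sym eq)))) (ℚₚ.*-zeroʳ (v l))) ⟩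
    v i * kronecker i i ≡⟨ trans (cong ((v i) *_) (kronecker-self i)) (ℚₚ.*-identityʳ (v i)) ⟩
    v i ∎)
    where open ≡-Reasoning

-- Residues along a linear form

record IsFacet (P : SimplicialPoset) {d : ℕ} (y : Elem P) (o : Fin (suc d) → Elem P)
  (k : Fin (suc d)) (z : Elem P) : Set where
  field
    bound      : _≤P_ P z y
    missing    : ¬ _≤P_ P (o k) z
    enumerates : EnumAtoms P z (o ∘ punchIn k)

-- The coefficient, in the boundary of the simplex with vertex order `o`, of the facet opposite
-- `o k` oriented by increasing atom index.
orientation : ∀ {d N} → (Fin (suc d) → Fin N) → Fin (suc d) → ℚ
orientation o k = negOnePowℚ (toℕ k) * inversionSign (tabulate (o ∘ punchIn k))

module AlongForm {d : ℕ} (u : Fin (suc d) → ℚ) (i₀ : Fin (suc d)) (r : ℚ) (ru : r * u i₀ ≡ 1ℚ) where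
  open Modulo u i₀ r ru
  open ≡-Reasoning

  -- The multiple of `u` that `reduce` subtracts; when `reduce v` vanishes, `v` is `scalar v` times
  -- `u`.
  scalar : (Fin (suc d) → ℚ) → ℚ
  scalar v = v i₀ * r

  module _ {N : ℕ} (column : Fin N → Fin (suc d) → ℚ) where
    -- The leading column `u` makes this depend on the facet's columns only modulo `u`, where
    -- adjacent cells agree.
    minor : List (Fin N) → ℚ
    minor xs = D (suc d) (u ∷ map column xs)

    minor-alternating : Alternating minor
    minor-alternating = mkAlternating λ ps x y qs → begin
      D (suc d) (u ∷ map column (ps ++ x ∷ y ∷ qs)) ≡⟨ cong (λ l → D (suc d) (u ∷ l)) (Listₚ.map-++ column ps (x ∷ y ∷ qs)) ⟩
      D (suc d) (u ∷ map column ps ++ column x ∷ column y ∷ map column qs)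
        ≡⟨ Alternating.exchange (D-alternating (suc d)) (u ∷ map column ps) (column x) (column y) (map column qs) ⟩
      - D (suc d) (u ∷ map column ps ++ column y ∷ column x ∷ map column qs)
        ≡⟨ cong (λ l → - D (suc d) (u ∷ l)) (sym (Listₚ.map-++ column ps (y ∷ x ∷ qs))) ⟩
      - D (suc d) (u ∷ map column (ps ++ y ∷ x ∷ qs)) ∎

  module _ {N : ℕ} (column : Fin N → Fin (suc d) → ℚ) (o : Fin (suc d) → Fin N) (k : Fin (suc d)) where
    det-minor : (∀ i → reduce (column (o k)) i ≡ 0ℚ) →
      det (λ j k → column (o k) j) ≡ negOnePowℚ (toℕ k) * (scalar (column (o k)) * minor column (tabulate (o ∘ punchIn k)))
    det-minor vanish = begin
      det (λ j k → column (o k) j) ≡⟨ det-D (suc d) (λ j k → column (o k) j) ⟩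
      D (suc d) (tabulate (λ k → column (o k))) ≡⟨ pull-front (D-alternating (suc d)) (λ k → column (o k)) k ⟩
      negOnePowℚ (toℕ k) * D (suc d) (column (o k) ∷ tabulate (λ j → column (o (punchIn k j))))
        ≡⟨ cong ((negOnePowℚ (toℕ k)) *_) (D-scale (suc d) {column (o k)} {u} (scalar (column (o k))) (reduce-zero {column (o k)} vanish) (tabulate (λ j → column (o (punchIn k j))))) ⟩
      negOnePowℚ (toℕ k) * (scalar (column (o k)) * D (suc d) (u ∷ tabulate (λ j → column (o (punchIn k j)))))
        ≡⟨ cong (λ l → negOnePowℚ (toℕ k) * (scalar (column (o k)) * D (suc d) (u ∷ l))) (sym (Listₚ.map-tabulate (o ∘ punchIn k) column)) ⟩
      negOnePowℚ (toℕ k) * (scalar (column (o k)) * minor column (tabulate (o ∘ punchIn k))) ∎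

    -- The sign `(-1)^k` occurs once in `orientation` and once in moving column `k` to the front,
    -- and cancels. Apart from `scalar`, what remains is alternating in the facet's vertices and
    -- corrected by their sorting sign.
    oriented-det : (∀ i → reduce (column (o k)) i ≡ 0ℚ) →
      orientation o k * det (λ j k → column (o k) j) ≡
      scalar (column (o k)) * (inversionSign (tabulate (o ∘ punchIn k)) * minor column (tabulate (o ∘ punchIn k)))
    oriented-det vanish = begin
      s * e * det (λ j k → column (o k) j) ≡⟨ cong ((s * e) *_) (det-minor vanish) ⟩
      s * e * (s * (c * f)) ≡⟨ solve 4 (λ s e c f → s :* e :* (s :* (c :* f)) := (s :* s) :* (c :* (e :* f))) refl s e c f ⟩
      (s * s) * (c * (e * f)) ≡⟨ cong (_* (c * (e * f))) (negOnePowℚ-square (toℕ k)) ⟩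
      1ℚ * (c * (e * f)) ≡⟨ ℚₚ.*-identityˡ _ ⟩
      c * (e * f) ∎
      where
      s = negOnePowℚ (toℕ k)
      e = inversionSign (tabulate (o ∘ punchIn k))
      c = scalar (column (o k))
      f = minor column (tabulate (o ∘ punchIn k))

  module FacetValues (P : SimplicialPoset) {y : Elem P} {o : Fin (suc d) → Elem P}
    (enum : EnumAtoms P y o) (column : Elem P → Fin (suc d) → ℚ)
    {k : Fin (suc d)} {z : Elem P} (facet : IsFacet P y o k z)
    (vanish : ∀ i → reduce (column (o k)) i ≡ 0ℚ) where
    open SimplicialPoset P using (N; le) renaming (trans to ≤-trans)
    open Faces P using (_⊑_; module Vertices)
    open IsFacet
    open Restriction P enum (λ κ → linV (column (o κ)))

    o-facet : ∀ κ → κ ≢ k → IsAtom P (o κ) × o κ ⊑ z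
    o-facet κ ne = subst (λ t → IsAtom P (o t) × o t ⊑ z) (Finₚ.punchIn-punchOut (λ eq → ne (sym eq)))
      (proj₁ (enumerates facet) (punchOut (λ eq → ne (sym eq))))

    -- Indexed by an atom of the poset and not by its position in `o`, so that two cells with
    -- different vertex orders can be compared.
    reducedMark : Fin N → Fin N → Poly (suc d)
    reducedMark w x = if le x w then linV (reduce (column x)) else 1P

    private
      σ-mark : ∀ w κ → σ (mark w κ) ≋ reducedMark w (o κ)
      σ-mark w κ with le (o κ) w
      ... | true  = σ-linV (column (o κ))
      ... | false = σ-const 1ℚ

      σ-value : ∀ {w} → w ⊑ y → σ (value w) ≋ ∏ (λ κ → reducedMark w (o κ))
      σ-value {w} p = ≋-trans (σ-cong (≋-reflexive (value-in p)))
        (≋-trans (σ-∏ (mark w)) (∏-cong (σ-mark w)))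

    σ-value-in : ∀ {w} → w ⊑ z → σ (value w) ≋ ∏ (λ j → reducedMark w (o (punchIn k j)))
    σ-value-in {w} p = ≋-trans (σ-value (≤-trans _ _ _ p (bound facet)))
      (≋-trans (∏-remove {i = k} (λ κ → reducedMark w (o κ)))
        (≋-trans (*P-congʳ (∏ (λ j → reducedMark w (o (punchIn k j)))) (≋-reflexive (cong (λ b → if b then linV (reduce (column (o k))) else 1P)
            (¬T⇒false (λ h → missing facet (≤-trans _ _ _ h p))))))
          (*P-identityˡ _)))

    -- If `w` lies below `y` but not below the facet, it contains the opposite vertex, whose form is
    -- a multiple of `ℓ` and is killed by `σ`.
    σ-value-out : ∀ {w} → ¬ (w ⊑ z) → σ (value w) ≋ 0P
    σ-value-out {w} w⋢z with T? (le w y) | T? (le (o k) w)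
    ... | no ¬p | _     = σ-cong (≋-reflexive (value-out ¬p))
    ... | yes p | yes q = ≋-trans (σ-value p) (∏-zero {f = λ κ → reducedMark w (o κ)} k
        (≋-trans (≋-reflexive (cong (λ b → if b then linV (reduce (column (o k))) else 1P) (T⇒true q))) (linV-zero {reduce (column (o k))} vanish)))
    ... | yes p | no ¬q = ⊥-elim (w⋢z (Vertices.atoms-reflect y p (bound facet) below-z))
      where
      below-z : ∀ x → IsAtom P x → x ⊑ w → x ⊑ z
      below-z x atom x≤w with proj₂ (proj₂ enum) x atom (≤-trans _ _ _ x≤w p)
      ... | κ , refl = proj₂ (o-facet κ (λ { refl → ¬q x≤w }))

  -- Two cells y, y' sharing the facet z, where ℓ is proportional to the form of y at the vertex opposite z.
  module Adjacent (P : SimplicialPoset) (Θ : Fin (suc d) → Elem P → ℚ) (Θ₁ : DegreeOne P Θ)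
    {y y' : Elem P} {o o' : Fin (suc d) → Elem P}
    (enum : EnumAtoms P y o) (enum' : EnumAtoms P y' o')
    (L L' : Elem P → Poly (suc d))
    (hL : ∀ x → IsAtom P x → _≤P_ P x y → _≡[_]_ P (var x) (below P y) (evalP (L x) (θP P Θ)))
    (hL' : ∀ x → IsAtom P x → _≤P_ P x y' → _≡[_]_ P (var x) (below P y') (evalP (L' x) (θP P Θ)))
    {k k' : Fin (suc d)} {z : Elem P} (facet : IsFacet P y o k z) (facet' : IsFacet P y' o' k' z)
    (vanish : ∀ i → reduce (CellRestriction.column P Θ Θ₁ enum L hL (o k)) i ≡ 0ℚ) where
    open SimplicialPoset P using (N; le) renaming (trans to ≤-trans)
    open Faces P using (_⊑_; enumerations-↭; module Vertices)
    open IsFacet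
    module Y  = CellRestriction P Θ Θ₁ enum L hL
    module Y' = CellRestriction P Θ Θ₁ enum' L' hL'
    module V = FacetValues P enum Y.column facet vanish
    open V using (o-facet)

    private
      ⟨_,_⟩ : (Fin (suc d) → ℚ) → Fin N → ℚ
      ⟨ v , x ⟩ = ∑ℚ (λ l → v l * Θ l x)

      reduce-expand : ∀ v i → reduce v i ≡ ∑ℚ (λ κ → ⟨ v , o κ ⟩ * reduce (Y.column (o κ)) i)
      reduce-expand v i = begin
        v i + - (v i₀ * r) * u i ≡⟨ cong₂ (λ a b → a + - (b * r) * u i) (Y.expand v i) (Y.expand v i₀) ⟩
        ∑ℚ (λ κ → ⟨ v , o κ ⟩ * Y.column (o κ) i) + - (∑ℚ (λ κ → ⟨ v , o κ ⟩ * Y.column (o κ) i₀) * r) * u i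
          ≡⟨ cong ((∑ℚ (λ κ → ⟨ v , o κ ⟩ * Y.column (o κ) i)) +_) (trans
               (solve 3 (λ s r u → (:- (s :* r)) :* u := s :* (:- (r :* u))) refl (∑ℚ (λ κ → ⟨ v , o κ ⟩ * Y.column (o κ) i₀)) r (u i))
               (*-distribʳ-∑ℚ (- (r * u i)) (λ κ → ⟨ v , o κ ⟩ * Y.column (o κ) i₀))) ⟩
        ∑ℚ (λ κ → ⟨ v , o κ ⟩ * Y.column (o κ) i) + ∑ℚ (λ κ → ⟨ v , o κ ⟩ * Y.column (o κ) i₀ * - (r * u i))
          ≡⟨ sym (∑ℚ-distrib-+ (λ κ → ⟨ v , o κ ⟩ * Y.column (o κ) i) (λ κ → ⟨ v , o κ ⟩ * Y.column (o κ) i₀ * - (r * u i))) ⟩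
        ∑ℚ (λ κ → ⟨ v , o κ ⟩ * Y.column (o κ) i + ⟨ v , o κ ⟩ * Y.column (o κ) i₀ * - (r * u i))
          ≡⟨ ∑ℚ-cong (λ κ → solve 5 (λ p c e r u → p :* c :+ p :* e :* (:- (r :* u)) := p :* (c :+ (:- (e :* r)) :* u)) refl
               ⟨ v , o κ ⟩ (Y.column (o κ) i) (Y.column (o κ) i₀) r (u i)) ⟩
        ∑ℚ (λ κ → ⟨ v , o κ ⟩ * reduce (Y.column (o κ)) i) ∎

      o'-index : ∀ κ → κ ≢ k → ∃ λ κ' → o' κ' ≡ o κ
      o'-index κ ne = proj₂ (proj₂ enum') (o κ) (proj₁ (o-facet κ ne)) (≤-trans _ _ _ (proj₂ (o-facet κ ne)) (bound facet'))

      -- For `κ ≢ k` the atom `o κ` belongs to the common facet, hence is also a vertex of `y'`, and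
      -- the duality of `y'` evaluates the coefficient.
      product : ∀ κ (ne : κ ≢ k) κ'' → ⟨ Y'.column (o' κ'') , o κ ⟩ ≡ kronecker (proj₁ (o'-index κ ne)) κ''
      product κ ne κ'' with o'-index κ ne
      ... | κ' , eq = trans (∑ℚ-cong (λ l → trans (cong (λ x → Y'.column (o' κ'') l * Θ l x) (sym eq)) (ℚₚ.*-comm (Y'.column (o' κ'') l) (Θ l (o' κ')))))
          (Y'.pairing κ' κ'')

    -- In the basis of `y` this column has coefficient zero at each vertex of the facet, so it is a
    -- multiple of the column at `o k`, which reduces to zero.
    vanish' : ∀ i → reduce (Y'.column (o' k')) i ≡ 0ℚ
    vanish' i = trans (reduce-expand (Y'.column (o' k')) i) (∑ℚ-zero term)
      where
      term : ∀ κ → ⟨ Y'.column (o' k') , o κ ⟩ * reduce (Y.column (o κ)) i ≡ 0ℚ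
      term κ with κ Fin.≟ k
      ... | yes refl = trans (cong ((⟨ Y'.column (o' k') , o κ ⟩) *_) (vanish i)) (ℚₚ.*-zeroʳ ⟨ Y'.column (o' k') , o κ ⟩)
      ... | no ne = trans (cong (_* reduce (Y.column (o κ)) i) (trans (product κ ne k') (kronecker-other off))) (ℚₚ.*-zeroˡ (reduce (Y.column (o κ)) i))
        where
        off : proj₁ (o'-index κ ne) ≢ k'
        off eq = missing facet' (subst (_⊑ z) (trans (sym (proj₂ (o'-index κ ne))) (cong o' eq)) (proj₂ (o-facet κ ne)))

    -- In the basis of `y`, the column of `x` taken in `y'` has coefficient one at `x` and zero at
    -- the other facet vertices. The unknown coefficient at `o k` multiplies a vector that reduces
    -- to zero.
    reduce-agree : ∀ x → IsAtom P x → x ⊑ z → ∀ i → reduce (Y'.column x) i ≡ reduce (Y.column x) i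
    reduce-agree x atom x≤z i
      with proj₂ (proj₂ enum) x atom (≤-trans _ _ _ x≤z (bound facet)) | proj₂ (proj₂ enum') x atom (≤-trans _ _ _ x≤z (bound facet'))
    ... | κx , refl | κ'' , eq = begin
      reduce (Y'.column (o κx)) i ≡⟨ cong (λ t → reduce (Y'.column t) i) (sym eq) ⟩
      reduce (Y'.column (o' κ'')) i ≡⟨ reduce-expand (Y'.column (o' κ'')) i ⟩
      ∑ℚ (λ κ → ⟨ Y'.column (o' κ'') , o κ ⟩ * reduce (Y.column (o κ)) i) ≡⟨ ∑ℚ-only κx other ⟩
      ⟨ Y'.column (o' κ'') , o κx ⟩ * reduce (Y.column (o κx)) i
        ≡⟨ cong (_* reduce (Y.column (o κx)) i) (trans (product κx κx≢k κ'')
             (trans (cong (λ t → kronecker t κ'') (proj₁ (proj₂ enum') _ _ (trans (proj₂ (o'-index κx κx≢k)) (sym eq)))) (kronecker-self κ''))) ⟩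
      1ℚ * reduce (Y.column (o κx)) i ≡⟨ ℚₚ.*-identityˡ _ ⟩
      reduce (Y.column (o κx)) i ∎
      where
      κx≢k : κx ≢ k
      κx≢k refl = missing facet x≤z
      other : ∀ κ → κ ≢ κx → ⟨ Y'.column (o' κ'') , o κ ⟩ * reduce (Y.column (o κ)) i ≡ 0ℚ
      other κ ne with κ Fin.≟ k
      ... | yes refl = trans (cong ((⟨ Y'.column (o' κ'') , o κ ⟩) *_) (vanish i)) (ℚₚ.*-zeroʳ ⟨ Y'.column (o' κ'') , o κ ⟩)
      ... | no ne' = trans (cong (_* reduce (Y.column (o κ)) i) (trans (product κ ne' κ'')
          (kronecker-other (λ e → ne (proj₁ (proj₂ enum) _ _ (trans (sym (proj₂ (o'-index κ ne'))) (trans (cong o' e) eq))))))) (ℚₚ.*-zeroˡ (reduce (Y.column (o κ)) i))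

    private
      xs  = tabulate (o ∘ punchIn k)
      xs' = tabulate (o' ∘ punchIn k')

      xs↭xs' : xs ↭ xs'
      xs↭xs' = enumerations-↭ (enumerates facet) (enumerates facet')

    facet-product : ∀ {l} (ψ ψ' : Fin N → Poly l) → (∀ x → IsAtom P x → x ⊑ z → ψ x ≋ ψ' x) →
      ∏ (λ j → ψ (o (punchIn k j))) ≋ ∏ (λ j → ψ' (o' (punchIn k' j)))
    facet-product ψ ψ' h = ≋-trans (≋-reflexive (sym (prodP-tabulate ψ (o ∘ punchIn k))))
      (≋-trans (prodP-↭ ψ xs↭xs') (≋-trans (≋-reflexive (prodP-tabulate ψ (o' ∘ punchIn k')))
        (∏-cong (λ j → let (a , p) = proj₁ (enumerates facet') j in h _ a p))))

    -- First the vertex order is changed, at the cost of a sign absorbed by `inversionSign`; then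
    -- the columns are changed by multiples of `u`.
    minors-agree : inversionSign xs * minor Y.column xs ≡
                   inversionSign xs' * minor Y'.column xs'
    minors-agree = trans (alternating-↭ (minor-alternating Y.column) xs↭xs' (tabulate⁺ (λ {i} {j} → proj₁ (proj₂ (enumerates facet)) i j)))
      (cong ((negOnePowℚ (inversions (map toℕ xs'))) *_) (D-column-operations (suc d) u (columns (o' ∘ punchIn k') (proj₁ (enumerates facet')))))
      where
      columns : ∀ {n} (c : Fin n → Fin N) → (∀ j → IsAtom P (c j) × c j ⊑ z) →
        Pointwise (λ a b → ∃ λ t → ∀ i → a i ≡ b i + t * u i) (map Y.column (tabulate c)) (map Y'.column (tabulate c))
      columns {zero}  c h = []
      -- The two columns have equal reductions, so they differ by the difference of their subtracted
      -- multiples of `u`.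
      columns {suc n} c h = (scalar (Y.column (c zero)) + - scalar (Y'.column (c zero)) , same) ∷ columns (c ∘ suc) (h ∘ suc)
        where
        same : ∀ i → Y.column (c zero) i ≡ Y'.column (c zero) i + (scalar (Y.column (c zero)) + - scalar (Y'.column (c zero))) * u i
        same i = begin
          a ≡⟨ solve 3 (λ a s u → a := (a :+ (:- s) :* u) :+ s :* u) refl a s (u i) ⟩
          (a + - s * u i) + s * u i ≡⟨ cong (_+ s * u i) (sym (reduce-agree (c zero) (proj₁ (h zero)) (proj₂ (h zero)) i)) ⟩
          (b + - t * u i) + s * u i ≡⟨ solve 4 (λ b t u s → (b :+ (:- t) :* u) :+ s :* u := b :+ (s :+ (:- t)) :* u) refl b t (u i) s ⟩
          b + (s + - t) * u i ∎
          where
          a = Y.column (c zero) i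
          b = Y'.column (c zero) i
          s = scalar (Y.column (c zero))
          t = scalar (Y'.column (c zero))

    -- By `oriented-det` each oriented determinant is its `scalar` times the common quantity `K`. As
    -- `m` and `m'` invert the determinants, orientation divided by `m` times `scalar` is the same
    -- for both cells; the statement clears the denominators.
    orientations-agree : ∀ {m m'} → m * det (λ j k → Y.column (o k) j) ≡ 1ℚ → m' * det (λ j k → Y'.column (o' k) j) ≡ 1ℚ →
      orientation o k * (m' * scalar (Y'.column (o' k'))) ≡ orientation o' k' * (m * scalar (Y.column (o k)))
    orientations-agree {m} {m'} hm hm' = begin
      g * (m' * c') ≡⟨ solve 3 (λ g m' c' → g :* (m' :* c') := con 1ℚ :* (g :* (m' :* c'))) refl g m' c' ⟩
      1ℚ * (g * (m' * c')) ≡⟨ cong (_* (g * (m' * c'))) (sym hm) ⟩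
      m * Δ * (g * (m' * c')) ≡⟨ solve 5 (λ m D g m' c' → m :* D :* (g :* (m' :* c')) := m :* m' :* c' :* (g :* D)) refl m Δ g m' c' ⟩
      m * m' * c' * (g * Δ) ≡⟨ cong ((m * m' * c') *_) (trans (oriented-det Y.column o k vanish) (cong (c *_) minors-agree)) ⟩
      m * m' * c' * (c * K) ≡⟨ solve 5 (λ m m' c' c K → m :* m' :* c' :* (c :* K) := m :* m' :* c :* (c' :* K)) refl m m' c' c K ⟩
      m * m' * c * (c' * K) ≡⟨ cong ((m * m' * c) *_) (sym (oriented-det Y'.column o' k' vanish')) ⟩
      m * m' * c * (g' * Δ') ≡⟨ solve 5 (λ m D g m' c' → m :* m' :* c' :* (g :* D) := m' :* D :* (g :* (m :* c'))) refl m Δ' g' m' c ⟩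
      m' * Δ' * (g' * (m * c)) ≡⟨ trans (cong (_* (g' * (m * c))) hm') (ℚₚ.*-identityˡ _) ⟩
      g' * (m * c) ∎
      where
      g = orientation o k
      g' = orientation o' k'
      c = scalar (Y.column (o k))
      c' = scalar (Y'.column (o' k'))
      Δ = det (λ j k → Y.column (o k) j)
      Δ' = det (λ j k → Y'.column (o' k) j)
      K = inversionSign xs' * minor Y'.column xs'

    -- After `σ`, both substitutions send `w` to zero unless `w` lies below the facet, and otherwise
    -- to the product of the reduced forms at the vertices of `w`, on which the cells agree.
    restrictions-agree : ∀ α ι ι' → _≡[_]_ P α (below P y) (evalP ι (θP P Θ)) →
      _≡[_]_ P α (below P y') (evalP ι' (θP P Θ)) → σ ι ≋ σ ι'
    restrictions-agree α ι ι' h h' =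
      ≋-trans (σ-cong (Y.restriction α ι h)) (≋-trans (evalP-∘ _ _ α)
        (≋-trans (evalP-cong (≋-refl {p = α}) values) (≋-sym (≋-trans (σ-cong (Y'.restriction α ι' h')) (evalP-∘ _ _ α)))))
      where
      module V' = FacetValues P enum' Y'.column facet' vanish'
      values : ∀ w → σ (Restriction.value P enum (λ κ → linV (Y.column (o κ))) w) ≋
                     σ (Restriction.value P enum' (λ κ → linV (Y'.column (o' κ))) w)
      values w with T? (le w z)
      ... | no ¬p = ≋-trans (V.σ-value-out ¬p) (≋-sym (V'.σ-value-out ¬p))
      ... | yes p = ≋-trans (V.σ-value-in p) (≋-trans (facet-product (V.reducedMark w) (V'.reducedMark w) same) (≋-sym (V'.σ-value-in p)))
        where
        same : ∀ x → IsAtom P x → x ⊑ z → V.reducedMark w x ≋ V'.reducedMark w x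
        same x atom q with le x w
        ... | true  = linV-cong (λ i → sym (reduce-agree x atom q i))
        ... | false = ≋-refl

    reduced-products-agree : ∏ (λ j → linV (reduce (Y.column (o (punchIn k j))))) ≋ ∏ (λ j → linV (reduce (Y'.column (o' (punchIn k' j)))))
    reduced-products-agree = facet-product (λ x → linV (reduce (Y.column x))) (λ x → linV (reduce (Y'.column x)))
      (λ x atom q → linV-cong (λ i → sym (reduce-agree x atom q i)))

-- Splitting a denominator along a linear form

0≢1 : 0ℚ ≢ 1ℚ
0≢1 ()

-- The decision is an explicit argument, so a proof can generalise over it in a local helper and
-- need not unfold the decision procedure.
choose : {A B : Set} → Dec A → B → B → B
choose (yes _) x y = x
choose (no _)  x y = y

choose-yes : {A B : Set} (a : Dec A) {x y : B} → A → choose a x y ≡ x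
choose-yes (yes _) p = refl
choose-yes (no ¬p) p = ⊥-elim (¬p p)

choose-no : {A B : Set} (a : Dec A) {x y : B} → ¬ A → choose a x y ≡ y
choose-no (yes p) ¬p = ⊥-elim (¬p p)
choose-no (no _)  ¬p = refl

-- The factorisation ∏ L(o κ) = ∏ ρ κ · Λ, where Λ collects the factors proportional to ℓ.
module Factorisation {d N : ℕ} (u : Fin (suc d) → ℚ) (i₀ : Fin (suc d)) (r : ℚ) (ru : r * u i₀ ≡ 1ℚ)
  (o : Fin (suc d) → Fin N) (column : Fin N → Fin (suc d) → ℚ) where
  open Modulo u i₀ r ru
  open AlongForm u i₀ r ru using (scalar)

  Proportional : Fin (suc d) → Set
  Proportional κ = ∀ i → reduce (column (o κ)) i ≡ 0ℚ

  proportional? : ∀ κ → Dec (Proportional κ)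
  proportional? κ = all? (λ i → reduce (column (o κ)) i ℚₚ.≟ 0ℚ)

  ρ τ : Fin (suc d) → Poly (suc d)
  ρ κ = choose (proportional? κ) (constP (scalar (column (o κ)))) (linV (column (o κ)))
  τ κ = choose (proportional? κ) ℓ 1P

  -- `Λ*` is the cofactor of `Λ` in `ℓ`: it is what multiplication by `ℓ` leaves in the numerator of
  -- the cell's term.
  Λ Λ* : Poly (suc d)
  Λ  = choose (any? proportional?) ℓ 1P
  Λ* = choose (any? proportional?) 1P ℓ

  Λ*Λ≋ℓ : Λ* *P Λ ≋ ℓ
  Λ*Λ≋ℓ = go (any? proportional?)
    where
    go : {A : Set} (a : Dec A) → choose a 1P ℓ *P choose a ℓ 1P ≋ ℓ
    go (yes _) = *P-identityˡ ℓ
    go (no _)  = *-identityʳ ℓ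

  private
    proportional-form : ∀ κ → Proportional κ → linV (column (o κ)) ≋ constP (scalar (column (o κ))) *P ℓ
    proportional-form κ p = begin
      linV (column (o κ))                          ≈⟨ linV-cong {v = column (o κ)} {v' = λ j → 0ℚ + scalar (column (o κ)) * u j} (λ j → trans (reduce-zero {column (o κ)} p j) (sym (ℚₚ.+-identityˡ (scalar (column (o κ)) * u j)))) ⟩
      linV (λ j → 0ℚ + scalar (column (o κ)) * u j)  ≈⟨ ≋-sym (linV-combine (λ _ → 0ℚ) (scalar (column (o κ))) u) ⟩
      linV (λ _ → 0ℚ) +P scaleP (scalar (column (o κ))) ℓ  ≈⟨ +P-cong (linV-zero {λ _ → 0ℚ} (λ _ → refl)) (scaleP-≋ (scalar (column (o κ))) ℓ) ⟩
      constP (scalar (column (o κ))) *P ℓ ∎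
      where open ≋-Reasoning

  split-form : ∀ κ → linV (column (o κ)) ≋ ρ κ *P τ κ
  split-form κ = go (proportional? κ)
    where
    go : (a : Dec (Proportional κ)) →
      linV (column (o κ)) ≋ choose a (constP (scalar (column (o κ)))) (linV (column (o κ))) *P choose a ℓ 1P
    go (yes p) = proportional-form κ p
    go (no _)  = ≋-sym (*-identityʳ (linV (column (o κ))))

  module _ (Θ' : Fin (suc d) → Fin (suc d) → ℚ)
    (pairing : ∀ κ κ' → ∑ℚ (λ j → Θ' κ j * column (o κ') j) ≡ kronecker κ κ') where

    private
      pairing-scalar : ∀ κ κ' → Proportional κ' → scalar (column (o κ')) * ∑ℚ (λ j → Θ' κ j * u j) ≡ kronecker κ κ'
      pairing-scalar κ κ' p = trans (*-distribˡ-∑ℚ (scalar (column (o κ'))) (λ j → Θ' κ j * u j))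
        (trans (∑ℚ-cong (λ j → trans (solve 3 (λ s t u → s :* (t :* u) := t :* (s :* u)) refl (scalar (column (o κ'))) (Θ' κ j) (u j))
                  (cong ((Θ' κ j) *_) (sym (reduce-zero {column (o κ')} p j)))))
          (pairing κ κ'))

    scalar≢0 : ∀ κ → Proportional κ → scalar (column (o κ)) ≢ 0ℚ
    scalar≢0 κ p eq = 0≢1 (trans (sym (ℚₚ.*-zeroˡ (∑ℚ (λ j → Θ' κ j * u j))))
      (trans (cong (_* ∑ℚ (λ j → Θ' κ j * u j)) (sym eq)) (trans (pairing-scalar κ κ p) (kronecker-self κ))))

    -- If both columns were multiples of `u` with `κ` and `κ'` distinct, pairing `κ` with the column
    -- at `κ'` would make its pairing with `u` zero, hence also its pairing with its own column,
    -- which is one.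
    proportional-unique : ∀ κ κ' → Proportional κ → Proportional κ' → κ ≡ κ'
    proportional-unique κ κ' p p' = decidable-stable (κ Fin.≟ κ') λ ne →
      0≢1 (trans (sym (ℚₚ.*-zeroʳ (scalar (column (o κ)))))
        (trans (cong ((scalar (column (o κ))) *_) (sym (x*y≡0⇒y≡0 (scalar≢0 κ' p') (trans (pairing-scalar κ κ' p') (kronecker-other ne)))))
          (trans (pairing-scalar κ κ p) (kronecker-self κ))))

    private
      nonzero-entry : ∀ κ → ¬ Proportional κ → ∃ λ i → reduce (column (o κ)) i ≢ 0ℚ
      nonzero-entry κ = Finₚ.¬∀⟶∃¬ (suc d) (λ i → reduce (column (o κ)) i ≡ 0ℚ) (λ i → reduce (column (o κ)) i ℚₚ.≟ 0ℚ)

    -- A proportional form contributes only its nonzero scalar to `ρ`; any other form stays a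
    -- nonzero linear form after reduction. So `ρ` remains cancellable modulo `ℓ`.
    σρ-nzd : ∀ κ → NonZeroDivisor (σ (ρ κ))
    σρ-nzd κ = go (proportional? κ)
      where
      go : (a : Dec (Proportional κ)) → NonZeroDivisor (σ (choose a (constP (scalar (column (o κ)))) (linV (column (o κ)))))
      go (yes p) = nzd-resp {p = constP (scalar (column (o κ)))} (≋-sym (σ-const (scalar (column (o κ))))) (nzd-const (scalar≢0 κ p))
      go (no ¬p) = nzd-resp {p = linV (reduce (column (o κ)))} (≋-sym (σ-linV (column (o κ))))
        (linV-nzd (reduce (column (o κ))) (proj₁ (nonzero-entry κ ¬p)) (proj₂ (nonzero-entry κ ¬p)))

    ∏τ≋Λ : ∏ τ ≋ Λ
    ∏τ≋Λ = go (any? proportional?)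
      where
      go : (a : Dec (∃ Proportional)) → ∏ τ ≋ choose a ℓ 1P
      go (yes (κ , p)) = ≋-trans (∏-only {f = τ} κ (λ κ' ne → ≋-reflexive (choose-no (proportional? κ') (λ p' → ne (proportional-unique κ' κ p' p)))))
        (≋-reflexive (choose-yes (proportional? κ) p))
      go (no none)     = ∏-one {f = τ} (λ κ → ≋-reflexive (choose-no (proportional? κ) (λ p → none (κ , p))))

    product-split : ∏ (λ κ → linV (column (o κ))) ≋ ∏ ρ *P Λ
    product-split = ≋-trans (∏-cong split-form) (≋-trans (∏-distrib-* ρ τ) (*P-congˡ (∏ ρ) ∏τ≋Λ))

    σ∏ρ : ∀ k → Proportional k → σ (∏ ρ) ≋ constP (scalar (column (o k))) *P ∏ (λ j → linV (reduce (column (o (punchIn k j)))))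
    σ∏ρ k p = ≋-trans (σ-∏ ρ) (≋-trans (∏-remove {i = k} (λ κ → σ (ρ κ)))
      (*P-cong at-k (∏-cong {f = λ j → σ (ρ (punchIn k j))} {g = λ j → linV (reduce (column (o (punchIn k j))))} off-k)))
      where
      at-k : σ (ρ k) ≋ constP (scalar (column (o k)))
      at-k = ≋-trans (σ-cong (≋-reflexive (choose-yes (proportional? k) p))) (σ-const (scalar (column (o k))))
      off-k : ∀ j → σ (ρ (punchIn k j)) ≋ linV (reduce (column (o (punchIn k j))))
      off-k j = ≋-trans (σ-cong (≋-reflexive (choose-no (proportional? (punchIn k j))
        (λ p' → Finₚ.punchInᵢ≢i k j (proportional-unique (punchIn k j) k p' p))))) (σ-linV (column (o (punchIn k j))))

-- From integer signs to rational signs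

module _ where
  open import Data.Rational.Unnormalised as ℚᵘ using (mkℚᵘ; *≡*)
  import Data.Rational.Unnormalised.Properties as ℚᵘₚ
  import Data.Integer.Properties as ℤₚ

  private
    toℚᵘ-/1 : ∀ i → ℚ.toℚᵘ (i ℚ./ 1) ℚᵘ.≃ mkℚᵘ i 0
    toℚᵘ-/1 i = ℚₚ.toℚᵘ-fromℚᵘ (mkℚᵘ i 0)

  /1-+ : ∀ i j → (i ℤ.+ j) ℚ./ 1 ≡ i ℚ./ 1 + j ℚ./ 1
  /1-+ i j = ℚₚ.toℚᵘ-injective (ℚᵘₚ.≃-trans (toℚᵘ-/1 (i ℤ.+ j)) (ℚᵘₚ.≃-sym
    (ℚᵘₚ.≃-trans (ℚₚ.toℚᵘ-homo-+ (i ℚ./ 1) (j ℚ./ 1))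
      (ℚᵘₚ.≃-trans (ℚᵘₚ.+-cong (toℚᵘ-/1 i) (toℚᵘ-/1 j))
        (*≡* (cong (ℤ._* ℤ.+ 1) (cong₂ ℤ._+_ (ℤₚ.*-identityʳ i) (ℤₚ.*-identityʳ j))))))))

  /1-* : ∀ i j → (i ℤ.* j) ℚ./ 1 ≡ (i ℚ./ 1) * (j ℚ./ 1)
  /1-* i j = ℚₚ.toℚᵘ-injective (ℚᵘₚ.≃-trans (toℚᵘ-/1 (i ℤ.* j)) (ℚᵘₚ.≃-sym
    (ℚᵘₚ.≃-trans (ℚₚ.toℚᵘ-homo-* (i ℚ./ 1) (j ℚ./ 1)) (ℚᵘₚ.*-cong (toℚᵘ-/1 i) (toℚᵘ-/1 j)))))

  negOnePow-/1 : ∀ n → negOnePowℤ n ℚ./ 1 ≡ negOnePowℚ n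
  negOnePow-/1 zero    = refl
  negOnePow-/1 (suc n) = begin
    (ℤ.- negOnePowℤ n) ℚ./ 1                    ≡⟨ cong (ℚ._/ 1) (sym (ℤₚ.-1*i≡-i (negOnePowℤ n))) ⟩
    (ℤ.-1ℤ ℤ.* negOnePowℤ n) ℚ./ 1              ≡⟨ /1-* ℤ.-1ℤ (negOnePowℤ n) ⟩
    (- 1ℚ) * (negOnePowℤ n ℚ./ 1)               ≡⟨ cong ((- 1ℚ) *_) (negOnePow-/1 n) ⟩
    (- 1ℚ) * negOnePowℚ n                       ≡⟨ solve 1 (λ x → con (- 1ℚ) :* x := :- x) refl (negOnePowℚ n) ⟩
    - negOnePowℚ n ∎
    where open ≡-Reasoning

sumℤ-/1 : ∀ {A : Set} (f : A → List ℤ) xs →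
  sumℤ (concatMap f xs) ℚ./ 1 ≡ sumℚ (map (λ x → sumℚ (map (ℚ._/ 1) (f x))) xs)
sumℤ-/1 f [] = refl
sumℤ-/1 f (x ∷ xs) = trans (go (f x)) (cong ((sumℚ (map (ℚ._/ 1) (f x))) +_) (sumℤ-/1 f xs))
  where
  rest = concatMap f xs
  go : ∀ ys → sumℤ (ys ++ rest) ℚ./ 1 ≡ sumℚ (map (ℚ._/ 1) ys) + sumℤ rest ℚ./ 1
  go []       = sym (ℚₚ.+-identityˡ _)
  go (y ∷ ys) = trans (/1-+ y (sumℤ (ys ++ rest))) (trans (cong (λ t → y ℚ./ 1 + t) (go ys)) (sym (ℚₚ.+-assoc (y ℚ./ 1) _ _)))

removeAt-map : ∀ {A B : Set} (f : A → B) n xs → removeAt n (map f xs) ≡ map f (removeAt n xs)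
removeAt-map f n       []       = refl
removeAt-map f zero    (x ∷ xs) = refl
removeAt-map f (suc n) (x ∷ xs) = cong (f x ∷_) (removeAt-map f n xs)

removeAt-tabulate : ∀ {A : Set} {n} (c : Fin (suc n) → A) k → removeAt (toℕ k) (tabulate c) ≡ tabulate (c ∘ punchIn k)
removeAt-tabulate c zero = refl
removeAt-tabulate {n = suc n} c (suc k) = cong (c zero ∷_) (removeAt-tabulate (c ∘ suc) k)

constP-∑ : ∀ {k n} (f : Fin n → ℚ) → constP {k} (∑ℚ f) ≋ ∑ (λ i → constP (f i))
constP-∑ {n = zero}  f = constP-0
constP-∑ {n = suc n} f = ≋-trans (constP-+ (f zero) (∑ℚ (f ∘ suc))) (+P-congˡ (constP (f zero)) (constP-∑ (f ∘ suc)))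

if-true : ∀ {A : Set} {b} {x y : A} → b ≡ true → (if b then x else y) ≡ x
if-true refl = refl

if-false : ∀ {A : Set} {b} {x y : A} → b ≡ false → (if b then x else y) ≡ y
if-false refl = refl

-- The index sum: residues along one form, and the final quotient

module PolyFractions {k N : ℕ} = PartialFractions (polyRing k) {N}

module Index (P : SimplicialPoset) {d : ℕ} (Θ : Fin (suc d) → Elem P → ℚ) (Θ₁ : DegreeOne P Θ)
  (sgn : Elem P → ℤ)
  (sgn-square : ∀ y → SimplicialPoset.rk P y ≡ suc d → (sgn y ℚ./ 1) * (sgn y ℚ./ 1) ≡ 1ℚ)
  (ord : Elem P → Fin (suc d) → Elem P)
  (enum : ∀ y → SimplicialPoset.rk P y ≡ suc d → EnumAtoms P y (ord y))
  (lθ : Elem P → Elem P → Poly (suc d))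
  (hθ : ∀ y → SimplicialPoset.rk P y ≡ suc d → ∀ x → IsAtom P x → _≤P_ P x y →
     _≡[_]_ P (var x) (below P y) (evalP (lθ y x) (θP P Θ)))
  (cycle : CycleCond P (suc d) sgn ord)
  (m : Elem P → ℚ)
  (hm : ∀ y → SimplicialPoset.rk P y ≡ suc d → m y * det (ThetaMat P (suc d) ord lθ y) ≡ 1ℚ)
  (α : Poly (SimplicialPoset.N P)) (ια : Elem P → Poly (suc d))
  (hα : ∀ y → SimplicialPoset.rk P y ≡ suc d → _≡[_]_ P α (below P y) (evalP (ια y) (θP P Θ))) where
  open SimplicialPoset P using (N; le; rk)
  open Faces P using (_⊑_; module Facets)
  open PolyFractions {suc d} {N}
  open ≋-Reasoning

  Top : Fin N → Set
  Top y = rk y ≡ suc d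

  top : Fin N → Bool
  top y = rk y ℕ.≡ᵇ suc d

  top-true : ∀ {y} → Top y → top y ≡ true
  top-true {y} t = T⇒true (ℕₚ.≡⇒≡ᵇ (rk y) (suc d) t)

  top-false : ∀ {y} → ¬ Top y → top y ≡ false
  top-false {y} ¬t = ¬T⇒false (λ h → ¬t (ℕₚ.≡ᵇ⇒≡ (rk y) (suc d) h))

  sign : Fin N → ℚ
  sign y = sgn y ℚ./ 1

  column : Fin N → Fin N → Fin (suc d) → ℚ
  column y x j = coeff (lθ y x) (unitMon j)

  module Cell (y : Fin N) (t : Top y) = CellRestriction P Θ Θ₁ (enum y t) (lθ y) (hθ y t)

  m≢0 : ∀ {y} → Top y → m y ≢ 0ℚ
  m≢0 {y} t eq = 0≢1 (trans (sym (ℚₚ.*-zeroˡ (det (ThetaMat P (suc d) ord lθ y))))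
    (trans (cong (_* det (ThetaMat P (suc d) ord lθ y)) (sym eq)) (hm y t)))

  denominator : Fin N → Poly (suc d)
  denominator y = scaleP (m y) (ThetaProd P (suc d) ord lθ y)

  forms : Fin N → Poly (suc d)
  forms y = ∏ (λ k → linV (column y (ord y k)))

  denominator-forms : ∀ {y} → Top y → denominator y ≋ constP (m y) *P forms y
  denominator-forms {y} t = ≋-trans (scaleP-≋ (m y) (ThetaProd P (suc d) ord lθ y))
    (*P-congˡ (constP (m y)) (≋-trans (≋-reflexive (∏-allFin (suc d) (λ k → lθ y (ord y k))))
      (∏-cong {f = λ k → lθ y (ord y k)} {g = λ k → linV (column y (ord y k))} (Cell.L-linear y t))))

  -- Numerators and denominators of the terms, extended to all of `P`: the defaults `0P` and `1P`
  -- let sums and products over the list of top cells run over `Fin N` instead.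
  a C : Fin N → Poly (suc d)
  a y = if top y then scaleP (sign y) (ια y) else 0P
  C y = if top y then denominator y else 1P

  a-off : ∀ {y} → ¬ Top y → a y ≡ 0P
  a-off ¬t = if-false (top-false ¬t)

  facet : ∀ {y z k} (t : Top y) → rk z ≡ d → z ⊑ y → ¬ (ord y k ⊑ z) → IsFacet P y (ord y) k z
  facet {y} {z} {k} t rz z≤y missing = record
    { bound = z≤y ; missing = missing
    ; enumerates = subst (λ w → EnumAtoms P w (ord y ∘ punchIn k)) (sym (face-unique rz z≤y missing)) face-enumerates }
    where open Facets (enum y t) k

  incident : Fin N → Fin N → Fin (suc d) → Bool
  incident z y k = (rk z ℕ.≡ᵇ d) ∧ (top y ∧ (le z y ∧ not (le (ord y k) z)))

  record Incident (z y : Fin N) (k : Fin (suc d)) : Set where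
    field
      rank    : rk z ≡ d
      isTop   : Top y
      bound   : z ⊑ y
      missing : ¬ (ord y k ⊑ z)

  T-not⇒¬T : ∀ {b} → T (not b) → ¬ T b
  T-not⇒¬T {false} _ ()

  ¬T⇒T-not : ∀ {b} → ¬ T b → T (not b)
  ¬T⇒T-not {true}  h = h _
  ¬T⇒T-not {false} h = _

  incident⇒ : ∀ {z y k} → T (incident z y k) → Incident z y k
  incident⇒ {z} {y} {k} h = record
    { rank = ℕₚ.≡ᵇ⇒≡ (rk z) d (proj₁ h₁) ; isTop = ℕₚ.≡ᵇ⇒≡ (rk y) (suc d) (proj₁ h₂)
    ; bound = proj₁ h₃ ; missing = T-not⇒¬T (proj₂ h₃) }
    where
    h₁ = Equivalence.to T-∧ h
    h₂ = Equivalence.to T-∧ (proj₂ h₁)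
    h₃ = Equivalence.to T-∧ (proj₂ h₂)

  ⇒incident : ∀ {z y k} → Incident z y k → T (incident z y k)
  ⇒incident {z} {y} i = Equivalence.from T-∧ (ℕₚ.≡⇒≡ᵇ (rk z) d rank , Equivalence.from T-∧ (ℕₚ.≡⇒≡ᵇ (rk y) (suc d) isTop ,
    Equivalence.from T-∧ (bound , ¬T⇒T-not missing)))
    where open Incident i

  toFacet : ∀ {z y k} (i : Incident z y k) → IsFacet P y (ord y) k z
  toFacet i = facet isTop rank bound missing
    where open Incident i

  oriented : Fin N → Fin (suc d) → ℚ
  oriented y k = sign y * orientation (ord y) k

  orientation-square : ∀ y k → orientation (ord y) k * orientation (ord y) k ≡ 1ℚ
  orientation-square y k = trans (solve 2 (λ a b → a :* b :* (a :* b) := a :* a :* (b :* b)) refl (negOnePowℚ (toℕ k)) (inversionSign (tabulate (ord y ∘ punchIn k))))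
    (cong₂ _*_ (negOnePowℚ-square (toℕ k)) (negOnePowℚ-square (inversions (map toℕ (tabulate (ord y ∘ punchIn k))))))

  -- For `z` of rank `d` this is the cycle condition carried over to ℚ; for any other rank
  -- `incident` is always false.
  cycle-sum : ∀ z → ∑ℚ (λ y → ∑ℚ (λ k → if incident z y k then oriented y k else 0ℚ)) ≡ 0ℚ
  cycle-sum z = go (rk z ℕ.≟ d)
    where
    module E = ≡-Reasoning
    entry term : Fin N → Fin (suc d) → ℤ
    entry y k = sgn y ℤ.* (negOnePowℤ (toℕ k) ℤ.* negOnePowℤ (inversions (removeAt (toℕ k) (map (λ k' → toℕ (ord y k')) (allFin (suc d))))))
    term y k = if le z y ∧ not (le (ord y k) z) then entry y k else ℤ.+ 0
    sign-/1 : ∀ y k → entry y k ℚ./ 1 ≡ oriented y k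
    sign-/1 y k = E.begin
      (sgn y ℤ.* (negOnePowℤ (toℕ k) ℤ.* negOnePowℤ (inversions l))) ℚ./ 1
        E.≡⟨ trans (/1-* (sgn y) _) (cong ((sign y) *_) (/1-* (negOnePowℤ (toℕ k)) (negOnePowℤ (inversions l)))) ⟩
      sign y * ((negOnePowℤ (toℕ k) ℚ./ 1) * (negOnePowℤ (inversions l) ℚ./ 1))
        E.≡⟨ cong₂ (λ s t → sign y * (s * t)) (negOnePow-/1 (toℕ k)) (trans (negOnePow-/1 (inversions l)) (cong (λ l → negOnePowℚ (inversions l)) sorted)) ⟩
      oriented y k E.∎
      where
      l = removeAt (toℕ k) (map (λ k' → toℕ (ord y k')) (allFin (suc d)))
      sorted : l ≡ map toℕ (tabulate (ord y ∘ punchIn k))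
      sorted = trans (cong (removeAt (toℕ k)) (trans (Listₚ.map-tabulate id (λ k' → toℕ (ord y k'))) (sym (Listₚ.map-tabulate (ord y) toℕ))))
        (trans (removeAt-map toℕ (toℕ k) (tabulate (ord y))) (cong (map toℕ) (removeAt-tabulate (ord y) k)))
    if-/1 : ∀ (b t : Bool) {i : ℤ} {q : ℚ} → i ℚ./ 1 ≡ q → (if t ∧ b then q else 0ℚ) ≡ (if t then (if b then i else ℤ.+ 0) ℚ./ 1 else 0ℚ)
    if-/1 true  true  h = sym h
    if-/1 false true  h = refl
    if-/1 b     false h = refl
    if-sum : ∀ (t : Bool) (f : Fin (suc d) → ℚ) → ∑ℚ (λ k → if t then f k else 0ℚ) ≡ (if t then ∑ℚ f else 0ℚ)
    if-sum true  f = refl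
    if-sum false f = ∑ℚ-zero {f = λ (_ : Fin (suc d)) → 0ℚ} (λ _ → refl)
    go : Dec (rk z ≡ d) → ∑ℚ (λ y → ∑ℚ (λ k → if incident z y k then oriented y k else 0ℚ)) ≡ 0ℚ
    go (no ¬rz) = ∑ℚ-zero (λ y → ∑ℚ-zero (λ k → if-false {x = oriented y k} {y = 0ℚ} (¬T⇒false (λ h → ¬rz (Incident.rank (incident⇒ {z} {y} {k} h))))))
    go (yes rz) = E.begin
      ∑ℚ (λ y → ∑ℚ (λ k → if incident z y k then oriented y k else 0ℚ))
        E.≡⟨ ∑ℚ-cong (λ y → trans (∑ℚ-cong (λ k → trans (cong (λ b → if b ∧ (top y ∧ (le z y ∧ not (le (ord y k) z))) then oriented y k else 0ℚ) (T⇒true (ℕₚ.≡⇒≡ᵇ (rk z) d rz)))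
               (if-/1 (le z y ∧ not (le (ord y k) z)) (top y) {entry y k} {oriented y k} (sign-/1 y k)))) (if-sum (top y) (λ k → term y k ℚ./ 1))) ⟩
      ∑ℚ (λ y → if top y then ∑ℚ (λ k → term y k ℚ./ 1) else 0ℚ)
        E.≡⟨ sym (∑ℚ-filter N top (λ y → ∑ℚ (λ k → term y k ℚ./ 1))) ⟩
      sumℚ (map (λ y → ∑ℚ (λ k → term y k ℚ./ 1)) (tops P (suc d)))
        E.≡⟨ cong sumℚ (Listₚ.map-cong (λ y → sym (trans (cong sumℚ (sym (Listₚ.map-∘ {g = ℚ._/ 1} {f = term y} (allFin (suc d))))) (∑ℚ-allFin (suc d) (λ k → term y k ℚ./ 1)))) (tops P (suc d))) ⟩
      sumℚ (map (λ y → sumℚ (map (ℚ._/ 1) (map (term y) (allFin (suc d))))) (tops P (suc d)))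
        E.≡⟨ sym (sumℤ-/1 (λ y → map (term y) (allFin (suc d))) (tops P (suc d))) ⟩
      sumℤ (concatMap (λ y → map (term y) (allFin (suc d))) (tops P (suc d))) ℚ./ 1 E.≡⟨ cong (ℚ._/ 1) (cycle z rz) ⟩
      0ℚ E.∎

  module AtForm (u : Fin (suc d) → ℚ) (i₀ : Fin (suc d)) (r : ℚ) (ru : r * u i₀ ≡ 1ℚ) where
    open Modulo u i₀ r ru
    open AlongForm u i₀ r ru using (scalar; module Adjacent)
    module F (y : Fin N) = Factorisation u i₀ r ru (ord y) (column y)

    Θ' : Fin N → Fin (suc d) → Fin (suc d) → ℚ
    Θ' y κ j = Θ j (ord y κ)

    -- C y = D' y · Λ y with D' y prime to ℓ and Λ y one of 1, ℓ.
    D' Λ Λ* : Fin N → Poly (suc d)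
    D' y = if top y then constP (m y) *P ∏ (F.ρ y) else 1P
    Λ y = if top y then F.Λ y else 1P
    -- Outside the top cells `Λ y` is `1P`, so the default has to be `ℓ` for `Λ* y *P Λ y` to equal
    -- `ℓ` at every `y`.
    Λ* y = if top y then F.Λ* y else ℓ

    C-split : ∀ y → C y ≋ D' y *P Λ y
    C-split y = go (rk y ℕ.≟ suc d)
      where
      go : Dec (Top y) → C y ≋ D' y *P Λ y
      go (yes t) = begin
        C y ≡⟨ if-true (top-true t) ⟩
        denominator y ≈⟨ denominator-forms t ⟩
        constP (m y) *P forms y ≈⟨ *P-congˡ (constP (m y)) (F.product-split y (Θ' y) (Cell.pairing y t)) ⟩
        constP (m y) *P (∏ (F.ρ y) *P F.Λ y) ≈⟨ ≋-sym (*P-assoc (constP (m y)) (∏ (F.ρ y)) (F.Λ y)) ⟩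
        (constP (m y) *P ∏ (F.ρ y)) *P F.Λ y ≡⟨ sym (cong₂ _*P_ (if-true (top-true t)) (if-true (top-true t))) ⟩
        D' y *P Λ y ∎
      go (no ¬t) = begin
        C y ≡⟨ if-false (top-false ¬t) ⟩
        1P ≈⟨ ≋-sym (*P-identityˡ 1P) ⟩
        1P *P 1P ≡⟨ sym (cong₂ _*P_ (if-false (top-false ¬t)) (if-false (top-false ¬t))) ⟩
        D' y *P Λ y ∎

    Λ-complement : ∀ y → Λ* y *P Λ y ≋ ℓ
    Λ-complement y = go (rk y ℕ.≟ suc d)
      where
      go : Dec (Top y) → Λ* y *P Λ y ≋ ℓ
      go (yes t) = ≋-trans (≋-reflexive (cong₂ _*P_ (if-true (top-true t)) (if-true (top-true t)))) (F.Λ*Λ≋ℓ y)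
      go (no ¬t) = ≋-trans (≋-reflexive (cong₂ _*P_ (if-false (top-false ¬t)) (if-false (top-false ¬t)))) (*-identityʳ ℓ)

    σD-top : ∀ {y} → Top y → σ (D' y) ≋ constP (m y) *P σ (∏ (F.ρ y))
    σD-top {y} t = ≋-trans (σ-cong (≋-reflexive (if-true (top-true t))))
      (≋-trans (σ-* (constP (m y)) (∏ (F.ρ y))) (*P-congʳ (σ (∏ (F.ρ y))) (σ-const (m y))))

    σD-nzd : ∀ y → NonZeroDivisor (σ (D' y))
    σD-nzd y = go (rk y ℕ.≟ suc d)
      where
      go : Dec (Top y) → NonZeroDivisor (σ (D' y))
      go (yes t) = nzd-resp {p = constP (m y) *P σ (∏ (F.ρ y))} (≋-sym (σD-top t))
        (nzd-* {p = constP (m y)} {q = σ (∏ (F.ρ y))} (nzd-const (m≢0 t))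
          (nzd-resp {p = ∏ (λ κ → σ (F.ρ y κ))} (≋-sym (σ-∏ (F.ρ y)))
            (nzd-∏ {f = λ κ → σ (F.ρ y κ)} (F.σρ-nzd y (Θ' y) (Cell.pairing y t)))))
      go (no ¬t) = nzd-resp {p = 1P} (≋-sym (≋-trans (σ-cong (≋-reflexive (if-false (top-false ¬t)))) (σ-const 1ℚ))) nzd-1

    -- Over the common denominator `∏ D'`, `b y` is the numerator of `ℓ` times the term of `y`. For
    -- a cell with a pole along `ℓ`, `Λ* y` is `1P` and `b y` equals `β y`.
    β b : Fin N → Poly (suc d)
    β y = a y *P hat D' y
    b y = a y *P Λ* y *P hat D' y

    -- The residue of `y`, placed at the vertex whose form is proportional to `ℓ`. Indexing by the
    -- vertex lets it be assigned to the opposite facet.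
    B : Fin N → Fin (suc d) → Poly (suc d)
    B y k = if top y then choose (F.proportional? y k) (σ (β y)) 0P else 0P

    B-yes : ∀ {y k} → Top y → F.Proportional y k → B y k ≡ σ (β y)
    B-yes {y} {k} t p = trans (if-true (top-true t)) (choose-yes (F.proportional? y k) p)

    B-no : ∀ {y k} → ¬ F.Proportional y k → B y k ≡ 0P
    B-no {y} {k} ¬p = trans (cong (λ x → if top y then x else 0P) (choose-no (F.proportional? y k) ¬p)) (both (top y))
      where
      both : ∀ (c : Bool) → (if c then 0P else 0P) ≡ 0P {suc d}
      both true  = refl
      both false = refl

    -- With a proportional form the sum has one nonzero candidate, by uniqueness. Without one,
    -- `Λ* y` is `ℓ` and `σ` annihilates `b y`.
    σb : ∀ y → σ (b y) ≋ ∑ (B y)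
    σb y = go (rk y ℕ.≟ suc d)
      where
      residue : Top y → Dec (∃ (F.Proportional y)) → σ (b y) ≋ ∑ (B y)
      residue t (yes (κ , p)) = begin
        σ (b y) ≈⟨ σ-cong (*P-congʳ (hat D' y) (≋-trans (*P-congˡ (a y) (≋-reflexive (trans (if-true (top-true t)) (choose-yes (any? (F.proportional? y)) (κ , p)))))
                     (*-identityʳ (a y)))) ⟩
        σ (β y) ≡⟨ sym (B-yes t p) ⟩
        B y κ ≈⟨ ≋-sym (∑-only {f = B y} κ (λ κ' ne → ≋-reflexive (B-no (λ p' →
                   ne (F.proportional-unique y (Θ' y) (Cell.pairing y t) κ' κ p' p))))) ⟩
        ∑ (B y) ∎
      residue t (no none) = begin
        σ (b y) ≈⟨ σ-cong (*P-congʳ (hat D' y) (*P-congˡ (a y) (≋-reflexive (trans (if-true (top-true t)) (choose-no (any? (F.proportional? y)) none))))) ⟩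
        σ (a y *P ℓ *P hat D' y) ≈⟨ ≋-trans (σ-* (a y *P ℓ) (hat D' y)) (*P-congʳ (σ (hat D' y)) (≋-trans (σ-* (a y) ℓ)
              (≋-trans (*P-congˡ (σ (a y)) σℓ≋0) (zeroʳ (σ (a y)))))) ⟩
        0P *P σ (hat D' y) ≈⟨ zeroˡ (σ (hat D' y)) ⟩
        0P ≈⟨ ≋-sym (∑-zero {f = B y} (λ κ → ≋-reflexive (B-no (λ p → none (κ , p))))) ⟩
        ∑ (B y) ∎
      go : Dec (Top y) → σ (b y) ≋ ∑ (B y)
      go (yes t) = residue t (any? (F.proportional? y))
      go (no ¬t) = begin
        σ (b y) ≈⟨ σ-cong (≋-trans (*P-congʳ (hat D' y) (≋-trans (*P-congʳ (Λ* y) (≋-reflexive (a-off ¬t))) (zeroˡ (Λ* y)))) (zeroˡ (hat D' y))) ⟩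
        0P ≈⟨ ≋-sym (∑-zero {f = B y} (λ κ → ≋-reflexive (if-false (top-false ¬t)))) ⟩
        ∑ (B y) ∎

    e : Fin N → Fin (suc d) → Poly (suc d)
    e y k = constP (oriented y k)

    -- The sign of `y` occurs both in `e y k` and in `a y`, and its square is one; only the
    -- orientation remains.
    oriented-β : ∀ {y} k → Top y → e y k *P σ (β y) ≋ constP (orientation (ord y) k) *P (σ (ια y) *P σ (hat D' y))
    oriented-β {y} k t = begin
      e y k *P σ (β y) ≈⟨ *P-congˡ (e y k) (≋-trans (σ-* (a y) (hat D' y)) (*P-congʳ h σa)) ⟩
      e y k *P ((constP (sign y) *P σ (ια y)) *P h) ≈⟨ *P-congˡ (e y k) (*P-assoc (constP (sign y)) (σ (ια y)) h) ⟩
      e y k *P (constP (sign y) *P (σ (ια y) *P h)) ≈⟨ ≋-sym (*P-assoc (e y k) (constP (sign y)) (σ (ια y) *P h)) ⟩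
      (e y k *P constP (sign y)) *P (σ (ια y) *P h) ≈⟨ *P-congʳ (σ (ια y) *P h) (≋-trans (≋-sym (constP-* (oriented y k) (sign y))) (≋-reflexive (cong constP scalars))) ⟩
      constP (orientation (ord y) k) *P (σ (ια y) *P h) ∎
      where
      h = σ (hat D' y)
      σa : σ (a y) ≋ constP (sign y) *P σ (ια y)
      σa = ≋-trans (σ-cong (≋-trans (≋-reflexive (if-true (top-true t))) (scaleP-≋ (sign y) (ια y))))
        (≋-trans (σ-* (constP (sign y)) (ια y)) (*P-congʳ (σ (ια y)) (σ-const (sign y))))
      scalars : oriented y k * sign y ≡ orientation (ord y) k
      scalars = trans (solve 2 (λ s g → s :* g :* s := s :* s :* g) refl (sign y) (orientation (ord y) k))
        (trans (cong (_* orientation (ord y) k) (sgn-square y t)) (ℚₚ.*-identityˡ _))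

    module _ {z y y' : Fin N} {k k' : Fin (suc d)} (i : Incident z y k) (i' : Incident z y' k') where
      private
        t = Incident.isTop i
        t' = Incident.isTop i'

      module Pair (p : F.Proportional y k) where
        open Adjacent P Θ Θ₁ (enum y t) (enum y' t') (lθ y) (lθ y') (hθ y t) (hθ y' t') (toFacet i) (toFacet i') p public

      proportional-across : F.Proportional y k → F.Proportional y' k'
      proportional-across p = Pair.vanish' p

      σD-form : ∀ {y k} → Top y → F.Proportional y k →
        σ (D' y) ≋ constP (m y * scalar (column y (ord y k))) *P ∏ (λ j → linV (reduce (column y (ord y (punchIn k j)))))
      σD-form {y} {k} t p = begin
        σ (D' y) ≈⟨ σD-top t ⟩
        constP (m y) *P σ (∏ (F.ρ y)) ≈⟨ *P-congˡ (constP (m y)) (F.σ∏ρ y (Θ' y) (Cell.pairing y t) k p) ⟩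
        constP (m y) *P (constP c *P Π) ≈⟨ ≋-sym (*P-assoc (constP (m y)) (constP c) Π) ⟩
        constP (m y) *P constP c *P Π ≈⟨ *P-congʳ Π (≋-sym (constP-* (m y) c)) ⟩
        constP (m y * c) *P Π ∎
        where
        c = scalar (column y (ord y k))
        Π = ∏ (λ j → linV (reduce (column y (ord y (punchIn k j)))))

      -- By `σD-form`, each `σ (D' y)` is `m y` times `scalar` times the product of the reduced
      -- facet forms. These products agree, and the constants are compared by `orientations-agree`.
      cross : F.Proportional y k → F.Proportional y' k' →
        constP (orientation (ord y) k) *P σ (D' y') ≋ constP (orientation (ord y') k') *P σ (D' y)
      cross p p' = begin
        constP g *P σ (D' y') ≈⟨ *P-congˡ (constP g) (σD-form t' p') ⟩
        constP g *P (constP (m y' * c') *P Π') ≈⟨ merge g (m y' * c') Π' ⟩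
        constP (g * (m y' * c')) *P Π' ≈⟨ *P-cong (≋-reflexive (cong constP (Pair.orientations-agree p {m y} {m y'} (hm y t) (hm y' t')))) (≋-sym (Pair.reduced-products-agree p)) ⟩
        constP (g' * (m y * c)) *P Π ≈⟨ ≋-sym (merge g' (m y * c) Π) ⟩
        constP g' *P (constP (m y * c) *P Π) ≈⟨ *P-congˡ (constP g') (≋-sym (σD-form t p)) ⟩
        constP g' *P σ (D' y) ∎
        where
        g = orientation (ord y) k
        g' = orientation (ord y') k'
        c = scalar (column y (ord y k))
        c' = scalar (column y' (ord y' k'))
        Π = ∏ (λ j → linV (reduce (column y (ord y (punchIn k j)))))
        Π' = ∏ (λ j → linV (reduce (column y' (ord y' (punchIn k' j)))))
        merge : ∀ g c (q : Poly (suc d)) → constP g *P (constP c *P q) ≋ constP (g * c) *P q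
        merge g c q = ≋-trans (≋-sym (*P-assoc (constP g) (constP c) q)) (*P-congʳ q (≋-sym (constP-* g c)))

      σhat : ∀ y → σ (D' y) *P σ (hat D' y) ≋ σ (∏ D')
      σhat y = ≋-trans (≋-sym (σ-* (D' y) (hat D' y))) (σ-cong (hat-total D' y))

      -- Modulo `ℓ`, each cofactor `hat D'` is the same product `∏ D'` divided by the cell's own
      -- `D'`. So the two residues agree after multiplication by both `σ (D' y)` and `σ (D' y')`,
      -- which can be cancelled.
      agree-proportional : F.Proportional y k → F.Proportional y' k' → e y k *P σ (β y) ≋ e y' k' *P σ (β y')
      agree-proportional p p' = ≋-trans (oriented-β k t) (≋-trans
        (nzd-cancel {p = σ (D' y) *P σ (D' y')} (nzd-* {p = σ (D' y)} {q = σ (D' y')} (σD-nzd y) (σD-nzd y'))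
          (cross-multiply {X = σ (D' y)} {X' = σ (D' y')} {h = σ (hat D' y)} {h' = σ (hat D' y')} {W = σ (∏ D')}
            {g = constP (orientation (ord y) k)} {g' = constP (orientation (ord y') k')} {i = σ (ια y)} {i' = σ (ια y')}
            (σhat y) (σhat y') (cross p p') (Pair.restrictions-agree p α (ια y) (ια y') (hα y t) (hα y' t'))))
        (≋-sym (oriented-β k' t')))

    agree : ∀ z y k y' k' → T (incident z y k) → T (incident z y' k') → e y k *P B y k ≋ e y' k' *P B y' k'
    agree z y k y' k' h h' = go (F.proportional? y k) (F.proportional? y' k')
      where
      i = incident⇒ {z} {y} {k} h
      i' = incident⇒ {z} {y'} {k'} h'
      go : Dec (F.Proportional y k) → Dec (F.Proportional y' k') → e y k *P B y k ≋ e y' k' *P B y' k'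
      go (yes p) (yes p') = begin
        e y k *P B y k ≡⟨ cong ((e y k) *P_) (B-yes (Incident.isTop i) p) ⟩
        e y k *P σ (β y) ≈⟨ agree-proportional i i' p p' ⟩
        e y' k' *P σ (β y') ≡⟨ cong ((e y' k') *P_) (sym (B-yes (Incident.isTop i') p')) ⟩
        e y' k' *P B y' k' ∎
      -- Proportionality passes across the shared facet, so the mixed cases are contradictory.
      go (yes p) (no ¬p') = ⊥-elim (¬p' (proportional-across i i' p))
      go (no ¬p) (yes p') = ⊥-elim (¬p (proportional-across i' i p'))
      go (no ¬p) (no ¬p') = begin
        e y k *P B y k ≡⟨ cong ((e y k) *P_) (B-no ¬p) ⟩
        e y k *P 0P ≈⟨ ≋-trans (zeroʳ (e y k)) (≋-sym (zeroʳ (e y' k'))) ⟩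
        e y' k' *P 0P ≡⟨ cong ((e y' k') *P_) (sym (B-no ¬p')) ⟩
        e y' k' *P B y' k' ∎

    e-square : ∀ z y k → T (incident z y k) → e y k *P e y k ≋ 1P
    e-square z y k h = ≋-trans (≋-sym (constP-* (oriented y k) (oriented y k))) (≋-reflexive (cong constP
      (trans (solve 2 (λ s g → s :* g :* (s :* g) := (s :* s) :* (g :* g)) refl (sign y) (orientation (ord y) k))
        (cong₂ _*_ (sgn-square y (Incident.isTop (incident⇒ {z} {y} {k} h))) (orientation-square y k)))))

    -- A top cell has exactly one facet opposite a given vertex, namely `face`, so precisely one
    -- summand survives.
    counted : ∀ y k → B y k ≋ ∑ (λ z → if incident z y k then B y k else 0P)
    counted y k = go (rk y ℕ.≟ suc d)
      where
      go : Dec (Top y) → B y k ≋ ∑ (λ z → if incident z y k then B y k else 0P)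
      go (yes t) = ≋-sym (≋-trans (∑-only {f = λ z → if incident z y k then B y k else 0P} face off)
          (≋-reflexive (if-true (T⇒true (⇒incident {face} {y} {k} on)))))
        where
        open Facets (enum y t) k
        on : Incident face y k
        on = record { rank = face-rank ; isTop = t ; bound = face≤ ; missing = ⋢face }
        off : ∀ z → z ≢ face → (if incident z y k then B y k else 0P) ≋ 0P
        off z ne = ≋-reflexive (if-false (¬T⇒false (λ h → let i = incident⇒ {z} {y} {k} h in
          ne (face-unique (Incident.rank i) (Incident.bound i) (Incident.missing i)))))
      go (no ¬t) = ≋-trans (≋-reflexive (if-false (top-false ¬t)))
        (≋-sym (∑-zero {f = λ z → if incident z y k then B y k else 0P}
          (λ z → ≋-reflexive (if-false (¬T⇒false (λ h → ¬t (Incident.isTop (incident⇒ {z} {y} {k} h))))))))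

    e-cycle : ∀ z → ∑ (λ y → ∑ (λ k → if incident z y k then e y k else 0P)) ≋ 0P
    e-cycle z = begin
      ∑ (λ y → ∑ (λ k → if incident z y k then e y k else 0P)) ≈⟨ ∑-cong (λ y → ≋-trans (∑-cong (λ k → const-if (incident z y k) (oriented y k))) (≋-sym (constP-∑ (w y)))) ⟩
      ∑ (λ y → constP (∑ℚ (w y))) ≈⟨ ≋-sym (constP-∑ (λ y → ∑ℚ (w y))) ⟩
      constP (∑ℚ (λ y → ∑ℚ (w y))) ≡⟨ cong constP (cycle-sum z) ⟩
      constP 0ℚ ≈⟨ constP-0 ⟩
      0P ∎
      where
      w : Fin N → Fin (suc d) → ℚ
      w y k = if incident z y k then oriented y k else 0ℚ
      const-if : ∀ (c : Bool) q → (if c then constP {suc d} q else 0P) ≋ constP (if c then q else 0ℚ)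
      const-if true  q = ≋-refl
      const-if false q = ≋-sym constP-0

    residue-vanishes : σ (∑ b) ≋ 0P
    residue-vanishes = begin
      σ (∑ b) ≈⟨ σ-∑ b ⟩
      ∑ (λ y → σ (b y)) ≈⟨ ∑-cong {f = λ y → σ (b y)} {g = λ y → ∑ (B y)} σb ⟩
      ∑ (λ y → ∑ (B y)) ≈⟨ cancel-by-cells B e incident counted e-cycle agree e-square ⟩
      0P ∎

    -- The index sum times `ℓ` has denominator `∏ D'` and numerator `∑ b`. The vanishing residue
    -- makes this numerator divisible by `ℓ`, and `∏ D'` is invertible along `ℓ` because `σ` of it
    -- is not a zero divisor.
    regular : Regular ℓ (∑ (λ y → a y *P hat C y)) (∏ C)
    regular = ∏ D' , proj₁ divided , nzd-cancel {p = ℓ} ℓ-nzd cleared , coprime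
      where
      divided : Divides ℓ (∑ b)
      divided = σ-zero⇒divides residue-vanishes
      cleared : ℓ *P (∑ (λ y → a y *P hat C y) *P ∏ D') ≋ ℓ *P (proj₁ divided *P ∏ C)
      cleared = ≋-trans (clear-denominators a C D' Λ Λ* ℓ C-split Λ-complement)
        (≋-trans (*P-congʳ (∏ C) (proj₂ divided)) (*P-assoc ℓ (proj₁ divided) (∏ C)))
      coprime : ∀ q → Divides ℓ (q *P ∏ D') → Divides ℓ q
      coprime q (q' , eq) = σ-zero⇒divides (nzd-resp {p = ∏ (λ y → σ (D' y))} (≋-sym (σ-∏ D')) (nzd-∏ {f = λ y → σ (D' y)} σD-nzd) (σ q) (begin
        σ (∏ D') *P σ q ≈⟨ *P-comm (σ (∏ D')) (σ q) ⟩
        σ q *P σ (∏ D') ≈⟨ ≋-sym (σ-* q (∏ D')) ⟩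
        σ (q *P ∏ D') ≈⟨ ≋-trans (σ-cong eq) (σ-* ℓ q') ⟩
        σ ℓ *P σ q' ≈⟨ *P-congʳ (σ q') σℓ≋0 ⟩
        0P *P σ q' ≈⟨ zeroˡ (σ q') ⟩
        0P ∎))

  linear-factors : List (Fin N) → List (Poly (suc d))
  linear-factors = concatMap (λ y → tabulate (λ k → linV (column y (ord y k))))

  prodP-++ : ∀ (xs ys : List (Poly (suc d))) → prodP (xs ++ ys) ≋ prodP xs *P prodP ys
  prodP-++ []       ys = ≋-sym (*P-identityˡ (prodP ys))
  prodP-++ (x ∷ xs) ys = ≋-trans (*P-congˡ x (prodP-++ xs ys)) (≋-sym (*P-assoc x (prodP xs) (prodP ys)))

  -- `μ` is the product of the `m y`. Its inverse `ν`, the product of the determinants, is kept so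
  -- that the constant can be divided out of the final quotient.
  denominators-factor : ∀ ys → All.All Top ys → Σ ℚ λ μ → Σ ℚ λ ν → (ν * μ ≡ 1ℚ) ×
    (prodP (map denominator ys) ≋ constP μ *P prodP (linear-factors ys))
  denominators-factor [] [] = 1ℚ , 1ℚ , refl , ≋-sym (*P-identityˡ 1P)
  denominators-factor (y ∷ ys) (t ∷ ts) = step (denominators-factor ys ts)
    where
    δy = det (ThetaMat P (suc d) ord lθ y)
    rest = prodP (linear-factors ys)
    step : (Σ ℚ λ μ → Σ ℚ λ ν → (ν * μ ≡ 1ℚ) × (prodP (map denominator ys) ≋ constP μ *P rest)) →
      Σ ℚ λ μ → Σ ℚ λ ν → (ν * μ ≡ 1ℚ) × (denominator y *P prodP (map denominator ys) ≋ constP μ *P prodP (linear-factors (y ∷ ys)))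
    step (μ , ν , νμ , eq) = m y * μ , δy * ν ,
      trans (solve 4 (λ D n m u → D :* n :* (m :* u) := (m :* D) :* (n :* u)) refl δy ν (m y) μ) (cong₂ _*_ (hm y t) νμ) , (begin
      denominator y *P prodP (map denominator ys) ≈⟨ *P-cong (denominator-forms t) eq ⟩
      (constP (m y) *P forms y) *P (constP μ *P rest) ≈⟨ interchange (constP (m y)) (forms y) (constP μ) rest ⟩
      (constP (m y) *P constP μ) *P (forms y *P rest) ≈⟨ *P-cong (≋-sym (constP-* (m y) μ)) (≋-trans
          (*P-congʳ rest (≋-reflexive (sym (∏-tabulate (λ k → linV (column y (ord y k)))))))
          (≋-sym (prodP-++ (tabulate (λ k → linV (column y (ord y k)))) (linear-factors ys)))) ⟩
      constP (m y * μ) *P prodP (linear-factors (y ∷ ys)) ∎)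
      where
      open import Algebra.Properties.CommutativeSemigroup (CommutativeRing.*-commutativeSemigroup (polyRing (suc d))) using (interchange)

  linear-factors-all : ∀ {Q : Poly (suc d) → Set} → (∀ y → Top y → ∀ k → Q (linV (column y (ord y k)))) →
    ∀ {ys} → All.All Top ys → All.All Q (linear-factors ys)
  linear-factors-all h []       = []
  linear-factors-all h (t ∷ ts) = Allₚ.++⁺ (Allₚ.tabulate⁺ (h _ t)) (linear-factors-all h ts)

  tops-top : All.All Top (tops P (suc d))
  tops-top = All.map (λ {y} → ℕₚ.≡ᵇ⇒≡ (rk y) (suc d)) (Allₚ.all-filter (λ y → T? (top y)) (allFin N))

  nonzero-column : ∀ y → Top y → ∀ k → ∃ λ j → column y (ord y k) j ≢ 0ℚ
  nonzero-column y t k = Finₚ.¬∀⟶∃¬ (suc d) (λ j → column y (ord y k) j ≡ 0ℚ) (λ j → column y (ord y k) j ℚₚ.≟ 0ℚ) λ zero-column →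
    0≢1 (trans (sym (∑ℚ-zero (λ j → trans (cong ((Θ j (ord y k)) *_) (zero-column j)) (ℚₚ.*-zeroʳ (Θ j (ord y k))))))
      (trans (Cell.pairing y t k k) (kronecker-self k)))

  denominators-∏ : prodP (map denominator (tops P (suc d))) ≋ ∏ C
  denominators-∏ = ∏-filter N top denominator

  hat-tops : ∀ y → prodP (map denominator (filterᵇ (λ y' → not (eqF P y y')) (tops P (suc d)))) ≋ hat C y
  hat-tops y = begin
    prodP (map denominator (filterᵇ other (tops P (suc d)))) ≈⟨ ∏-foldr-filter other denominator (tops P (suc d)) ⟩
    prodP (map (λ y' → if other y' then denominator y' else 1P) (tops P (suc d))) ≈⟨ ∏-filter N top (λ y' → if other y' then denominator y' else 1P) ⟩
    ∏ (λ y' → if top y' then (if other y' then denominator y' else 1P) else 1P)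
      ≈⟨ ∏-cong (λ y' → ≋-reflexive (exchange-if (top y') (eqF P y y') (denominator y'))) ⟩
    hat C y ∎
    where
    other : Fin N → Bool
    other y' = not (eqF P y y')
    exchange-if : ∀ (t e : Bool) (c : Poly (suc d)) → (if t then (if not e then c else 1P) else 1P) ≡ (if e then 1P else (if t then c else 1P))
    exchange-if true  true  c = refl
    exchange-if true  false c = refl
    exchange-if false true  c = refl
    exchange-if false false c = refl

  numerator : Poly (suc d)
  numerator = sumP (map (λ y → scaleP (sign y) (ια y *P prodP (map denominator (filterᵇ (λ y' → not (eqF P y y')) (tops P (suc d)))))) (tops P (suc d)))

  numerator-∑ : numerator ≋ ∑ (λ y → a y *P hat C y)
  numerator-∑ = ≋-trans (∑-filter N top summand) (∑-cong term)
    where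
    summand : Fin N → Poly (suc d)
    summand y = scaleP (sign y) (ια y *P prodP (map denominator (filterᵇ (λ y' → not (eqF P y y')) (tops P (suc d)))))
    summand≋ : ∀ y → summand y ≋ scaleP (sign y) (ια y) *P hat C y
    summand≋ y = ≋-trans (scaleP-cong (sign y) (*P-congˡ (ια y) (hat-tops y)))
      (≋-trans (scaleP-≋ (sign y) (ια y *P hat C y)) (≋-trans (≋-sym (*P-assoc (constP (sign y)) (ια y) (hat C y)))
        (*P-congʳ (hat C y) (≋-sym (scaleP-≋ (sign y) (ια y))))))
    pull : ∀ (t : Bool) {s x h : Poly (suc d)} → s ≋ x *P h → (if t then s else 0P) ≋ (if t then x else 0P) *P h
    pull true          eq = eq
    pull false {h = h} eq = ≋-sym (zeroˡ h)
    term : ∀ y → (if top y then summand y else 0P) ≋ a y *P hat C y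
    term y = pull (top y) {summand y} {scaleP (sign y) (ια y)} {hat C y} (summand≋ y)

  -- Each linear factor of a denominator is nonzero and can serve as `ℓ` in `AtForm.regular`, so
  -- `product-divides` removes them all. The remaining constant is undone by `ν`.
  index-polynomial : IndexPolynomial P (suc d) sgn m ια (ThetaProd P (suc d) ord lθ)
  index-polynomial = conclude (denominators-factor (tops P (suc d)) tops-top)
    where
    xs = linear-factors (tops P (suc d))
    𝒩 = ∑ (λ y → a y *P hat C y)
    regular-factors : ∀ μ → ∏ C ≋ constP μ *P prodP xs → All.All (λ ℓ → Regular ℓ 𝒩 (prodP xs)) xs
    regular-factors μ eq = linear-factors-all {λ ℓ → Regular ℓ 𝒩 (prodP xs)} regular-at tops-top
      where
      regular-at : ∀ y → Top y → ∀ k → Regular (linV (column y (ord y k))) 𝒩 (prodP xs)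
      regular-at y t k = rescale (AtForm.regular (column y (ord y k)) (proj₁ nz) (proj₁ inv) (proj₂ inv))
        where
        nz = nonzero-column y t k
        inv = ℚ-inverse (column y (ord y k) (proj₁ nz)) (proj₂ nz)
        rescale : Regular (linV (column y (ord y k))) 𝒩 (∏ C) → Regular (linV (column y (ord y k))) 𝒩 (prodP xs)
        -- `∏ C` is `μ` times `prodP xs`; the constant moves into the numerator `U`.
        rescale (V , U , 𝒩V , coprime) = V , U *P constP μ ,
          ≋-trans 𝒩V (≋-trans (*P-congˡ U eq) (≋-sym (*P-assoc U (constP μ) (prodP xs)))) , coprime
    conclude : (Σ ℚ λ μ → Σ ℚ λ ν → (ν * μ ≡ 1ℚ) × (prodP (map denominator (tops P (suc d))) ≋ constP μ *P prodP xs)) →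
      IndexPolynomial P (suc d) sgn m ια (ThetaProd P (suc d) ord lθ)
    conclude (μ , ν , νμ , eq) = quotient (product-divides xs 𝒩
        (linear-factors-all {NonZeroDivisor} (λ y t k → linV-nzd (column y (ord y k)) (proj₁ (nonzero-column y t k)) (proj₂ (nonzero-column y t k))) tops-top)
        (regular-factors μ (≋-trans (≋-sym denominators-∏) eq)))
      where
      quotient : Divides (prodP xs) 𝒩 → IndexPolynomial P (suc d) sgn m ια (ThetaProd P (suc d) ord lθ)
      quotient (q , 𝒩≋) = constP ν *P q , at (begin
        (constP ν *P q) *P prodP (map denominator (tops P (suc d))) ≈⟨ *P-congˡ (constP ν *P q) eq ⟩
        (constP ν *P q) *P (constP μ *P prodP xs) ≈⟨ interchange (constP ν) q (constP μ) (prodP xs) ⟩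
        (constP ν *P constP μ) *P (q *P prodP xs) ≈⟨ *P-cong (≋-trans (≋-sym (constP-* ν μ)) (≋-reflexive (cong constP νμ))) (*P-comm q (prodP xs)) ⟩
        1P *P (prodP xs *P q) ≈⟨ *P-identityˡ (prodP xs *P q) ⟩
        prodP xs *P q ≈⟨ ≋-sym 𝒩≋ ⟩
        𝒩 ≈⟨ ≋-sym numerator-∑ ⟩
        numerator ∎)
        where open import Algebra.Properties.CommutativeSemigroup (CommutativeRing.*-commutativeSemigroup (polyRing (suc d))) using (interchange)

product-of-ones : ∀ {k} {A : Set} (f : A → Poly k) {xs} → All.All (λ x → f x ≋ 1P) xs → prodP (map f xs) ≋ 1P
product-of-ones f []       = ≋-refl
product-of-ones f (h ∷ hs) = ≋-trans (*P-cong h (product-of-ones f hs)) (*P-identityˡ 1P)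

unit-square : ∀ {i} → i ≡ ℤ.+ 1 ⊎ i ≡ ℤ.-[1+ 0 ] → (i ℚ./ 1) * (i ℚ./ 1) ≡ 1ℚ
unit-square (inj₁ refl) = refl
unit-square (inj₂ refl) = refl

open import Data.Integer using (+_; -[1+_])

theorem4p1 : (P : SimplicialPoset) (d : ℕ) → HasRank P d →
    (Θ : Fin d → Fin (SimplicialPoset.N P) → ℚ) → DegreeOne P Θ → IsLSOP P Θ →
    PseudoCond P d →
    (sgn : Fin (SimplicialPoset.N P) → ℤ) →
    (∀ y → SimplicialPoset.rk P y ≡ d → sgn y ≡ + 1 ⊎ sgn y ≡ -[1+ 0 ]) →
    (ord : Fin (SimplicialPoset.N P) → Fin d → Fin (SimplicialPoset.N P)) →
    (∀ y → SimplicialPoset.rk P y ≡ d → EnumAtoms P y (ord y)) →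
    (lθ : Fin (SimplicialPoset.N P) → Fin (SimplicialPoset.N P) → Poly d) →
    (∀ y → SimplicialPoset.rk P y ≡ d → ∀ x → IsAtom P x → _≤P_ P x y →
    _≡[_]_ P (var x) (below P y) (evalP (lθ y x) (θP P Θ))) →
    (∀ y → SimplicialPoset.rk P y ≡ d → 0ℚ < det (ThetaMat P d ord lθ y)) →
    CycleCond P d sgn ord →
    (m : Fin (SimplicialPoset.N P) → ℚ) →
    (∀ y → SimplicialPoset.rk P y ≡ d → m y * det (ThetaMat P d ord lθ y) ≡ 1ℚ) →
    (α : Poly (SimplicialPoset.N P)) → (ια : Fin (SimplicialPoset.N P) → Poly d) →
    (∀ y → SimplicialPoset.rk P y ≡ d →
    _≡[_]_ P α (below P y) (evalP (ια y) (θP P Θ))) →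
    IndexPolynomial P d sgn m ια (ThetaProd P d ord lθ)
-- In rank zero there is no vertex to remove. The product of forms is empty and the determinant is
-- 1, so `hm` says that each denominator is 1 and the numerator itself is the required polynomial.
theorem4p1 P zero _ _ _ _ _ sgn _ ord _ lθ _ _ _ m hm _ ια _ =
  numerator , at (≋-trans (*P-congˡ numerator
    (product-of-ones denominator (All.map (λ {y} → is-one {y}) rank-zero))) (*-identityʳ numerator))
  where
  open SimplicialPoset P using (N; rk)
  denominator : Fin N → Poly 0
  denominator y = scaleP (m y) (ThetaProd P 0 ord lθ y)
  numerator : Poly 0
  numerator = sumP (map (λ y → scaleP (sgn y ℚ./ 1) (ια y *P prodP (map denominator
    (filterᵇ (λ y' → not (eqF P y y')) (tops P 0))))) (tops P 0))
  rank-zero : All.All (λ y → rk y ≡ 0) (tops P 0)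
  rank-zero = All.map (λ {y} → ℕₚ.≡ᵇ⇒≡ (rk y) 0) (Allₚ.all-filter (λ y → T? (rk y ℕ.≡ᵇ 0)) (allFin N))
  is-one : ∀ {y} → rk y ≡ 0 → denominator y ≋ 1P
  is-one {y} t = ≋-reflexive (cong constP (hm y t))
theorem4p1 P (suc d) _ Θ Θ₁ _ _ sgn sgn± ord enum lθ hθ _ cycle m hm α ια hα =
  Index.index-polynomial P Θ Θ₁ sgn (λ y t → unit-square (sgn± y t)) ord enum lθ hθ cycle m hm α ια hα
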